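{- For every integer $k\ge 2$, the number of $k$-SAT functions on $n$ Boolean variables is at most $2^{(\pi(\vec T_k,\log_2 3)+o(1))\binom nk}$ as $n\to\infty$.
   Context: $k$-SAT setting: variables $x_1,\dots,x_n$; literals $x_i,\overline{x_i}$; a clause is a conjunction of $k$ literals on $k$ distinct variables; a formula is a set of clauses and represents the OR of its clauses; a $k$-SAT function is a function $\{0,1\}^n\to\{0,1\}$ represented by some $k$-SAT formula. A partially directed $k$-graph ($k$-PDG) on a vertex set $V$ specifies for each $k$-subset $S\subseteq V$ exactly one of: no edge on $S$; an undirected edge on $S$; or a directed edge on $S$ directed toward a chosen vertex of $S$. For an $n$-vertex $k$-PDG $\vec H$, $\alpha(\vec H)=e_u(\vec H)/\binom nk$ and $\beta(\vec H)=e_d(\vec H)/\binom nk$ where $e_u,e_d$ count undirected and directed edges. $\vec F$ is a subgraph of $\vec H$ if a $k$-PDG isomorphic to $\vec F$ can be obtained from $\vec H$ by deleting edges, deleting vertices and forgetting directions of edges; $\vec H$ is $\vec F$-free if $\vec F$ is not a subgraph. $\vec T_k$ is the $k$-PDG on $\{1,\dots,k+1\}$ with undirected edges $\{1,\dots,k\}$, $\{2,\dots,k+1\}$ and the edge $\{1,\dots,k-1,k+1\}$ directed toward $k+1$. $\pi(\vec F,\theta)$ is the smallest real number such that every $n$-vertex $\vec F$-free $k$-PDG $\vec H$ satisfies $\alpha(\vec H)+\theta\beta(\vec H)\le\pi(\vec F,\theta)+o_{n\to\infty}(1)$. -}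

module Defs where

open import Data.Nat using (ℕ; zero; suc; _+_; _*_; _^_; _≤_)
open import Data.Nat.Combinatorics using (_C_)
open import Data.Bool using (Bool; true; false; _∧_; _∨_; not; if_then_else_)
open import Data.Fin using (Fin; zero; suc; fromℕ; inject₁)
import Data.Fin as F
open import Data.Fin.Subset using (Subset; ∣_∣; ∁; ⁅_⁆; _∈_)
open import Data.Vec using (Vec; []; _∷_; tabulate; lookup)
open import Data.Vec.Properties using (≡-dec)
import Data.Bool as B
open import Data.List using (List; []; _∷_; _++_; map; length)
open import Data.List.Relation.Unary.All using (All)
open import Data.List.Relation.Unary.AllPairs using (AllPairs)
open import Data.Product using (Σ; _×_; ∃)
open import Data.Unit using (⊤)
open import Function.Definitions using (Injective)
open import Relation.Binary.PropositionalEquality using (_≡_; _≢_)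
open import Relation.Nullary using (does)
import Data.Nat as N

allF : ∀ {m} → (Fin m → Bool) → Bool
allF {zero}  f = true
allF {suc m} f = f zero ∧ allF (λ i → f (suc i))

anyF : ∀ {m} → (Fin m → Bool) → Bool
anyF {zero}  f = false
anyF {suc m} f = f zero ∨ anyF (λ i → f (suc i))

anyL : ∀ {A : Set} → (A → Bool) → List A → Bool
anyL p []       = false
anyL p (x ∷ xs) = p x ∨ anyL p xs

countL : ∀ {A : Set} → (A → Bool) → List A → ℕ
countL p []       = 0
countL p (x ∷ xs) = (if p x then 1 else 0) + countL p xs

Assignment : ℕ → Set
Assignment n = Fin n → Bool

-- A clause: a conjunction of k literals on k distinct variables.
-- Literal i is the variable var i, positive if sign i = true,
-- negated if sign i = false.
record Clause (k n : ℕ) : Set where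
  field
    var      : Fin k → Fin n
    sign     : Fin k → Bool
    distinct : Injective _≡_ _≡_ var
open Clause public

evalLit : ∀ {n} → Fin n → Bool → Assignment n → Bool
evalLit x true  a = a x
evalLit x false a = not (a x)

evalClause : ∀ {k n} → Clause k n → Assignment n → Bool
evalClause cl a = allF (λ i → evalLit (var cl i) (sign cl i) a)

-- A formula is a (finite) set of clauses, represented as a list;
-- it represents the OR of its clauses.
Formula : ℕ → ℕ → Set
Formula k n = List (Clause k n)

evalFormula : ∀ {k n} → Formula k n → Assignment n → Bool
evalFormula Φ a = anyL (λ cl → evalClause cl a) Φ

BoolFun : ℕ → Set
BoolFun n = Assignment n → Bool

IsKSAT : (k : ℕ) → ∀ {n} → BoolFun n → Set
IsKSAT k {n} f = Σ (Formula k n) λ Φ → ∀ a → f a ≡ evalFormula Φ a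

Distinct : ∀ {n} → BoolFun n → BoolFun n → Set
Distinct f g = ∃ λ a → f a ≢ g a

-- L is a list of pairwise distinct k-SAT functions on n variables.
-- "The number of k-SAT functions is at most B" is expressed as:
-- every such list has length at most B.
DistinctKSATList : (k n : ℕ) → List (BoolFun n) → Set
DistinctKSATList k n L = All (IsKSAT k) L × AllPairs Distinct L

-- state of a k-subset: no edge, undirected edge, or edge directed toward v
data Label (n : ℕ) : Set where
  none  : Label n
  undir : Label n
  dir   : Fin n → Label n

allSubsets : (n : ℕ) → List (Subset n)
allSubsets zero    = [] ∷ []
allSubsets (suc n) = map (true ∷_) (allSubsets n) ++ map (false ∷_) (allSubsets n)

isKSet : ∀ {n} → ℕ → Subset n → Bool
isKSet k S = does (∣ S ∣ N.≟ k)

-- Only the labels of k-subsets are relevant; labels of other subsets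
-- are ignored everywhere.  A directed edge points to a vertex of its set.
record PDG (k n : ℕ) : Set where
  field
    label : Subset n → Label n
    dirIn : ∀ S v → ∣ S ∣ ≡ k → label S ≡ dir v → v ∈ S
open PDG public

isUndir : ∀ {n} → Label n → Bool
isUndir undir = true
isUndir _     = false

isDir : ∀ {n} → Label n → Bool
isDir (dir _) = true
isDir _       = false

eU : ∀ {k n} → PDG k n → ℕ
eU {k} {n} H = countL (λ S → isKSet k S ∧ isUndir (label H S)) (allSubsets n)

eD : ∀ {k n} → PDG k n → ℕ
eD {k} {n} H = countL (λ S → isKSet k S ∧ isDir (label H S)) (allSubsets n)

image : ∀ {m n} → (Fin m → Fin n) → Subset m → Subset n
image φ S = tabulate λ j → anyF (λ i → lookup S i ∧ does (φ i F.≟ j))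

Match : ∀ {m n} → (Fin m → Fin n) → Label m → Label n → Set
Match φ none    l = ⊤
Match φ undir   l = l ≢ none
Match φ (dir v) l = l ≡ dir (φ v)

-- F (given by its labelling of k-subsets of Fin m) is a subgraph of H:
-- an injective vertex map such that every undirected edge of F is sent
-- onto an edge of H (of any kind: directions may be forgotten), and every
-- edge of F directed toward v is sent onto an edge of H directed toward φ v.
Contains : ∀ {k m n} → (Subset m → Label m) → PDG k n → Set
Contains {k} {m} {n} labF H =
  Σ (Fin m → Fin n) λ φ → Injective _≡_ _≡_ φ ×
    (∀ (S : Subset m) → ∣ S ∣ ≡ k → Match φ (labF S) (label H (image φ S)))

-- the vertex k-1 of Fin (suc k) (paper's vertex k); only meaningful for k ≥ 1
km1 : (k : ℕ) → Fin (suc k)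
km1 zero    = zero
km1 (suc k) = inject₁ (fromℕ k)

_=S_ : ∀ {n} → Subset n → Subset n → Bool
S =S T = does (≡-dec B._≟_ S T)

-- T_k on vertices 0..k (paper's 1..k+1 shifted down by one):
-- undirected edges {0..k-1} = ∁⁅k⁆, {1..k} = ∁⁅0⁆, and the edge
-- {0..k-2,k} = ∁⁅k-1⁆ directed toward k.
Tk : (k : ℕ) → Subset (suc k) → Label (suc k)
Tk k S =
  if S =S ∁ ⁅ fromℕ k ⁆ then undir else
  if S =S ∁ ⁅ zero ⁆ then undir else
  if S =S ∁ ⁅ km1 k ⁆ then dir (fromℕ k) else none

TkFree : ∀ {k n} → PDG k n → Set
TkFree {k} H = Contains (Tk k) H → Data.Empty.⊥
  where import Data.Empty

-- Rational c = p / q (q ≥ 1) is an admissible value in the definition of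
-- π(T_k, log₂ 3): every n-vertex T_k-free k-PDG H satisfies
--   α(H) + log₂3 · β(H) ≤ c + o(1),
-- i.e. for every rational ε = a / b > 0 there is N such that for n ≥ N,
--   e_u + log₂3 · e_d ≤ (p/q + a/b) · (n choose k),
-- written exactly (exponentiating base 2, multiplying by q·b) as
--   2^(q b e_u) · 3^(q b e_d) ≤ 2^((p b + a q) (n choose k)).
AdmissibleT : (k p q : ℕ) → Set
AdmissibleT k p q =
  (a b : ℕ) → 1 ≤ a → 1 ≤ b → Σ ℕ λ N → ∀ n → N ≤ n → (H : PDG k n) → TkFree H →
    (2 ^ (q * b * eU H)) * (3 ^ (q * b * eD H)) ≤ 2 ^ ((p * b + a * q) * (n C k))

{-# OPTIONS --safe #-}
-- A k-SAT function has a minimal formula: every clause has a witness, an assignment satisfying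
-- that clause and no other.  Take a random formula from the list.  Revealing its clauses that meet
-- a bounded set W of variables costs o(n^k) bits, and the energy (mean squared conditional
-- probability of a clause) grows with W, so for some W revealing a few further variables hardly
-- changes it.  Given the clauses meeting such a W, bounded configurations of clauses that each have
-- conditional probability at least 1/d then occur together in some formula of the list.
--
-- Let D be the set of these likely clauses.  Blow-ups of the following patterns contradict
-- minimality, because a witness gives opposite values to twin variables and hence satisfies any
-- clause on a suitable choice of twins; so by Cauchy-Schwarz the patterns are rare:
--   two clauses of one formula on the same variables; two clauses of D on the same variables with
--   at least two different signs; the edges of T_k, where a k-set is an edge if it carries a clause
--   of D, directed if it carries two.
-- Hence most restrictions to a bounded random set of variables are T_k-free, and averaging bounds
-- 2^e_u 3^e_d.  Apart from few exceptional k-sets a formula picks at most one clause of D on every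
-- k-set, which leaves 2 choices on an undirected and 3 on a directed edge.

module Submission where

open import Defs hiding (none)
import Defs
open import Data.Bool using (Bool; true; false; _∧_; _∨_; not; if_then_else_; T; _xor_)
import Data.Bool.Properties as Bool
open import Data.Empty using (⊥; ⊥-elim)
open import Data.Fin as Fin using (Fin; zero; suc; fromℕ; inject₁; _↑ˡ_; punchIn; punchOut)
import Data.Fin.Properties as Fin
open import Data.Fin.Subset using (Subset; ∣_∣; ∁; ⁅_⁆)
open import Data.List using (List; []; _∷_; _++_; map; length; concatMap; allFin; filterᵇ; filter)
import Data.List as List
import Data.List.Membership.DecPropositional as DecMem
open import Data.List.Membership.Propositional using (_∈_; find; lose)
open import Data.List.Membership.Propositional.Properties using (∈-concatMap⁺; ∈-map⁺; ∈-map⁻; ∈-allFin; ∈-++⁺ˡ; ∈-++⁺ʳ; ∈-++⁻; ∈-filter⁻; ∈-filter⁺; ∈-lookup)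
open import Data.List.Properties using (length-tabulate; length-map; length-++; filter-notAll)
import Data.List.Properties as ListP
import Data.List.Relation.Unary.All as ListAll
open import Data.List.Relation.Unary.All.Properties using (¬All⇒Any¬)
import Data.List.Relation.Unary.All.Properties as ListAll
open import Data.List.Relation.Unary.AllPairs using (AllPairs; []; _∷_)
import Data.List.Relation.Unary.AllPairs as AllPairs
import Data.List.Relation.Unary.AllPairs.Properties as AllPairs
open import Data.List.Relation.Unary.Any using (here; there)
import Data.List.Relation.Unary.Any as Any
open import Data.Maybe using (Maybe; just; nothing; is-just)
open import Data.Maybe.Properties using (just-injective) renaming (≡-dec to Maybe-≡-dec)
open import Data.Nat
open import Data.Nat.Combinatorics using (nCk+nC[k+1]≡[n+1]C[k+1]) renaming (_C_ to _choose_)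
open import Data.Nat.Divisibility using (_∣_; ∣-trans; n∣m*n; m∣m*n)
open import Data.Nat.DivMod using (_/_; m*[n/m]≡n; m/n*n≤m; m*n/n≡m; /-monoˡ-≤)
open import Data.Nat.Properties
open import Algebra.Properties.CommutativeSemigroup +-commutativeSemigroup using (interchange)
open import Data.Nat.Tactic.RingSolver using (solve-∀)
open import Data.Product using (Σ; _×_; _,_; proj₁; proj₂; ∃)
open import Data.Sum using (_⊎_; inj₁; inj₂)
open import Data.Unit using (⊤; tt)
open import Data.Vec as Vec using (Vec; []; _∷_; lookup; _[_]≔_; removeAt; replicate; insertAt; last; tabulate)
open import Data.Vec.Properties using ([]≔-commutes; map-[]≔; lookup∘update; lookup∘update′; lookup-replicate; ∷-injective; lookup-++ˡ; lookup∘tabulate; tabulate∘lookup; tabulate-cong; map-replicate; lookup-map; insertAt-lookup; insertAt-punchIn; removeAt-insertAt; removeAt-punchOut; toList∘fromList; lookup⇒[]=; ≡-dec)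
open import Data.Vec.Relation.Unary.All using (All; []; _∷_)
open import Data.Vec.Relation.Unary.All.Properties using (lookup⁺)
open import Data.Vec.Relation.Unary.AllPairs using ([]; _∷_)
open import Data.Vec.Relation.Unary.Unique.Propositional using (Unique)
open import Function.Definitions using (Injective)
open import Relation.Binary.Definitions using (DecidableEquality)
open import Relation.Binary.PropositionalEquality hiding (J)
open import Relation.Nullary using (Dec; yes; no; ¬_; does)
open import Relation.Nullary.Decidable using (dec-true; dec-false; _×-dec_; _⊎-dec_; ¬?)

-- Likely clauses are correlated and need not occur together. But a configuration selects from
-- `k + 1` pairs of twins, and each clause uses `k` of the `2 * (k + 1)` variables: of two clauses
-- on different variable sets, each has a variable outside the other. Revealing all clauses through
-- the `k + 2` variables outside one clause thus decides all the others; unless this drops its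
-- conditional probability below `1 / 2d`, the clause can be added to them at the cost of a factor
-- `2d`. The argument fails for two clauses on the same variables. This is why likely clauses on one
-- `k`-set may differ in one sign `l`: the second clause of the contradiction would use the
-- variables of the twin clause for `l`. The place of that difference becomes the direction. In
-- `T_k` a witness of the first edge leaves the last vertex free; the second edge excludes one value
-- there, and the directed edge, which offers both signs, excludes the other. Probabilities are
-- scaled by a common multiple of all class sizes, and `log₂ 3` is avoided by powers of 2 and 3, so
-- all arithmetic is in `ℕ`.

private variable
  A A′ : Set
  n j k p r m : ℕ

-- Finite sums, Cauchy-Schwarz, and sums over tuples.

∑ : List A → (A → ℕ) → ℕ
∑ []       f = 0
∑ (x ∷ xs) f = f x + ∑ xs f

⟦_⟧ : Bool → ℕ
⟦ true ⟧  = 1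
⟦ false ⟧ = 0

⟦⟧≤1 : ∀ b → ⟦ b ⟧ ≤ 1
⟦⟧≤1 true  = ≤-refl
⟦⟧≤1 false = z≤n

∑-cong : (xs : List A) {f g : A → ℕ} → (∀ x → f x ≡ g x) → ∑ xs f ≡ ∑ xs g
∑-cong []       e = refl
∑-cong (x ∷ xs) e = cong₂ _+_ (e x) (∑-cong xs e)

∑-mono-∈ : (xs : List A) {f g : A → ℕ} → (∀ x → x ∈ xs → f x ≤ g x) → ∑ xs f ≤ ∑ xs g
∑-mono-∈ []       e = z≤n
∑-mono-∈ (x ∷ xs) e = +-mono-≤ (e x (here refl)) (∑-mono-∈ xs λ y p → e y (there p))

∑-mono : (xs : List A) {f g : A → ℕ} → (∀ x → f x ≤ g x) → ∑ xs f ≤ ∑ xs g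
∑-mono xs e = ∑-mono-∈ xs λ x _ → e x

∑-+ : (xs : List A) (f g : A → ℕ) → ∑ xs (λ x → f x + g x) ≡ ∑ xs f + ∑ xs g
∑-+ []       f g = refl
∑-+ (x ∷ xs) f g = trans (cong (f x + g x +_) (∑-+ xs f g)) (interchange (f x) (g x) (∑ xs f) (∑ xs g))

∑-*ˡ : (xs : List A) (c : ℕ) (f : A → ℕ) → ∑ xs (λ x → c * f x) ≡ c * ∑ xs f
∑-*ˡ []       c f = sym (*-zeroʳ c)
∑-*ˡ (x ∷ xs) c f = trans (cong (c * f x +_) (∑-*ˡ xs c f)) (sym (*-distribˡ-+ c (f x) (∑ xs f)))

∑-*ʳ : (xs : List A) (f : A → ℕ) (c : ℕ) → ∑ xs (λ x → f x * c) ≡ ∑ xs f * c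
∑-*ʳ xs f c = trans (∑-cong xs λ x → *-comm (f x) c) (trans (∑-*ˡ xs c f) (*-comm c (∑ xs f)))

∑-const : (xs : List A) (c : ℕ) → ∑ xs (λ _ → c) ≡ length xs * c
∑-const []       c = refl
∑-const (x ∷ xs) c = cong (c +_) (∑-const xs c)

∑-zero : (xs : List A) → ∑ xs (λ _ → 0) ≡ 0
∑-zero xs = trans (∑-const xs 0) (*-zeroʳ (length xs))

∑-bound : (xs : List A) {f : A → ℕ} {c : ℕ} → (∀ x → f x ≤ c) → ∑ xs f ≤ length xs * c
∑-bound xs {c = c} e = ≤-trans (∑-mono xs e) (≤-reflexive (∑-const xs c))

∑-swap : (xs : List A) (ys : List A′) (f : A → A′ → ℕ) →
         ∑ xs (λ x → ∑ ys (f x)) ≡ ∑ ys (λ y → ∑ xs λ x → f x y)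
∑-swap []       ys f = sym (∑-zero ys)
∑-swap (x ∷ xs) ys f =
  trans (cong (∑ ys (f x) +_) (∑-swap xs ys f)) (sym (∑-+ ys (f x) λ y → ∑ xs λ x → f x y))

∑-++ : (xs ys : List A) (f : A → ℕ) → ∑ (xs ++ ys) f ≡ ∑ xs f + ∑ ys f
∑-++ []       ys f = refl
∑-++ (x ∷ xs) ys f = trans (cong (f x +_) (∑-++ xs ys f)) (sym (+-assoc (f x) _ _))

∑-map : (h : A → A′) (xs : List A) (f : A′ → ℕ) → ∑ (map h xs) f ≡ ∑ xs (λ x → f (h x))
∑-map h []       f = refl
∑-map h (x ∷ xs) f = cong (f (h x) +_) (∑-map h xs f)

∑-concatMap : (h : A → List A′) (xs : List A) (f : A′ → ℕ) → ∑ (concatMap h xs) f ≡ ∑ xs (λ x → ∑ (h x) f)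
∑-concatMap h []       f = refl
∑-concatMap h (x ∷ xs) f = trans (∑-++ (h x) _ f) (cong (∑ (h x) f +_) (∑-concatMap h xs f))

∑-∈ : {xs : List A} {x : A} (f : A → ℕ) → x ∈ xs → f x ≤ ∑ xs f
∑-∈ f (here refl) = m≤m+n _ _
∑-∈ f (there p)   = ≤-trans (∑-∈ f p) (m≤n+m _ _)

length≡∑1 : (xs : List A) → length xs ≡ ∑ xs (λ _ → 1)
length≡∑1 xs = sym (trans (∑-const xs 1) (*-identityʳ (length xs)))

∑-find : (xs : List A) (f : A → ℕ) (c : ℕ) → 1 ≤ length xs → ∑ xs f ≤ length xs * c → ∃ λ x → f x ≤ c
∑-find (x ∷ xs) f c _ h = go x xs h
  where
  go : ∀ x xs → f x + ∑ xs f ≤ c + length xs * c → ∃ λ x → f x ≤ c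
  go x xs h with f x ≤? c
  go x xs       h | yes p = x , p
  go x []       h | no ¬p = x , subst₂ _≤_ (+-identityʳ (f x)) (+-identityʳ c) h
  go x (y ∷ xs) h | no ¬p = go y xs (+-cancelˡ-≤ c _ _ (≤-trans (+-monoˡ-≤ _ (<⇒≤ (≰⇒> ¬p))) h))

2ab≤a²+b² : ∀ a b → 2 * (a * b) ≤ a * a + b * b
2ab≤a²+b² a b with ≤-total a b
... | inj₁ a≤b with m≤n⇒∃[o]m+o≡n a≤b
... | (c , refl) = ≤-trans (m≤m+n _ (c * c)) (≤-reflexive (lem a c))
  where lem : ∀ a c → 2 * (a * (a + c)) + c * c ≡ a * a + (a + c) * (a + c)
        lem = solve-∀
2ab≤a²+b² a b | inj₂ b≤a with m≤n⇒∃[o]m+o≡n b≤a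
... | (c , refl) = ≤-trans (m≤m+n _ (c * c)) (≤-reflexive (lem b c))
  where lem : ∀ b c → 2 * ((b + c) * b) + c * c ≡ (b + c) * (b + c) + b * b
        lem = solve-∀

∑-cauchy-schwarz : (xs : List A) (f : A → ℕ) → ∑ xs f * ∑ xs f ≤ length xs * ∑ xs (λ x → f x * f x)
∑-cauchy-schwarz xs f = *-cancelˡ-≤ 2 (begin
  2 * (∑ xs f * ∑ xs f)                                        ≡⟨ cong (2 *_) (sym (∑-*ʳ xs f (∑ xs f))) ⟩
  2 * ∑ xs (λ x → f x * ∑ xs f)                                ≡⟨ sym (∑-*ˡ xs 2 _) ⟩
  ∑ xs (λ x → 2 * (f x * ∑ xs f))                              ≡⟨ ∑-cong xs (λ x → trans (cong (2 *_) (sym (∑-*ˡ xs (f x) f))) (sym (∑-*ˡ xs 2 _))) ⟩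
  ∑ xs (λ x → ∑ xs λ y → 2 * (f x * f y))                      ≤⟨ ∑-mono xs (λ x → ∑-mono xs λ y → 2ab≤a²+b² (f x) (f y)) ⟩
  ∑ xs (λ x → ∑ xs λ y → f x * f x + f y * f y)                ≡⟨ ∑-cong xs (λ x → trans (∑-+ xs _ _) (cong (_+ S) (∑-const xs _))) ⟩
  ∑ xs (λ x → length xs * (f x * f x) + S)                     ≡⟨ trans (∑-+ xs _ _) (cong₂ _+_ (∑-*ˡ xs (length xs) _) (∑-const xs S)) ⟩
  length xs * S + length xs * S                                ≡⟨ sym (cong (length xs * S +_) (+-identityʳ _)) ⟩
  2 * (length xs * S) ∎)
  where open ≤-Reasoning
        S = ∑ xs (λ x → f x * f x)

vecs : List A → (m : ℕ) → List (Vec A m)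
vecs xs zero    = [] ∷ []
vecs xs (suc m) = concatMap (λ v → map (v ∷_) (vecs xs m)) xs

∑-vecs : (xs : List A) (m : ℕ) (f : Vec A (suc m) → ℕ) →
         ∑ (vecs xs (suc m)) f ≡ ∑ xs (λ v → ∑ (vecs xs m) λ t → f (v ∷ t))
∑-vecs xs m f = trans (∑-concatMap _ xs f) (∑-cong xs λ v → ∑-map (v ∷_) (vecs xs m) f)

length-vecs : (xs : List A) (m : ℕ) → length (vecs xs m) ≡ length xs ^ m
length-vecs xs zero    = refl
length-vecs xs (suc m) = begin
  length (vecs xs (suc m))                           ≡⟨ length≡∑1 (vecs xs (suc m)) ⟩
  ∑ (vecs xs (suc m)) (λ _ → 1)                      ≡⟨ ∑-vecs xs m _ ⟩
  ∑ xs (λ v → ∑ (vecs xs m) λ _ → 1)                 ≡⟨ ∑-const xs _ ⟩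
  length xs * ∑ (vecs xs m) (λ _ → 1)                ≡⟨ cong (length xs *_) (sym (length≡∑1 (vecs xs m))) ⟩
  length xs * length (vecs xs m)                     ≡⟨ cong (length xs *_) (length-vecs xs m) ⟩
  length xs ^ suc m ∎
  where open ≡-Reasoning

∑-vecs-++ : (xs : List A) (a b : ℕ) (f : Vec A (a + b) → ℕ) →
            ∑ (vecs xs (a + b)) f ≡ ∑ (vecs xs a) (λ s → ∑ (vecs xs b) λ t → f (s Vec.++ t))
∑-vecs-++ xs zero    b f = sym (+-identityʳ _)
∑-vecs-++ xs (suc a) b f = begin
  ∑ (vecs xs (suc a + b)) f                                                    ≡⟨ ∑-vecs xs (a + b) f ⟩
  ∑ xs (λ v → ∑ (vecs xs (a + b)) λ t → f (v ∷ t))                             ≡⟨ ∑-cong xs (λ v → ∑-vecs-++ xs a b _) ⟩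
  ∑ xs (λ v → ∑ (vecs xs a) λ s → ∑ (vecs xs b) λ t → f (v ∷ s Vec.++ t))      ≡⟨ sym (∑-vecs xs a _) ⟩
  ∑ (vecs xs (suc a)) (λ s → ∑ (vecs xs b) λ t → f (s Vec.++ t)) ∎
  where open ≡-Reasoning

∈-vecs : {xs : List A} → (∀ x → x ∈ xs) → ∀ {m} (v : Vec A m) → v ∈ vecs xs m
∈-vecs all []      = here refl
∈-vecs all (x ∷ v) = ∈-concatMap⁺ _ (Any.map (λ { refl → ∈-map⁺ (x ∷_) (∈-vecs all v) }) (all x))

length-allFin : ∀ n → length (allFin n) ≡ n
length-allFin n = length-tabulate {n = n} (λ x → x)

-- Conditional expectation and energy in natural numbers.

∣! : ∀ {j M} → 1 ≤ j → j ≤ M → j ∣ M !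
∣! {j} {zero}  1≤j j≤M = ⊥-elim (1+n≰n (≤-trans 1≤j j≤M))
∣! {j} {suc M} 1≤j j≤M with m≤n⇒m<n∨m≡n j≤M
... | inj₁ j<  = ∣-trans (∣! 1≤j (s≤s⁻¹ j<)) (n∣m*n (suc M))
... | inj₂ refl = m∣m*n (M !)

square-gap : ∀ {a b c} → a + c ≤ b → 2 * (a * b) + c * c ≤ a * a + b * b
square-gap {a} {b} {c} h with m≤n⇒∃[o]m+o≡n h
... | (o , refl) = ≤-trans (m≤m+n _ (2 * c * o + o * o)) (≤-reflexive (lem a c o))
  where lem : ∀ a c o → 2 * (a * (a + c + o)) + c * c + (2 * c * o + o * o) ≡ a * a + (a + c + o) * (a + c + o)
        lem = solve-∀

≤ᵇ-true : ∀ {a b} → (a ≤ᵇ b) ≡ true → a ≤ b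
≤ᵇ-true {a} e = ≤ᵇ⇒≤ a _ (subst T (sym e) _)

≤ᵇ-false : ∀ {a b} → (a ≤ᵇ b) ≡ false → b < a
≤ᵇ-false {a} {b} e = ≰⇒> λ h → subst T e (≤⇒≤ᵇ h)

-- From `b ≥ 2c` and `a < c` the gap `b - a` is at least `c`. The indicator makes this a pointwise
-- term, so that the defect of `2ab ≤ a² + b²` can be summed over a drop set.
drop-square : ∀ a b c → 2 * (a * b) + ⟦ (2 * c ≤ᵇ b) ∧ (a <ᵇ c) ⟧ * (c * c) ≤ a * a + b * b
drop-square a b c with 2 * c ≤ᵇ b in eb | a <ᵇ c in ea
... | false | _     = ≤-trans (≤-reflexive (+-identityʳ _)) (2ab≤a²+b² a b)
... | true  | false = ≤-trans (≤-reflexive (+-identityʳ _)) (2ab≤a²+b² a b)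
... | true  | true  = ≤-trans (≤-reflexive (cong (2 * (a * b) +_) (*-identityˡ _)))
  (square-gap {a} {b} {c} (≤-trans (+-monoˡ-≤ c (<⇒≤ (≤ᵇ-true {suc a} {c} ea)))
    (≤-trans (≤-reflexive (cong (c +_) (sym (+-identityʳ c)))) (≤ᵇ-true eb))))

dichotomy : ∀ a c g → c * g ≤ a * g + c * (⟦ a <ᵇ c ⟧ * g)
dichotomy a c g with a <ᵇ c in e
... | true  = ≤-trans (≤-reflexive (cong (c *_) (sym (*-identityˡ g)))) (m≤n+m _ (a * g))
... | false = ≤-trans (*-monoˡ-≤ g (s≤s⁻¹ (≤ᵇ-false {suc a} {c} e))) (m≤m+n _ _)

module CondExp (M d : ℕ) where

  Ω : Set
  Ω = Fin M

  Ωs : List Ω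
  Ωs = allFin M

  -- L is a multiple of every class size, so L times a conditional probability is a natural number.
  L : ℕ
  L = 2 * d * M !

  inv : ℕ → ℕ
  inv zero    = 0
  inv (suc j) = L / suc j

  *-inv : ∀ {j} → 1 ≤ j → j ≤ M → j * inv j ≡ L
  *-inv {suc j} 1≤j j≤M = m*[n/m]≡n (∣-trans (∣! 1≤j j≤M) (n∣m*n (2 * d)))

  module _ (κ : Ω → List Bool) where

    sim : Ω → Ω → Bool
    sim ω ω′ = does (ListP.≡-dec Bool._≟_ (κ ω) (κ ω′))

    sim-sym : ∀ ω ω′ → sim ω ω′ ≡ sim ω′ ω
    sim-sym ω ω′ with ListP.≡-dec Bool._≟_ (κ ω) (κ ω′)
    ... | yes p = sym (dec-true (ListP.≡-dec Bool._≟_ _ _) (sym p))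
    ... | no ¬p = sym (dec-false (ListP.≡-dec Bool._≟_ _ _) (λ q → ¬p (sym q)))

    sim-refl : ∀ ω → sim ω ω ≡ true
    sim-refl ω = dec-true (ListP.≡-dec Bool._≟_ (κ ω) (κ ω)) refl

    sim⇒≡ : ∀ ω ω′ → sim ω ω′ ≡ true → κ ω ≡ κ ω′
    sim⇒≡ ω ω′ e with ListP.≡-dec Bool._≟_ (κ ω) (κ ω′)
    ... | yes p = p

    cls : Ω → ℕ
    cls ω = ∑ Ωs λ ω′ → ⟦ sim ω ω′ ⟧

    -- `L` times the conditional expectation of `Y` given `κ`. It is an exact integer because a
    -- class has at most `M` elements, so its size divides `M !` and hence `L`.
    P : (Ω → ℕ) → Ω → ℕ
    P Y ω = ∑ Ωs (λ ω′ → ⟦ sim ω ω′ ⟧ * Y ω′) * inv (cls ω)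

    Invariant : (Ω → ℕ) → Set
    Invariant g = ∀ ω ω′ → κ ω ≡ κ ω′ → g ω ≡ g ω′

    sim-inv : ∀ ω₁ ω → κ ω ≡ κ ω₁ → ∀ ω′ → sim ω ω′ ≡ sim ω₁ ω′
    sim-inv ω₁ ω e ω′ rewrite e = refl

    cls-inv : Invariant cls
    cls-inv ω ω₁ e rewrite e = refl

    P-inv : ∀ Y → Invariant (P Y)
    P-inv Y ω ω₁ e rewrite e = refl

    1≤cls : ∀ ω → 1 ≤ cls ω
    1≤cls ω = subst (_≤ cls ω) (cong ⟦_⟧ (sim-refl ω)) (∑-∈ (λ ω′ → ⟦ sim ω ω′ ⟧) (∈-allFin ω))

    cls≤ : ∀ ω → cls ω ≤ M
    cls≤ ω = ≤-trans (∑-bound Ωs λ ω′ → ⟦⟧≤1 (sim ω ω′))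
      (≤-reflexive (trans (*-identityʳ _) (length-allFin M)))

    cls*inv : ∀ ω → cls ω * inv (cls ω) ≡ L
    cls*inv ω = *-inv (1≤cls ω) (cls≤ ω)

    P≤L : ∀ Y → (∀ ω → Y ω ≤ 1) → ∀ ω → P Y ω ≤ L
    P≤L Y Y≤1 ω = ≤-trans (*-monoˡ-≤ (inv (cls ω)) (∑-mono Ωs λ ω′ →
      ≤-trans (*-monoʳ-≤ ⟦ sim ω ω′ ⟧ (Y≤1 ω′)) (≤-reflexive (*-identityʳ _)))) (≤-reflexive (cls*inv ω))

    -- The two summations are exchanged: `sim` is symmetric, and `cls` and `g` are constant on
    -- classes, so the inner sum collects `cls * inv`, which is `L`.
    tower : ∀ Y g → Invariant g → ∑ Ωs (λ ω → P Y ω * g ω) ≡ L * ∑ Ωs (λ ω → Y ω * g ω)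
    tower Y g g-inv = begin
      ∑ Ωs (λ ω → P Y ω * g ω)
        ≡⟨ ∑-cong Ωs (λ ω → trans (*-assoc (mass ω) (inv (cls ω)) (g ω)) (sym (∑-*ʳ Ωs (λ ω′ → ⟦ sim ω ω′ ⟧ * Y ω′) (inv (cls ω) * g ω)))) ⟩
      ∑ Ωs (λ ω → ∑ Ωs λ ω′ → ⟦ sim ω ω′ ⟧ * Y ω′ * (inv (cls ω) * g ω))
        ≡⟨ ∑-cong Ωs (λ ω → ∑-cong Ωs λ ω′ → pull ω ω′) ⟩
      ∑ Ωs (λ ω → ∑ Ωs λ ω′ → ⟦ sim ω′ ω ⟧ * (Y ω′ * (inv (cls ω′) * g ω′)))
        ≡⟨ ∑-swap Ωs Ωs _ ⟩
      ∑ Ωs (λ ω′ → ∑ Ωs λ ω → ⟦ sim ω′ ω ⟧ * (Y ω′ * (inv (cls ω′) * g ω′)))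
        ≡⟨ ∑-cong Ωs (λ ω′ → trans (∑-*ʳ Ωs (λ ω → ⟦ sim ω′ ω ⟧) _) (trans (lem (cls ω′) (Y ω′) (inv (cls ω′)) (g ω′)) (cong (_* (Y ω′ * g ω′)) (cls*inv ω′)))) ⟩
      ∑ Ωs (λ ω′ → L * (Y ω′ * g ω′))
        ≡⟨ ∑-*ˡ Ωs L _ ⟩
      L * ∑ Ωs (λ ω → Y ω * g ω) ∎
      where
      open ≡-Reasoning
      mass : Ω → ℕ
      mass ω = ∑ Ωs λ ω′ → ⟦ sim ω ω′ ⟧ * Y ω′
      lem : ∀ c y i g → c * (y * (i * g)) ≡ c * i * (y * g)
      lem = solve-∀
      pull : ∀ ω ω′ → ⟦ sim ω ω′ ⟧ * Y ω′ * (inv (cls ω) * g ω) ≡ ⟦ sim ω′ ω ⟧ * (Y ω′ * (inv (cls ω′) * g ω′))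
      pull ω ω′ rewrite sim-sym ω ω′ with sim ω′ ω in eq
      ... | false = refl
      ... | true rewrite cls-inv ω ω′ (sym (sim⇒≡ ω′ ω eq)) | g-inv ω ω′ (sym (sim⇒≡ ω′ ω eq)) =
        trans (cong (_* (inv (cls ω′) * g ω′)) (+-identityʳ (Y ω′))) (sym (+-identityʳ _))

  energy : (Ω → List Bool) → (Ω → ℕ) → ℕ
  energy κ Y = ∑ Ωs λ ω → P κ Y ω * P κ Y ω

  -- heavy: conditional probability at least 1 / d; drop: it falls below 1 / 2d under κ′.
  heavy : (Ω → List Bool) → (Ω → ℕ) → Ω → Bool
  heavy κ Y ω = 2 * M ! ≤ᵇ P κ Y ω

  drop : (κ κ′ : Ω → List Bool) → (Ω → ℕ) → Ω → Bool
  drop κ κ′ Y ω = heavy κ Y ω ∧ (P κ′ Y ω <ᵇ M !)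

  Refines : (κ κ′ : Ω → List Bool) → Set
  Refines κ′ κ = ∀ ω ω′ → κ′ ω ≡ κ′ ω′ → κ ω ≡ κ ω′

  -- Pythagoras: two uses of `tower` identify the cross term of `P κ′ Y` and `P κ Y` with the old
  -- energy, so the gain is the sum of squared changes. A drop, from at least `2 * M !` to below
  -- `M !`, changes the value by more than `M !`.
  energy-increment : ∀ κ κ′ Y → Refines κ′ κ →
    energy κ Y + ∑ Ωs (λ ω → ⟦ drop κ κ′ Y ω ⟧) * (M ! * M !) ≤ energy κ′ Y
  energy-increment κ κ′ Y ref = +-cancelˡ-≤ (energy κ Y) _ _ (begin
    energy κ Y + (energy κ Y + ∑ Ωs (λ ω → ⟦ drop κ κ′ Y ω ⟧) * (M ! * M !))
      ≡⟨ sym (+-assoc (energy κ Y) _ _) ⟩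
    energy κ Y + energy κ Y + ∑ Ωs (λ ω → ⟦ drop κ κ′ Y ω ⟧) * (M ! * M !)
      ≡⟨ cong₂ _+_ (trans (cong (energy κ Y +_) (sym (+-identityʳ _))) (cong (2 *_) (sym cross))) (sym (∑-*ʳ Ωs _ _)) ⟩
    2 * ∑ Ωs (λ ω → P′ ω * P₀ ω) + ∑ Ωs (λ ω → ⟦ drop κ κ′ Y ω ⟧ * (M ! * M !))
      ≡⟨ trans (cong (_+ ∑ Ωs (λ ω → ⟦ drop κ κ′ Y ω ⟧ * (M ! * M !))) (sym (∑-*ˡ Ωs 2 (λ ω → P′ ω * P₀ ω)))) (sym (∑-+ Ωs _ _)) ⟩
    ∑ Ωs (λ ω → 2 * (P′ ω * P₀ ω) + ⟦ drop κ κ′ Y ω ⟧ * (M ! * M !))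
      ≤⟨ ∑-mono Ωs pointwise ⟩
    ∑ Ωs (λ ω → P′ ω * P′ ω + P₀ ω * P₀ ω)
      ≡⟨ trans (∑-+ Ωs _ _) (+-comm (energy κ′ Y) _) ⟩
    energy κ Y + energy κ′ Y ∎)
    where
    open ≤-Reasoning
    P₀ = P κ Y
    P′ = P κ′ Y
    cross : ∑ Ωs (λ ω → P′ ω * P₀ ω) ≡ energy κ Y
    cross = trans (tower κ′ Y P₀ (λ ω ω′ e → P-inv κ Y ω ω′ (ref ω ω′ e)))
                  (sym (tower κ Y P₀ (P-inv κ Y)))
    pointwise : ∀ ω → 2 * (P′ ω * P₀ ω) + ⟦ drop κ κ′ Y ω ⟧ * (M ! * M !) ≤ P′ ω * P′ ω + P₀ ω * P₀ ω
    pointwise ω = drop-square (P′ ω) (P₀ ω) (M !)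

  -- Adding the event Y to a κ′-measurable event g costs at most a factor 2d, up to the drop set.
  condition : ∀ κ κ′ Y g → Refines κ′ κ → Invariant κ′ g →
    (∀ ω → 1 ≤ g ω → heavy κ Y ω ≡ true) →
    ∑ Ωs g ≤ 2 * d * ∑ Ωs (λ ω → Y ω * g ω) + ∑ Ωs (λ ω → ⟦ drop κ κ′ Y ω ⟧ * g ω)
  condition κ κ′ Y g ref g-inv hv = *-cancelˡ-≤ (M !) {{nz}} (begin
    M ! * ∑ Ωs g
      ≡⟨ sym (∑-*ˡ Ωs (M !) g) ⟩
    ∑ Ωs (λ ω → M ! * g ω)
      ≤⟨ ∑-mono Ωs pointwise ⟩
    ∑ Ωs (λ ω → P κ′ Y ω * g ω + M ! * (⟦ drop κ κ′ Y ω ⟧ * g ω))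
      ≡⟨ trans (∑-+ Ωs _ _) (cong₂ _+_ (tower κ′ Y g g-inv) (∑-*ˡ Ωs (M !) _)) ⟩
    2 * d * M ! * ∑ Ωs (λ ω → Y ω * g ω) + M ! * ∑ Ωs (λ ω → ⟦ drop κ κ′ Y ω ⟧ * g ω)
      ≡⟨ lem (2 * d) (M !) _ _ ⟩
    M ! * (2 * d * ∑ Ωs (λ ω → Y ω * g ω) + ∑ Ωs (λ ω → ⟦ drop κ κ′ Y ω ⟧ * g ω)) ∎)
    where
    open ≤-Reasoning
    nz = M !≢0
    lem : ∀ c m a b → c * m * a + m * b ≡ m * (c * a + b)
    lem = solve-∀
    pointwise : ∀ ω → M ! * g ω ≤ P κ′ Y ω * g ω + M ! * (⟦ drop κ κ′ Y ω ⟧ * g ω)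
    pointwise ω with g ω in eq
    ... | zero = ≤-trans (≤-reflexive (*-zeroʳ (M !))) z≤n
    ... | suc j = subst (λ b → M ! * suc j ≤ P κ′ Y ω * suc j + M ! * (⟦ b ∧ (P κ′ Y ω <ᵇ M !) ⟧ * suc j))
      (sym (hv ω (subst (1 ≤_) (sym eq) (s≤s z≤n)))) (dichotomy (P κ′ Y ω) (M !) (suc j))

∧-true : ∀ {a b} → a ∧ b ≡ true → a ≡ true × b ≡ true
∧-true {true} {true} _ = refl , refl

⟦∧⟧ : ∀ a b → ⟦ a ∧ b ⟧ ≡ ⟦ a ⟧ * ⟦ b ⟧
⟦∧⟧ true  b = sym (+-identityʳ _)
⟦∧⟧ false b = refl

bools : List Bool
bools = false ∷ true ∷ []

∈-bools : ∀ b → b ∈ bools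
∈-bools false = here refl
∈-bools true  = there (here refl)

-- Complete multipartite blow-ups

Blow : (p : ℕ) → (Vec A p → Bool) → Vec A (p * 2) → Bool
Blow zero    R []           = R []
Blow (suc p) R (v ∷ v′ ∷ φ) = Blow p (λ t → R (v ∷ t) ∧ R (v′ ∷ t)) φ

pick : Vec Bool p → Vec A (p * 2) → Vec A p
pick []          φ            = []
pick (false ∷ h) (v ∷ v′ ∷ φ) = v ∷ pick h φ
pick (true ∷ h)  (v ∷ v′ ∷ φ) = v′ ∷ pick h φ

Blow-pick : ∀ (R : Vec A p → Bool) h φ → Blow p R φ ≡ true → R (pick h φ) ≡ true
Blow-pick R []          []           e = e
Blow-pick R (false ∷ h) (v ∷ v′ ∷ φ) e = proj₁ (∧-true (Blow-pick (λ t → R (v ∷ t) ∧ R (v′ ∷ t)) h φ e))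
Blow-pick R (true ∷ h)  (v ∷ v′ ∷ φ) e = proj₂ (∧-true {R (v ∷ pick h φ)} (Blow-pick (λ t → R (v ∷ t) ∧ R (v′ ∷ t)) h φ e))

-- Density `1 / D` leaves a share `1 / (2 * D * D)` of pairs of first entries whose common
-- extensions still have density `1 / (2 * D * D)`. One factor pays for the share of pairs, and the
-- recursive call for the density.
blowConst : ℕ → ℕ → ℕ
blowConst D zero    = 1
blowConst D (suc p) = 2 * D * D * blowConst (2 * D * D) p

-- One coordinate is doubled at a time. Cauchy-Schwarz over the remaining coordinates bounds from
-- below the common extensions of two first entries, and the induction hypothesis applies to the
-- pairs that have many.
blow-up : ∀ {n} (xs : List A) → length xs ≡ suc n → ∀ D p (R : Vec A p → Bool) →
          suc n ^ p ≤ ∑ (vecs xs p) (λ x → ⟦ R x ⟧) * D →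
          suc n ^ (p * 2) ≤ ∑ (vecs xs (p * 2)) (λ φ → ⟦ Blow p R φ ⟧) * blowConst D p
blow-up xs len D zero    R h with R []
... | true = s≤s z≤n
blow-up {A = A} {n} xs len D (suc p) R h = +-cancelˡ-≤ (N ^ (suc p * 2)) _ _ (begin
  N ^ (suc p * 2) + N ^ (suc p * 2)
    ≡⟨ cong (λ z → z + z) (trans (^-distribˡ-+-* N 2 (p * 2)) (cong (N ^ 2 *_) sq)) ⟩
  N ^ 2 * (N ^ p * N ^ p) + N ^ 2 * (N ^ p * N ^ p)
    ≡⟨ lem₁ (N ^ 2) (N ^ p) ⟩
  2 * (N ^ 2 * N ^ p) * N ^ p
    ≤⟨ *-monoˡ-≤ (N ^ p) (*-monoʳ-≤ 2 dense) ⟩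
  2 * (S * (D * D)) * N ^ p
    ≡⟨ trans (lem₂ S D (N ^ p)) (trans (sym (∑-*ʳ xs _ _)) (∑-cong xs λ v → sym (∑-*ʳ xs _ _))) ⟩
  ∑ xs (λ v → ∑ xs λ v′ → b v v′ * (2 * D * D * N ^ p))
    ≤⟨ ∑-mono xs (λ v → ∑-mono xs λ v′ → each v v′) ⟩
  ∑ xs (λ v → ∑ xs λ v′ → N ^ p * N ^ p + bl v v′ * C)
    ≡⟨ ∑-cong xs (λ v → trans (∑-+ xs _ _) (cong₂ _+_ (∑-const xs _) (∑-*ʳ xs _ C))) ⟩
  ∑ xs (λ v → length xs * (N ^ p * N ^ p) + ∑ xs (bl v) * C)
    ≡⟨ trans (∑-+ xs _ _) (cong₂ _+_ (∑-const xs _) (∑-*ʳ xs _ C)) ⟩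
  length xs * (length xs * (N ^ p * N ^ p)) + ∑ xs (λ v → ∑ xs (bl v)) * C
    ≡⟨ cong₂ (λ z w → z + w * C) (trans (cong (λ z → z * (z * (N ^ p * N ^ p))) len) (lem₃ N (N ^ p))) blows ⟩
  N * N * (N ^ p * N ^ p) + ∑ (vecs xs (suc p * 2)) (λ φ → ⟦ Blow (suc p) R φ ⟧) * C
    ≡⟨ cong (_+ ∑ (vecs xs (suc p * 2)) (λ φ → ⟦ Blow (suc p) R φ ⟧) * C) (trans (cong (_* (N ^ p * N ^ p)) (cong (N *_) (sym (*-identityʳ N)))) (sym (trans (^-distribˡ-+-* N 2 (p * 2)) (cong (N ^ 2 *_) sq)))) ⟩
  N ^ (suc p * 2) + ∑ (vecs xs (suc p * 2)) (λ φ → ⟦ Blow (suc p) R φ ⟧) * C ∎)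
  where
  open ≤-Reasoning
  N = suc n
  C = 2 * D * D * blowConst (2 * D * D) p
  ts = vecs xs p
  R₂ : A → A → Vec A p → Bool
  R₂ v v′ t = R (v ∷ t) ∧ R (v′ ∷ t)
  g : Vec A p → ℕ
  g t = ∑ xs λ v → ⟦ R (v ∷ t) ⟧
  b bl : A → A → ℕ
  b v v′ = ∑ ts λ t → ⟦ R₂ v v′ t ⟧
  bl v v′ = ∑ (vecs xs (p * 2)) λ φ → ⟦ Blow p (R₂ v v′) φ ⟧
  S = ∑ xs λ v → ∑ xs λ v′ → b v v′
  lem₁ : ∀ a c → a * (c * c) + a * (c * c) ≡ 2 * (a * c) * c
  lem₁ = solve-∀
  lem₂ : ∀ s d c → 2 * (s * (d * d)) * c ≡ s * (2 * d * d * c)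
  lem₂ = solve-∀
  lem₃ : ∀ a c → a * (a * (c * c)) ≡ a * a * (c * c)
  lem₃ = solve-∀
  lem₄ : ∀ a c → a * c * (a * c) ≡ c * (a * (a * 1) * c)
  lem₄ = solve-∀
  lem₅ : ∀ a d → a * d * (a * d) ≡ a * a * (d * d)
  lem₅ = solve-∀
  sq : N ^ (p * 2) ≡ N ^ p * N ^ p
  sq = trans (cong (N ^_) (trans (*-comm p 2) (cong (p +_) (+-identityʳ p)))) (^-distribˡ-+-* N p p)
  count : ∑ (vecs xs (suc p)) (λ x → ⟦ R x ⟧) ≡ ∑ ts g
  count = trans (∑-vecs xs p _) (∑-swap xs ts _)
  blows : ∑ xs (λ v → ∑ xs (bl v)) ≡ ∑ (vecs xs (suc p * 2)) (λ φ → ⟦ Blow (suc p) R φ ⟧)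
  blows = sym (trans (∑-vecs xs _ _) (∑-cong xs λ v → ∑-vecs xs _ _))
  squares : ∑ ts (λ t → g t * g t) ≡ S
  squares = begin-equality
    ∑ ts (λ t → g t * g t)
      ≡⟨ ∑-cong ts (λ t → trans (sym (∑-*ʳ xs _ (g t))) (∑-cong xs λ v → trans (sym (∑-*ˡ xs ⟦ R (v ∷ t) ⟧ _)) (∑-cong xs λ v′ → sym (⟦∧⟧ (R (v ∷ t)) (R (v′ ∷ t)))))) ⟩
    ∑ ts (λ t → ∑ xs λ v → ∑ xs λ v′ → ⟦ R₂ v v′ t ⟧)
      ≡⟨ trans (∑-swap ts xs _) (∑-cong xs λ v → ∑-swap ts xs _) ⟩
    S ∎
  dense : N ^ 2 * N ^ p ≤ S * (D * D)
  dense = *-cancelˡ-≤ (N ^ p) {{m^n≢0 N p}} (begin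
    N ^ p * (N ^ 2 * N ^ p)        ≡⟨ sym (lem₄ N (N ^ p)) ⟩
    N ^ suc p * N ^ suc p          ≤⟨ *-mono-≤ h h ⟩
    a * D * (a * D)                ≡⟨ lem₅ a D ⟩
    a * a * (D * D)                ≡⟨ cong (λ z → z * z * (D * D)) count ⟩
    ∑ ts g * ∑ ts g * (D * D)      ≤⟨ *-monoˡ-≤ (D * D) (∑-cauchy-schwarz ts g) ⟩
    length ts * ∑ ts (λ t → g t * g t) * (D * D) ≡⟨ cong₂ (λ z w → z * w * (D * D)) (trans (length-vecs xs p) (cong (_^ p) len)) squares ⟩
    N ^ p * S * (D * D)            ≡⟨ *-assoc (N ^ p) S (D * D) ⟩
    N ^ p * (S * (D * D)) ∎)
    where a = ∑ (vecs xs (suc p)) (λ x → ⟦ R x ⟧)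
  b≤ : ∀ v v′ → b v v′ ≤ N ^ p
  b≤ v v′ = ≤-trans (∑-bound ts λ t → ⟦⟧≤1 (R₂ v v′ t))
    (≤-reflexive (trans (*-identityʳ _) (trans (length-vecs xs p) (cong (_^ p) len))))
  -- A pair with common extensions of density below `1 / (2 * D * D)` is charged to the first term.
  -- These charges make up half of the left side of the main estimate, the half that `+-cancelˡ-≤`
  -- removes.
  each : ∀ v v′ → b v v′ * (2 * D * D * N ^ p) ≤ N ^ p * N ^ p + bl v v′ * C
  each v v′ with N ^ p ≤? b v v′ * (2 * D * D)
  ... | no ¬q = ≤-trans (≤-reflexive (sym (*-assoc (b v v′) (2 * D * D) (N ^ p))))
                  (≤-trans (*-monoˡ-≤ (N ^ p) (<⇒≤ (≰⇒> ¬q))) (m≤m+n _ _))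
  ... | yes q = begin
    b v v′ * (2 * D * D * N ^ p)            ≤⟨ *-monoˡ-≤ (2 * D * D * N ^ p) (b≤ v v′) ⟩
    N ^ p * (2 * D * D * N ^ p)             ≡⟨ lem₆ (N ^ p) (2 * D * D) ⟩
    N ^ p * N ^ p * (2 * D * D)             ≡⟨ cong (_* (2 * D * D)) (sym sq) ⟩
    N ^ (p * 2) * (2 * D * D)               ≤⟨ *-monoˡ-≤ (2 * D * D) (blow-up xs len (2 * D * D) p (R₂ v v′) q) ⟩
    bl v v′ * blowConst (2 * D * D) p * (2 * D * D) ≡⟨ lem₇ (bl v v′) (blowConst (2 * D * D) p) (2 * D * D) ⟩
    bl v v′ * C                             ≤⟨ m≤n+m _ _ ⟩
    N ^ p * N ^ p + bl v v′ * C ∎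
    where
    lem₆ : ∀ a c → a * (c * a) ≡ a * a * c
    lem₆ = solve-∀
    lem₇ : ∀ a b c → a * b * c ≡ a * (c * b)
    lem₇ = solve-∀

-- Code p j r selects at most one element from each of p pairs: j elements are taken, r are left.
data Code : ℕ → ℕ → ℕ → Set where
  []   : Code 0 0 0
  skip : Code p j r → Code (suc p) j (2 + r)
  take : Bool → Code p j r → Code (suc p) (suc j) (suc r)

sel : Code p j r → Vec A (p * 2) → Vec A j
sel []             φ            = []
sel (skip σ)       (v ∷ v′ ∷ φ) = sel σ φ
sel (take false σ) (v ∷ v′ ∷ φ) = v ∷ sel σ φ
sel (take true σ)  (v ∷ v′ ∷ φ) = v′ ∷ sel σ φ

rest : Code p j r → Vec A (p * 2) → Vec A r
rest []             φ            = []
rest (skip σ)       (v ∷ v′ ∷ φ) = v ∷ v′ ∷ rest σ φ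
rest (take false σ) (v ∷ v′ ∷ φ) = v′ ∷ rest σ φ
rest (take true σ)  (v ∷ v′ ∷ φ) = v ∷ rest σ φ

-- `sel` and `rest` together only permute the coordinates of `φ`, so the selected and the remaining
-- entries range independently over all tuples.
∑-code : (xs : List A) (σ : Code p j r) (h : Vec A j → Vec A r → ℕ) →
         ∑ (vecs xs (p * 2)) (λ φ → h (sel σ φ) (rest σ φ)) ≡ ∑ (vecs xs j) (λ x → ∑ (vecs xs r) (h x))
∑-code xs [] h = sym (+-identityʳ _)
∑-code {p = suc p} {j} {suc (suc r)} xs (skip σ) h = begin
  ∑ (vecs xs (suc p * 2)) (λ φ → h (sel (skip σ) φ) (rest (skip σ) φ))
    ≡⟨ trans (∑-vecs xs _ _) (∑-cong xs λ v → trans (∑-vecs xs _ _) (∑-cong xs λ v′ → ∑-code xs σ λ x y → h x (v ∷ v′ ∷ y))) ⟩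
  ∑ xs (λ v → ∑ xs λ v′ → ∑ (vecs xs j) λ x → ∑ (vecs xs r) λ y → h x (v ∷ v′ ∷ y))
    ≡⟨ trans (∑-cong xs λ v → ∑-swap xs (vecs xs j) _) (∑-swap xs (vecs xs j) _) ⟩
  ∑ (vecs xs j) (λ x → ∑ xs λ v → ∑ xs λ v′ → ∑ (vecs xs r) λ y → h x (v ∷ v′ ∷ y))
    ≡⟨ ∑-cong (vecs xs j) (λ x → sym (trans (∑-vecs xs _ _) (∑-cong xs λ v → ∑-vecs xs _ _))) ⟩
  ∑ (vecs xs j) (λ x → ∑ (vecs xs (2 + r)) (h x)) ∎
  where open ≡-Reasoning
∑-code {p = suc p} {suc j} {suc r} xs (take b σ) h = begin
  ∑ (vecs xs (suc p * 2)) (λ φ → h (sel (take b σ) φ) (rest (take b σ) φ))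
    ≡⟨ trans (∑-vecs xs _ _) (∑-cong xs λ v → ∑-vecs xs _ _) ⟩
  ∑ xs (λ v → ∑ xs λ v′ → ∑ (vecs xs (p * 2)) λ φ → h (sel (take b σ) (v ∷ v′ ∷ φ)) (rest (take b σ) (v ∷ v′ ∷ φ)))
    ≡⟨ split b ⟩
  ∑ xs (λ v → ∑ xs λ v′ → ∑ (vecs xs (p * 2)) λ φ → h (v ∷ sel σ φ) (v′ ∷ rest σ φ))
    ≡⟨ ∑-cong xs (λ v → ∑-cong xs λ v′ → ∑-code xs σ λ x y → h (v ∷ x) (v′ ∷ y)) ⟩
  ∑ xs (λ v → ∑ xs λ v′ → ∑ (vecs xs j) λ x → ∑ (vecs xs r) λ y → h (v ∷ x) (v′ ∷ y))
    ≡⟨ ∑-cong xs (λ v → ∑-swap xs (vecs xs j) _) ⟩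
  ∑ xs (λ v → ∑ (vecs xs j) λ x → ∑ xs λ v′ → ∑ (vecs xs r) λ y → h (v ∷ x) (v′ ∷ y))
    ≡⟨ sym (trans (∑-vecs xs _ _) (∑-cong xs λ v → ∑-cong (vecs xs j) λ x → ∑-vecs xs _ _)) ⟩
  ∑ (vecs xs (suc j)) (λ x → ∑ (vecs xs (suc r)) (h x)) ∎
  where
  open ≡-Reasoning
  split : ∀ b → ∑ xs (λ v → ∑ xs λ v′ → ∑ (vecs xs (p * 2)) λ φ → h (sel (take b σ) (v ∷ v′ ∷ φ)) (rest (take b σ) (v ∷ v′ ∷ φ)))
            ≡ ∑ xs (λ v → ∑ xs λ v′ → ∑ (vecs xs (p * 2)) λ φ → h (v ∷ sel σ φ) (v′ ∷ rest σ φ))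
  split false = refl
  split true  = ∑-swap xs xs _

-- An untyped copy, needed because `codes-meet` recurses through codes whose indices `j` and `r`
-- disagree.
erase : Code p j r → Vec (Maybe Bool) p
erase []         = []
erase (skip σ)   = nothing ∷ erase σ
erase (take b σ) = just b ∷ erase σ

Meet : Vec A j → Vec A r → Set
Meet x y = ∃ λ i → ∃ λ i′ → lookup x i ≡ lookup y i′

-- A selection different from another and at least as large must pick something that the other
-- leaves. Sizes are compared by an inequality since that is what survives the recursion; it rules
-- out equality when one code skips a pair and the other takes from it.
codes-meet : ∀ {j′ r′} (σ : Code p j r) (τ : Code p j′ r′) → j′ ≤ j →
  (∀ {A : Set} (φ : Vec A (p * 2)) → Meet (sel σ φ) (rest τ φ)) ⊎ (j ≡ j′ × erase σ ≡ erase τ)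
codes-meet [] [] _ = inj₂ (refl , refl)
codes-meet (skip σ) (skip τ) le with codes-meet σ τ le
... | inj₂ (e , e′) = inj₂ (e , cong (nothing ∷_) e′)
... | inj₁ m = inj₁ λ { (v ∷ v′ ∷ φ) → let (i , i′ , e) = m φ in i , suc (suc i′) , e }
codes-meet (skip σ) (take b τ) le with codes-meet σ τ (≤-trans (n≤1+n _) le)
... | inj₂ (refl , _) = ⊥-elim (1+n≰n le)
codes-meet (skip σ) (take false τ) le | inj₁ m = inj₁ λ { (v ∷ v′ ∷ φ) → let (i , i′ , e) = m φ in i , suc i′ , e }
codes-meet (skip σ) (take true τ) le | inj₁ m = inj₁ λ { (v ∷ v′ ∷ φ) → let (i , i′ , e) = m φ in i , suc i′ , e }
codes-meet (take false σ) (skip τ) le = inj₁ λ { (v ∷ v′ ∷ φ) → zero , zero , refl }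
codes-meet (take true σ)  (skip τ) le = inj₁ λ { (v ∷ v′ ∷ φ) → zero , suc zero , refl }
codes-meet (take false σ) (take true τ) le = inj₁ λ { (v ∷ v′ ∷ φ) → zero , zero , refl }
codes-meet (take true σ) (take false τ) le = inj₁ λ { (v ∷ v′ ∷ φ) → zero , zero , refl }
codes-meet (take false σ) (take false τ) (s≤s le) with codes-meet σ τ le
... | inj₂ (e , e′) = inj₂ (cong suc e , cong (just false ∷_) e′)
... | inj₁ m = inj₁ λ { (v ∷ v′ ∷ φ) → let (i , i′ , e) = m φ in suc i , suc i′ , e }
codes-meet (take true σ) (take true τ) (s≤s le) with codes-meet σ τ le
... | inj₂ (e , e′) = inj₂ (cong suc e , cong (just true ∷_) e′)
... | inj₁ m = inj₁ λ { (v ∷ v′ ∷ φ) → let (i , i′ , e) = m φ in suc i , suc i′ , e }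

All-sel : ∀ {P : A → Set} (σ : Code p j r) {φ} → All P φ → All P (sel σ φ)
All-sel []             ps             = []
All-sel (skip σ)       {_ ∷ _ ∷ _} (p ∷ p′ ∷ ps)  = All-sel σ ps
All-sel (take false σ) {_ ∷ _ ∷ _} (p ∷ p′ ∷ ps)  = p ∷ All-sel σ ps
All-sel (take true σ)  {_ ∷ _ ∷ _} (p ∷ p′ ∷ ps)  = p′ ∷ All-sel σ ps

Unique-sel : (σ : Code p j r) {φ : Vec A (p * 2)} → Unique φ → Unique (sel σ φ)
Unique-sel []             us = []
Unique-sel (skip σ)       {_ ∷ _ ∷ _} (_ ∷ _ ∷ us)        = Unique-sel σ us
Unique-sel (take false σ) {_ ∷ _ ∷ _} ((_ ∷ u) ∷ _ ∷ us)  = All-sel σ u ∷ Unique-sel σ us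
Unique-sel (take true σ)  {_ ∷ _ ∷ _} (_ ∷ u ∷ us)        = All-sel σ u ∷ Unique-sel σ us

-- Tuples with repeated entries are rare.

memᵇ : Fin n → Vec (Fin n) j → Bool
memᵇ v []      = false
memᵇ v (w ∷ x) = does (v Fin.≟ w) ∨ memᵇ v x

uniqueᵇ : Vec (Fin n) j → Bool
uniqueᵇ []      = true
uniqueᵇ (v ∷ x) = not (memᵇ v x) ∧ uniqueᵇ x

memᵇ-false : ∀ {v : Fin n} (x : Vec (Fin n) j) → memᵇ v x ≡ false → All (v ≢_) x
memᵇ-false []      e = []
memᵇ-false {v = v} (w ∷ x) e with v Fin.≟ w
... | no ¬p = ¬p ∷ memᵇ-false x e

uniqueᵇ⇒Unique : (x : Vec (Fin n) j) → uniqueᵇ x ≡ true → Unique x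
uniqueᵇ⇒Unique []      e = []
uniqueᵇ⇒Unique (v ∷ x) e with memᵇ v x in eq
... | false = memᵇ-false x eq ∷ uniqueᵇ⇒Unique x e

⟦∨⟧ : ∀ a b → ⟦ a ∨ b ⟧ ≤ ⟦ a ⟧ + ⟦ b ⟧
⟦∨⟧ true  b = s≤s z≤n
⟦∨⟧ false b = ≤-refl

∑-tabulate : ∀ {A : Set} (f : Fin n → A) (h : A → ℕ) → ∑ (List.tabulate f) h ≡ ∑ (allFin n) (λ i → h (f i))
∑-tabulate {zero}  f h = refl
∑-tabulate {suc n} f h = cong (h (f zero) +_) (trans (∑-tabulate (λ i → f (suc i)) h) (sym (∑-tabulate suc (λ i → h (f i)))))

∑-≟ : (w : Fin n) → ∑ (allFin n) (λ v → ⟦ does (v Fin.≟ w) ⟧) ≡ 1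
∑-≟ {suc n} zero    = cong suc (trans (∑-tabulate {n} suc _) (∑-zero (allFin n)))
∑-≟ {suc n} (suc w) = trans (∑-tabulate {n} suc _) (∑-≟ w)

∑-mem : (x : Vec (Fin n) j) → ∑ (allFin n) (λ v → ⟦ memᵇ v x ⟧) ≤ j
∑-mem {n} []      = ≤-reflexive (∑-zero (allFin n))
∑-mem {n} (w ∷ x) = ≤-trans (∑-mono (allFin n) λ v → ⟦∨⟧ (does (v Fin.≟ w)) (memᵇ v x))
  (≤-trans (≤-reflexive (∑-+ (allFin n) _ _)) (+-mono-≤ (≤-reflexive (∑-≟ w)) (∑-mem x)))

tuples : ∀ n j → List (Vec (Fin n) j)
tuples n = vecs (allFin n)

length-tuples : ∀ n j → length (tuples n j) ≡ n ^ j
length-tuples n j = trans (length-vecs (allFin n) j) (cong (_^ j) (length-allFin n))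

∈-tuples : (x : Vec (Fin n) j) → x ∈ tuples n j
∈-tuples = ∈-vecs ∈-allFin

-- A new entry collides with the other `j` entries for at most `j` of its `n` values; the bound
-- `j * j` grows fast enough to absorb these.
∑-nonunique : ∀ n j → ∑ (tuples n j) (λ x → ⟦ not (uniqueᵇ x) ⟧) * n ≤ j * j * n ^ j
∑-nonunique n zero    = z≤n
∑-nonunique n (suc j) = begin
  ∑ (tuples n (suc j)) (λ x → ⟦ not (uniqueᵇ x) ⟧) * n
    ≡⟨ cong (_* n) (∑-vecs (allFin n) j _) ⟩
  ∑ V (λ v → ∑ xs λ x → ⟦ not (not (memᵇ v x) ∧ uniqueᵇ x) ⟧) * n
    ≤⟨ *-monoˡ-≤ n (∑-mono V λ v → ∑-mono xs λ x → demorgan (memᵇ v x) (uniqueᵇ x)) ⟩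
  ∑ V (λ v → ∑ xs λ x → ⟦ memᵇ v x ⟧ + ⟦ not (uniqueᵇ x) ⟧) * n
    ≡⟨ cong (_* n) (trans (∑-cong V λ v → ∑-+ xs _ _) (∑-+ V _ _)) ⟩
  (∑ V (λ v → ∑ xs λ x → ⟦ memᵇ v x ⟧) + ∑ V (λ _ → bad)) * n
    ≡⟨ cong₂ (λ a b → (a + b) * n) (∑-swap V xs _) (trans (∑-const V bad) (cong (_* bad) (length-allFin n))) ⟩
  (∑ xs (λ x → ∑ V λ v → ⟦ memᵇ v x ⟧) + n * bad) * n
    ≤⟨ *-monoˡ-≤ n (+-monoˡ-≤ (n * bad) (≤-trans (∑-bound xs ∑-mem) (≤-reflexive (cong (_* j) (length-tuples n j))))) ⟩
  (n ^ j * j + n * bad) * n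
    ≡⟨ lem₁ n (n ^ j) j bad ⟩
  n * (j * n ^ j) + n * (bad * n)
    ≤⟨ +-monoʳ-≤ (n * (j * n ^ j)) (*-monoʳ-≤ n (∑-nonunique n j)) ⟩
  n * (j * n ^ j) + n * (j * j * n ^ j)
    ≤⟨ m≤m+n _ ((1 + j) * (n * n ^ j)) ⟩
  n * (j * n ^ j) + n * (j * j * n ^ j) + (1 + j) * (n * n ^ j)
    ≡⟨ lem₂ n (n ^ j) j ⟩
  suc j * suc j * n ^ suc j ∎
  where
  open ≤-Reasoning
  V = allFin n
  xs = tuples n j
  bad = ∑ xs (λ x → ⟦ not (uniqueᵇ x) ⟧)
  lem₁ : ∀ n a j b → (a * j + n * b) * n ≡ n * (j * a) + n * (b * n)
  lem₁ = solve-∀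
  lem₂ : ∀ n a j → n * (j * a) + n * (j * j * a) + (1 + j) * (n * a) ≡ (1 + j) * (1 + j) * (n * a)
  lem₂ = solve-∀
  demorgan : ∀ a b → ⟦ not (not a ∧ b) ⟧ ≤ ⟦ a ⟧ + ⟦ not b ⟧
  demorgan true  b = s≤s z≤n
  demorgan false b = ≤-refl

-- Clauses as partial assignments, satisfaction and minimality.

-- A canonical form: entry `v` is the sign of variable `v`, or `nothing` if the clause avoids it.
-- Reordering the literals gives the same term, so minimality can speak of equality of clauses.
Cl : ℕ → Set
Cl n = Vec (Maybe Bool) n

cl : Vec (Fin n) j → Vec Bool j → Cl n
cl []      []      = replicate _ nothing
cl (v ∷ x) (b ∷ c) = cl x c [ v ]≔ just b

-- Lets any variable of a clause be moved to the front, since revealed clauses are listed with the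
-- revealed variable first.
cl-front : (x : Vec (Fin n) (suc j)) (c : Vec Bool (suc j)) → Unique x → ∀ i →
  cl x c ≡ cl (lookup x i ∷ removeAt x i) (lookup c i ∷ removeAt c i)
cl-front (v ∷ x)     (b ∷ c)     u       zero    = refl
cl-front (v ∷ w ∷ x) (b ∷ d ∷ c) (a ∷ u) (suc i) =
  trans (cong (_[ v ]≔ just b) (cl-front (w ∷ x) (d ∷ c) u i))
        ([]≔-commutes (cl (removeAt (w ∷ x) i) (removeAt (d ∷ c) i)) (lookup (w ∷ x) i) v
          (λ e → lookup⁺ a i (sym e)))

lookup-cl-∉ : ∀ {v : Fin n} (x : Vec (Fin n) j) c → All (v ≢_) x → lookup (cl x c) v ≡ nothing
lookup-cl-∉ {v = v} []      []      []       = lookup-replicate v nothing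
lookup-cl-∉ {v = v} (w ∷ x) (b ∷ c) (a ∷ as) = trans (lookup∘update′ a (cl x c) (just b)) (lookup-cl-∉ x c as)

lookup-cl-∈ : (x : Vec (Fin n) j) → ∀ c i → is-just (lookup (cl x c) (lookup x i)) ≡ true
lookup-cl-∈ (v ∷ x) (b ∷ c) zero    = cong is-just (lookup∘update v (cl x c) (just b))
lookup-cl-∈ (v ∷ x) (b ∷ c) (suc i) with lookup x i Fin.≟ v
... | yes e rewrite e = cong is-just (lookup∘update v (cl x c) (just b))
... | no ne = trans (cong is-just (lookup∘update′ ne (cl x c) (just b))) (lookup-cl-∈ x c i)

lit : Maybe Bool → Bool → Bool
lit nothing      y = true
lit (just true)  y = y
lit (just false) y = not y

lit-true : ∀ b y → lit (just b) y ≡ true → y ≡ b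
lit-true true  y     e = e
lit-true false false e = refl

lit-refl : ∀ b → lit (just b) b ≡ true
lit-refl true  = refl
lit-refl false = refl

lit-false : ∀ b y → lit (just b) y ≡ false → y ≡ not b
lit-false true  y    e = e
lit-false false true e = refl

sat : (Fin n → Bool) → Cl n → Bool
sat a []      = true
sat a (m ∷ C) = lit m (a zero) ∧ sat (λ i → a (suc i)) C

satV : (Fin n → Bool) → Vec (Fin n) j → Vec Bool j → Bool
satV a []      []      = true
satV a (v ∷ x) (b ∷ c) = lit (just b) (a v) ∧ satV a x c

sat-update : ∀ (a : Fin n → Bool) C v b → lookup C v ≡ nothing →
  sat a (C [ v ]≔ just b) ≡ lit (just b) (a v) ∧ sat a C
sat-update a (nothing ∷ C) zero    b e = refl
sat-update a (m ∷ C)       (suc v) b e rewrite sat-update (λ i → a (suc i)) C v b e =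
  ∧-swap (lit m (a zero)) (lit (just b) (a (suc v))) _
  where
  ∧-swap : ∀ x y z → x ∧ (y ∧ z) ≡ y ∧ (x ∧ z)
  ∧-swap true  y     z = refl
  ∧-swap false true  z = refl
  ∧-swap false false z = refl

sat-empty : ∀ (a : Fin n → Bool) → sat a (replicate n nothing) ≡ true
sat-empty {zero}  a = refl
sat-empty {suc n} a = sat-empty (λ i → a (suc i))

sat-cl : ∀ (a : Fin n → Bool) (x : Vec (Fin n) j) c → Unique x → sat a (cl x c) ≡ satV a x c
sat-cl a []      []      _       = sat-empty a
sat-cl a (v ∷ x) (b ∷ c) (d ∷ u) =
  trans (sat-update a (cl x c) v b (lookup-cl-∉ x c d)) (cong (lit (just b) (a v) ∧_) (sat-cl a x c u))

Minimal : (Cl n → Bool) → Set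
Minimal 𝔽 = ∀ C → 𝔽 C ≡ true → ∃ λ a → sat a C ≡ true × (∀ C′ → 𝔽 C′ ≡ true → C′ ≢ C → sat a C′ ≡ false)

-- Selections that omit one pair of twins.

takeAll : Vec Bool k → Code k k k
takeAll []      = []
takeAll (b ∷ h) = take b (takeAll h)

-- A `k`-subset of `k + 1` vertices is named by the vertex it omits, and `h` chooses a twin of every
-- other vertex. What is left over is the omitted pair and one twin of each remaining pair, `2 + k`
-- entries.
codeRm : Fin (suc k) → Vec Bool k → Code (suc k) k (2 + k)
codeRm zero    h       = skip (takeAll h)
codeRm (suc i) (b ∷ h) = take b (codeRm i h)

sel-takeAll : (h : Vec Bool k) (φ : Vec A (k * 2)) → sel (takeAll h) φ ≡ pick h φ
sel-takeAll []          φ            = refl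
sel-takeAll (false ∷ h) (v ∷ v′ ∷ φ) = cong (v ∷_) (sel-takeAll h φ)
sel-takeAll (true ∷ h)  (v ∷ v′ ∷ φ) = cong (v′ ∷_) (sel-takeAll h φ)

removeAt-∷ : (v : A) (x : Vec A (suc m)) (i : Fin (suc m)) → v ∷ removeAt x i ≡ removeAt (v ∷ x) (suc i)
removeAt-∷ v (w ∷ x) i = refl

-- The inserted `false` is an arbitrary choice in the omitted pair, discarded by `removeAt`; so
-- membership in a blow-up can be read off through `pick`.
sel-codeRm : ∀ i (h : Vec Bool k) (φ : Vec A (suc k * 2)) →
  sel (codeRm i h) φ ≡ removeAt (pick (insertAt h i false) φ) i
sel-codeRm zero h (v ∷ v′ ∷ φ) = sel-takeAll h φ
sel-codeRm (suc i) (false ∷ h) (v ∷ v′ ∷ φ) =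
  trans (cong (v ∷_) (sel-codeRm i h φ)) (removeAt-∷ v (pick (insertAt h i false) φ) i)
sel-codeRm (suc i) (true ∷ h) (v ∷ v′ ∷ φ) =
  trans (cong (v′ ∷_) (sel-codeRm i h φ)) (removeAt-∷ v′ (pick (insertAt h i false) φ) i)

erase-takeAll : (h h′ : Vec Bool k) → erase (takeAll h) ≡ erase (takeAll h′) → h ≡ h′
erase-takeAll []      []       e = refl
erase-takeAll (b ∷ h) (b′ ∷ h′) e =
  cong₂ _∷_ (just-injective (proj₁ (∷-injective e))) (erase-takeAll h h′ (proj₂ (∷-injective e)))

erase-codeRm : ∀ i i′ (h h′ : Vec Bool k) → erase (codeRm i h) ≡ erase (codeRm i′ h′) → i ≡ i′ × h ≡ h′
erase-codeRm zero zero h h′ e = refl , erase-takeAll h h′ (proj₂ (∷-injective e))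
erase-codeRm zero (suc i′) h (b ∷ h′) ()
erase-codeRm (suc i) zero (b ∷ h) h′ ()
erase-codeRm (suc i) (suc i′) (b ∷ h) (b′ ∷ h′) e with ∷-injective e
... | (refl , e′) with erase-codeRm i i′ h h′ e′
... | (refl , refl) = refl , refl

All-rest : ∀ {P : A → Set} (σ : Code p j r) {φ} → All P φ → ∀ i → P (lookup (rest σ φ) i)
All-rest (skip σ)       {_ ∷ _ ∷ _} (p ∷ p′ ∷ ps) zero          = p
All-rest (skip σ)       {_ ∷ _ ∷ _} (p ∷ p′ ∷ ps) (suc zero)    = p′
All-rest (skip σ)       {_ ∷ _ ∷ _} (p ∷ p′ ∷ ps) (suc (suc i)) = All-rest σ ps i
All-rest (take false σ) {_ ∷ _ ∷ _} (p ∷ p′ ∷ ps) zero          = p′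
All-rest (take false σ) {_ ∷ _ ∷ _} (p ∷ p′ ∷ ps) (suc i)       = All-rest σ ps i
All-rest (take true σ)  {_ ∷ _ ∷ _} (p ∷ p′ ∷ ps) zero          = p
All-rest (take true σ)  {_ ∷ _ ∷ _} (p ∷ p′ ∷ ps) (suc i)       = All-rest σ ps i

sel#rest : (σ : Code p j r) {φ : Vec A (p * 2)} → Unique φ → ∀ i → All (lookup (rest σ φ) i ≢_) (sel σ φ)
sel#rest (skip σ)       {_ ∷ _ ∷ _} ((_ ∷ a) ∷ a′ ∷ u) zero          = All-sel σ a
sel#rest (skip σ)       {_ ∷ _ ∷ _} ((_ ∷ a) ∷ a′ ∷ u) (suc zero)    = All-sel σ a′
sel#rest (skip σ)       {_ ∷ _ ∷ _} ((_ ∷ a) ∷ a′ ∷ u) (suc (suc i)) = sel#rest σ u i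
sel#rest (take false σ) {_ ∷ _ ∷ _} ((d ∷ a) ∷ a′ ∷ u) zero          = (λ e → d (sym e)) ∷ All-sel σ a′
sel#rest (take false σ) {_ ∷ _ ∷ _} ((d ∷ a) ∷ a′ ∷ u) (suc i)       = (λ e → All-rest σ a i (sym e)) ∷ sel#rest σ u i
sel#rest (take true σ)  {_ ∷ _ ∷ _} ((d ∷ a) ∷ a′ ∷ u) zero          = d ∷ All-sel σ a
sel#rest (take true σ)  {_ ∷ _ ∷ _} ((d ∷ a) ∷ a′ ∷ u) (suc i)       = (λ e → All-rest σ a′ i (sym e)) ∷ sel#rest σ u i

-- Different selections give clauses on different variable sets, so the signs do not matter. Without
-- this a witness could satisfy the second clause by its being the first one.
cl-distinct : (σ τ : Code p j r) {φ : Vec (Fin n) (p * 2)} → Unique φ → erase σ ≢ erase τ →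
  ∀ c c′ → cl (sel σ φ) c ≢ cl (sel τ φ) c′
cl-distinct σ τ {φ} u ne c c′ e with codes-meet σ τ ≤-refl
... | inj₂ (_ , e′) = ne e′
... | inj₁ m with m φ
... | (i , i′ , ev) with trans (sym (lookup-cl-∈ (sel σ φ) c i))
      (cong is-just (trans (cong₂ lookup e ev) (lookup-cl-∉ (sel τ φ) c′ (sel#rest τ u i′))))
... | ()

-- A witness of the clause (x , s) gives x_i the value s_i; if the clause with x_i replaced by
-- its twin is also present, the twin gets the opposite value, so both values occur in each pair.

rmLast : Vec Bool k → Code (suc k) k (2 + k)
rmLast {k} = codeRm (fromℕ k)

none : Vec Bool k
none = replicate _ false

flip : Fin k → Vec Bool k
flip i = none [ i ]≔ true

-- Where the base clause has sign `b`, its first twin gets the value `b` and the second one the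
-- opposite value, so twin number `b xor d` has the value `d`.
mix : Vec Bool k → Vec Bool k → Vec Bool k
mix []      []      = []
mix (b ∷ s) (d ∷ t) = (b xor d) ∷ mix s t

-- The last pair lies outside the base clause, so its twins need not have opposite values. The
-- default `false` takes the first of them, the one named by `lastPart`; likewise in `mixPen`.
mixTail : Vec Bool k → Vec Bool (suc k) → Vec Bool (suc k)
mixTail []      (d ∷ []) = false ∷ []
mixTail (b ∷ s) (d ∷ t)  = (b xor d) ∷ mixTail s t

mixPen : Vec Bool (suc k) → Vec Bool (suc k) → Vec Bool (suc k)
mixPen (b ∷ [])     (d ∷ []) = false ∷ []
mixPen (b ∷ b′ ∷ s) (d ∷ t)  = (b xor d) ∷ mixPen (b′ ∷ s) t

lastPart : ∀ k → Vec A (suc k * 2) → A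
lastPart zero    (v ∷ v′ ∷ []) = v
lastPart (suc k) (v ∷ v′ ∷ φ) = lastPart k φ

module _ (a : Fin n → Bool) where

  Opposite : Vec Bool k → Vec (Fin n) (suc k * 2) → Set
  Opposite []      φ            = ⊤
  Opposite (b ∷ s) (v ∷ v′ ∷ φ) = a v ≡ b × a v′ ≡ not b × Opposite s φ

  opposite : (s : Vec Bool k) (φ : Vec (Fin n) (suc k * 2)) → satV a (sel (rmLast none) φ) s ≡ true →
    (∀ i → satV a (sel (rmLast (flip i)) φ) s ≡ false) → Opposite s φ
  opposite []      φ            e f = tt
  opposite (b ∷ s) (v ∷ v′ ∷ φ) e f with ∧-true {lit (just b) (a v)} e
  ... | (e₁ , e₂) = lit-true b (a v) e₁ , lit-false b (a v′) (head (f zero)) ,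
      opposite s φ e₂ λ i → subst (λ z → z ∧ satV a (sel (rmLast (flip i)) φ) s ≡ false) e₁ (f (suc i))
    where
    head : lit (just b) (a v′) ∧ satV a (sel (rmLast none) φ) s ≡ false → lit (just b) (a v′) ≡ false
    head h rewrite e₂ = trans (sym (Bool.∧-identityʳ _)) h

  sat-mix : ∀ {k} (s t : Vec Bool k) (φ : Vec (Fin n) (suc k * 2)) → Opposite s φ → satV a (sel (rmLast (mix s t)) φ) t ≡ true
  sat-mix [] [] (v ∷ v′ ∷ []) o = refl
  sat-mix (true ∷ s)  (true ∷ t)  (v ∷ v′ ∷ φ) (e , e′ , o) rewrite e  = sat-mix s t φ o
  sat-mix (true ∷ s)  (false ∷ t) (v ∷ v′ ∷ φ) (e , e′ , o) rewrite e′ = sat-mix s t φ o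
  sat-mix (false ∷ s) (true ∷ t)  (v ∷ v′ ∷ φ) (e , e′ , o) rewrite e′ = sat-mix s t φ o
  sat-mix (false ∷ s) (false ∷ t) (v ∷ v′ ∷ φ) (e , e′ , o) rewrite e  = sat-mix s t φ o

  sat-mixTail : ∀ {k} (s : Vec Bool k) t (φ : Vec (Fin n) (suc k * 2)) → Opposite s φ → a (lastPart k φ) ≡ last t →
    satV a (sel (takeAll (mixTail s t)) φ) t ≡ true
  sat-mixTail [] (d ∷ []) (v ∷ v′ ∷ []) o l rewrite l | lit-refl d = refl
  sat-mixTail (true ∷ s)  (true ∷ d ∷ t)  (v ∷ v′ ∷ φ) (e , e′ , o) l rewrite e  = sat-mixTail s (d ∷ t) φ o l
  sat-mixTail (true ∷ s)  (false ∷ d ∷ t) (v ∷ v′ ∷ φ) (e , e′ , o) l rewrite e′ = sat-mixTail s (d ∷ t) φ o l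
  sat-mixTail (false ∷ s) (true ∷ d ∷ t)  (v ∷ v′ ∷ φ) (e , e′ , o) l rewrite e′ = sat-mixTail s (d ∷ t) φ o l
  sat-mixTail (false ∷ s) (false ∷ d ∷ t) (v ∷ v′ ∷ φ) (e , e′ , o) l rewrite e  = sat-mixTail s (d ∷ t) φ o l

  sat-mixPen : ∀ {k} (s : Vec Bool (suc k)) t (φ : Vec (Fin n) (suc (suc k) * 2)) → Opposite s φ → a (lastPart (suc k) φ) ≡ last t →
    satV a (sel (codeRm (inject₁ (fromℕ k)) (mixPen s t)) φ) t ≡ true
  sat-mixPen (b ∷ []) (d ∷ []) (v ∷ v′ ∷ w ∷ w′ ∷ []) o l rewrite l | lit-refl d = refl
  sat-mixPen (true ∷ b ∷ s)  (true ∷ d ∷ t)  (v ∷ v′ ∷ φ) (e , e′ , o) l rewrite e  = sat-mixPen (b ∷ s) (d ∷ t) φ o l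
  sat-mixPen (true ∷ b ∷ s)  (false ∷ d ∷ t) (v ∷ v′ ∷ φ) (e , e′ , o) l rewrite e′ = sat-mixPen (b ∷ s) (d ∷ t) φ o l
  sat-mixPen (false ∷ b ∷ s) (true ∷ d ∷ t)  (v ∷ v′ ∷ φ) (e , e′ , o) l rewrite e′ = sat-mixPen (b ∷ s) (d ∷ t) φ o l
  sat-mixPen (false ∷ b ∷ s) (false ∷ d ∷ t) (v ∷ v′ ∷ φ) (e , e′ , o) l rewrite e  = sat-mixPen (b ∷ s) (d ∷ t) φ o l

mix-none : (s t : Vec Bool k) → mix s t ≡ none → s ≡ t
mix-none []      []      e = refl
mix-none (b ∷ s) (d ∷ t) e = cong₂ _∷_ (xor-false b d (proj₁ (∷-injective e))) (mix-none s t (proj₂ (∷-injective e)))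
  where
  xor-false : ∀ b d → b xor d ≡ false → b ≡ d
  xor-false true  true  _ = refl
  xor-false false false _ = refl

flip≢none : (i : Fin k) → flip i ≢ none
flip≢none zero    ()
flip≢none (suc i) e = flip≢none i (proj₂ (∷-injective e))

rmLast-≢ : {h h′ : Vec Bool k} → h ≢ h′ → erase (rmLast h) ≢ erase (rmLast h′)
rmLast-≢ {k} {h} {h′} ne e = ne (proj₂ (erase-codeRm (fromℕ k) (fromℕ k) h h′ e))

codeRm-≢ : {i i′ : Fin (suc k)} {h h′ : Vec Bool k} → i ≢ i′ → erase (codeRm i h) ≢ erase (codeRm i′ h′)
codeRm-≢ {i = i} {i′} {h} {h′} ne e = ne (proj₁ (erase-codeRm i i′ h h′ e))

module Twins {n k : ℕ} (𝔽 : Cl n → Bool) (min : Minimal 𝔽) (s : Vec Bool k)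
             (φ : Vec (Fin n) (suc k * 2)) (uniq : Unique φ) where

  In : Code (suc k) k (2 + k) → Vec Bool k → Set
  In σ c = 𝔽 (cl (sel σ φ) c) ≡ true

  witness : In (rmLast none) s → (∀ i → In (rmLast (flip i)) s) →
    ∃ λ a → Opposite a s φ × (∀ σ c → erase σ ≢ erase (rmLast none) → In σ c → satV a (sel σ φ) c ≡ false)
  witness base twins with min _ base
  ... | (a , a⊨ , a⊭) = a , opposite a s φ (trans (sym (sat-cl a _ s (Unique-sel (rmLast none) uniq))) a⊨)
                              (λ i → only (rmLast (flip i)) s (rmLast-≢ (flip≢none i)) (twins i)) , only
    where
    only : ∀ σ c → erase σ ≢ erase (rmLast none) → In σ c → satV a (sel σ φ) c ≡ false
    only σ c ne e = trans (sym (sat-cl a _ c (Unique-sel σ uniq))) (a⊭ _ e (cl-distinct σ (rmLast none) uniq ne c s))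

  -- The selection `mix s t` is made so that the base witness satisfies the clause with signs `t`;
  -- as `s ≢ t`, it is not the base selection, and minimality is violated.
  no-pair : ∀ {t} → s ≢ t → In (rmLast none) s → (∀ i → In (rmLast (flip i)) s) → ¬ In (rmLast (mix s t)) t
  no-pair {t} s≢t base twins e with witness base twins
  ... | (a , opp , only) with trans (sym (sat-mix a s t φ opp)) (only (rmLast (mix s t)) t (rmLast-≢ λ q → s≢t (mix-none s t q)) e)
  ... | ()

-- The case distinction is on the value of the base witness at the last vertex: whichever of `t` and
-- `u` ends with this value, its clause is satisfied as well.
no-T : ∀ {n j} (𝔽 : Cl n → Bool) (min : Minimal 𝔽) b (s : Vec Bool (suc j)) t u
  (φ : Vec (Fin n) (suc (suc (suc j)) * 2)) (uniq : Unique φ) → let open Twins 𝔽 min (b ∷ s) φ uniq in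
  In (rmLast none) (b ∷ s) → (∀ i → In (rmLast (flip i)) (b ∷ s)) →
  In (codeRm zero (mixTail s t)) t → In (codeRm (inject₁ (fromℕ (suc j))) (mixPen (b ∷ s) u)) u →
  last u ≡ not (last t) → ⊥
no-T {j = j} 𝔽 min b s t u φ@(v ∷ v′ ∷ φ′) uniq base twins et eu opp-last
  with Twins.witness 𝔽 min (b ∷ s) φ uniq base twins
... | (a , opp@(_ , _ , opp′) , only) with a (lastPart (suc j) φ′) Bool.≟ last t
... | yes p with trans (sym (sat-mixTail a s t φ′ opp′ p)) (only (codeRm zero (mixTail s t)) t (λ ()) et)
... | ()
no-T {j = j} 𝔽 min b s t u φ@(v ∷ v′ ∷ φ′) uniq base twins et eu opp-last
    | (a , opp@(_ , _ , opp′) , only) | no ¬p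
  with trans (sym (sat-mixPen a (b ∷ s) u φ opp (trans (Bool.¬-not ¬p) (sym opp-last))))
             (only (codeRm (inject₁ (fromℕ (suc j))) (mixPen (b ∷ s) u)) u
               (codeRm-≢ {i = inject₁ (fromℕ (suc j))} {fromℕ (suc (suc j))} {mixPen (b ∷ s) u} {none} λ e → Fin.fromℕ≢inject₁ (sym e)) eu)
... | ()

-- Revealing the clauses through given variables, and stability of the energy.

map-≡-drop : (f g : A → A′) (xs ys : List A) → map f (xs ++ ys) ≡ map g (xs ++ ys) → map f ys ≡ map g ys
map-≡-drop f g []       ys e = e
map-≡-drop f g (x ∷ xs) ys e = map-≡-drop f g xs ys (proj₂ (ListP.∷-injective e))

map-≡-∈ : (f g : A → A′) {xs : List A} {x : A} → map f xs ≡ map g xs → x ∈ xs → f x ≡ g x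
map-≡-∈ f g e (here refl) = proj₁ (ListP.∷-injective e)
map-≡-∈ f g e (there q)   = map-≡-∈ f g (proj₂ (ListP.∷-injective e)) q

signs : ∀ k → List (Vec Bool k)
signs = vecs bools

∈-signs : (c : Vec Bool k) → c ∈ signs k
∈-signs = ∈-vecs ∈-bools

clausesOn : List (Vec (Fin n) k) → List (Cl n)
clausesOn {k = k} xs = concatMap (λ x → map (cl x) (signs k)) xs

∑-clausesOn : (xs : List (Vec (Fin n) k)) (f : Cl n → ℕ) → ∑ (clausesOn xs) f ≡ ∑ xs (λ x → ∑ (signs k) λ c → f (cl x c))
∑-clausesOn {k = k} xs f = trans (∑-concatMap _ xs f) (∑-cong xs λ x → ∑-map (cl x) (signs k) f)

length-clausesOn : (xs : List (Vec (Fin n) k)) → length (clausesOn xs) ≡ length xs * 2 ^ k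
length-clausesOn {k = k} xs = begin
  length (clausesOn xs)                        ≡⟨ trans (length≡∑1 (clausesOn xs)) (∑-clausesOn xs _) ⟩
  ∑ xs (λ x → ∑ (signs k) λ c → 1)             ≡⟨ ∑-const xs _ ⟩
  length xs * ∑ (signs k) (λ c → 1)            ≡⟨ cong (length xs *_) (trans (sym (length≡∑1 (signs k))) (length-vecs bools k)) ⟩
  length xs * 2 ^ k ∎
  where open ≡-Reasoning

∈-clausesOn : {xs : List (Vec (Fin n) k)} {x : Vec (Fin n) k} (c : Vec Bool k) → x ∈ xs → cl x c ∈ clausesOn xs
∈-clausesOn {x = x} c x∈ = ∈-concatMap⁺ _ (Any.map (λ { refl → ∈-map⁺ (cl x) (∈-signs c) }) x∈)

star : (k′ : ℕ) → Fin n → List (Cl n)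
star {n} k′ w = clausesOn (map (w ∷_) (tuples n k′))

touching : (k′ : ℕ) → Vec (Fin n) m → List (Cl n)
touching k′ []      = []
touching k′ (w ∷ W) = star k′ w ++ touching k′ W

length-touching : (k′ : ℕ) (W : Vec (Fin n) m) → length (touching k′ W) ≡ m * (n ^ k′ * 2 ^ suc k′)
length-touching k′ []      = refl
length-touching {n} {suc m} k′ (w ∷ W) = trans (length-++ (star k′ w))
  (cong₂ _+_ (trans (length-clausesOn (map (w ∷_) (tuples n k′)))
    (cong (_* 2 ^ suc k′) (trans (length-map (w ∷_) (tuples n k′)) (length-tuples n k′)))) (length-touching k′ W))

∈-touching : {k′ : ℕ} (W : Vec (Fin n) m) (i : Fin m) (t : Vec (Fin n) k′) (c : Vec Bool (suc k′)) →
  cl (lookup W i ∷ t) c ∈ touching k′ W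
∈-touching (w ∷ W) zero    t c = ∈-++⁺ˡ (∈-clausesOn c (∈-map⁺ (w ∷_) (∈-tuples t)))
∈-touching {k′ = k′} (w ∷ W) (suc i) t c = ∈-++⁺ʳ (star k′ w) (∈-touching W i t c)

module Stability (k′ n M d : ℕ) (𝔽 : Fin M → Cl n → Bool) where
  open CondExp M d

  K = suc k′

  Y : Cl n → Ω → ℕ
  Y C ω = ⟦ 𝔽 ω C ⟧

  key : Vec (Fin n) m → Ω → List Bool
  key W ω = map (𝔽 ω) (touching k′ W)

  key-refines : (y : Vec (Fin n) r) (W : Vec (Fin n) m) → Refines (key (y Vec.++ W)) (key W)
  key-refines []      W ω ω′ e = e
  key-refines (v ∷ y) W ω ω′ e = key-refines y W ω ω′ (map-≡-drop (𝔽 ω) (𝔽 ω′) (star k′ v) (touching k′ (y Vec.++ W)) e)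

  key-determines : (x : Vec (Fin n) K) (W : Vec (Fin n) m) → Unique x → Meet x W → ∀ c ω ω′ →
    key W ω ≡ key W ω′ → 𝔽 ω (cl x c) ≡ 𝔽 ω′ (cl x c)
  key-determines x W u (i , i′ , e) c ω ω′ eq rewrite cl-front x c u i | e =
    map-≡-∈ (𝔽 ω) (𝔽 ω′) eq (∈-touching W i′ (removeAt x i) (lookup c i ∷ removeAt c i))

  -- Every clause is repeated once for each ordering of its variables, and tuples with repetitions
  -- occur too. This matches the sums over all tuples that come from selections in `φ`.
  clauses : List (Cl n)
  clauses = clausesOn (tuples n K)

  length-clauses : length clauses ≡ n ^ K * 2 ^ K
  length-clauses = trans (length-clausesOn (tuples n K)) (cong (_* 2 ^ K) (length-tuples n K))

  energyAt : Vec (Fin n) m → ℕ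
  energyAt W = ∑ clauses λ C → energy (key W) (Y C)

  drops : Vec (Fin n) r → Vec (Fin n) m → ℕ
  drops y W = ∑ clauses λ C → ∑ Ωs λ ω → ⟦ drop (key W) (key (y Vec.++ W)) (Y C) ω ⟧

  μ² = M ! * M !

  cap : ℕ
  cap = n ^ K * 2 ^ K * (M * (2 * d * (2 * d)))

  energyAt-increment : (y : Vec (Fin n) r) (W : Vec (Fin n) m) → energyAt W + drops y W * μ² ≤ energyAt (y Vec.++ W)
  energyAt-increment y W = ≤-trans
    (≤-reflexive (trans (cong (energyAt W +_) (sym (∑-*ʳ clauses _ μ²))) (sym (∑-+ clauses _ _))))
    (∑-mono clauses λ C → energy-increment (key W) (key (y Vec.++ W)) (Y C) (key-refines y W))

  energyAt-bound : (W : Vec (Fin n) m) → energyAt W ≤ cap * μ²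
  energyAt-bound W = begin
    energyAt W
      ≤⟨ ∑-bound clauses (λ C → ∑-bound Ωs λ ω → *-mono-≤ (P≤L (key W) (Y C) (λ ω → ⟦⟧≤1 (𝔽 ω C)) ω) (P≤L (key W) (Y C) (λ ω → ⟦⟧≤1 (𝔽 ω C)) ω)) ⟩
    length clauses * (length Ωs * (L * L))
      ≡⟨ cong₂ (λ a b → a * (b * (L * L))) length-clauses (length-allFin M) ⟩
    n ^ K * 2 ^ K * (M * (L * L))
      ≡⟨ lem (n ^ K * 2 ^ K) M (2 * d) (M !) ⟩
    cap * μ² ∎
    where
    open ≤-Reasoning
    lem : ∀ a m c f → a * (m * (c * f * (c * f))) ≡ a * (m * (c * c)) * (f * f)
    lem = solve-∀

  totalEnergy : ℕ → ℕ
  totalEnergy m = ∑ (tuples n m) energyAt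

  totalDrops : ℕ → ℕ → ℕ
  totalDrops r m = ∑ (tuples n m) λ W → ∑ (tuples n r) λ y → drops y W

  -- For uniform `W` and `y` the extension `y ++ W` is again a uniform tuple; this is why energies
  -- are averaged over all `W` of a given length instead of following a single one.
  totalEnergy-increment : ∀ r m → n ^ r * totalEnergy m + totalDrops r m * μ² ≤ totalEnergy (r + m)
  totalEnergy-increment r m = begin
    n ^ r * totalEnergy m + totalDrops r m * μ²
      ≡⟨ cong₂ _+_ (sym (∑-*ˡ (tuples n m) (n ^ r) _)) (sym (∑-*ʳ (tuples n m) _ μ²)) ⟩
    ∑ (tuples n m) (λ W → n ^ r * energyAt W) + ∑ (tuples n m) (λ W → ∑ (tuples n r) (λ y → drops y W) * μ²)
      ≡⟨ sym (∑-+ (tuples n m) _ _) ⟩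
    ∑ (tuples n m) (λ W → n ^ r * energyAt W + ∑ (tuples n r) (λ y → drops y W) * μ²)
      ≡⟨ ∑-cong (tuples n m) (λ W → sym (trans (∑-+ (tuples n r) _ _) (cong₂ _+_
           (trans (∑-const (tuples n r) _) (cong (_* energyAt W) (length-tuples n r))) (∑-*ʳ (tuples n r) _ μ²)))) ⟩
    ∑ (tuples n m) (λ W → ∑ (tuples n r) λ y → energyAt W + drops y W * μ²)
      ≤⟨ ∑-mono (tuples n m) (λ W → ∑-mono (tuples n r) λ y → energyAt-increment y W) ⟩
    ∑ (tuples n m) (λ W → ∑ (tuples n r) λ y → energyAt (y Vec.++ W))
      ≡⟨ trans (∑-swap (tuples n m) (tuples n r) _) (sym (∑-vecs-++ (allFin n) r m _)) ⟩
    totalEnergy (r + m) ∎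
    where open ≤-Reasoning

  totalEnergy-bound : ∀ m → totalEnergy m ≤ n ^ m * (cap * μ²)
  totalEnergy-bound m = ≤-trans (∑-bound (tuples n m) energyAt-bound) (≤-reflexive (cong (_* (cap * μ²)) (length-tuples n m)))

  module _ (r J : ℕ) where

    Few : ℕ → Set
    Few i = totalDrops r (i * r) * suc J ≤ n ^ (i * r) * (n ^ r * cap)

    -- A failure of `Few` raises the mean energy by more than a share `1 / (J + 1)` of its maximum
    -- `cap * μ²`. The leading `suc` keeps this strict, so that `J + 1` consecutive failures
    -- contradict `totalEnergy-bound`.
    grow : ∀ i → ¬ Few i → i * (n ^ (i * r) * (cap * μ²)) ≤ suc J * totalEnergy (i * r) →
           suc (suc i * (n ^ (suc i * r) * (cap * μ²))) ≤ suc J * totalEnergy (suc i * r)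
    grow i ¬few ih = begin
      suc (suc i * (n ^ (suc i * r) * (cap * μ²)))
        ≡⟨ cong (λ z → suc (suc i * (z * (cap * μ²)))) (^-distribˡ-+-* n r (i * r)) ⟩
      suc (suc i * (n ^ r * n ^ (i * r) * (cap * μ²)))
        ≡⟨ lem₁ i (n ^ r) (n ^ (i * r)) cap μ² ⟩
      1 + n ^ (i * r) * (n ^ r * cap) * μ² + n ^ r * (i * (n ^ (i * r) * (cap * μ²)))
        ≤⟨ +-mono-≤ (+-monoˡ-≤ (n ^ (i * r) * (n ^ r * cap) * μ²) 1≤μ²) (*-monoʳ-≤ (n ^ r) ih) ⟩
      suc (n ^ (i * r) * (n ^ r * cap)) * μ² + n ^ r * (suc J * totalEnergy (i * r))
        ≤⟨ +-monoˡ-≤ (n ^ r * (suc J * totalEnergy (i * r))) (*-monoˡ-≤ μ² (≰⇒> ¬few)) ⟩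
      totalDrops r (i * r) * suc J * μ² + n ^ r * (suc J * totalEnergy (i * r))
        ≡⟨ lem₂ (totalDrops r (i * r)) (suc J) μ² (n ^ r) (totalEnergy (i * r)) ⟩
      suc J * (n ^ r * totalEnergy (i * r) + totalDrops r (i * r) * μ²)
        ≤⟨ *-monoʳ-≤ (suc J) (totalEnergy-increment r (i * r)) ⟩
      suc J * totalEnergy (suc i * r) ∎
      where
      open ≤-Reasoning
      lem₁ : ∀ i a b c m → 1 + (1 + i) * (a * b * (c * m)) ≡ 1 + b * (a * c) * m + a * (i * (b * (c * m)))
      lem₁ = solve-∀
      lem₂ : ∀ t j m a e → t * j * m + a * (j * e) ≡ j * (a * e + t * m)
      lem₂ = solve-∀
      1≤μ² : 1 ≤ μ²
      1≤μ² = *-mono-≤ (1≤n! M) (1≤n! M)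

    search : ∀ i → (∃ λ l → l ≤ i × Few l) ⊎ (i * (n ^ (i * r) * (cap * μ²)) ≤ suc J * totalEnergy (i * r))
    search zero = inj₂ z≤n
    search (suc i) with search i
    ... | inj₁ (l , l≤ , f) = inj₁ (l , m≤n⇒m≤1+n l≤ , f)
    ... | inj₂ ih with totalDrops r (i * r) * suc J ≤? n ^ (i * r) * (n ^ r * cap)
    ...   | yes f = inj₁ (i , n≤1+n i , f)
    ...   | no ¬f = inj₂ (<⇒≤ (grow i ¬f ih))

    few : ∃ λ l → l ≤ J × Few l
    few with search J
    ... | inj₁ res = res
    ... | inj₂ ih with totalDrops r (J * r) * suc J ≤? n ^ (J * r) * (n ^ r * cap)
    ...   | yes f = J , ≤-refl , f
    ...   | no ¬f = ⊥-elim (1+n≰n (≤-trans (grow J ¬f ih) (*-monoʳ-≤ (suc J) (totalEnergy-bound (suc J * r)))))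

    stable : 1 ≤ n → ∃ λ m → m ≤ J * r × (Σ (Vec (Fin n) m) λ W → ∑ (tuples n r) (λ y → drops y W) * suc J ≤ n ^ r * cap)
    stable 1≤n with few
    ... | (l , l≤ , f) = l * r , *-monoˡ-≤ r l≤ ,
      ∑-find (tuples n (l * r)) (λ W → ∑ (tuples n r) (λ y → drops y W) * suc J) (n ^ r * cap)
        (subst (1 ≤_) (sym (length-tuples n (l * r))) (m^n>0 n {{>-nonZero 1≤n}} (l * r)))
        (≤-trans (≤-reflexive (∑-*ʳ (tuples n (l * r)) _ (suc J)))
          (≤-trans f (≤-reflexive (cong (_* (n ^ r * cap)) (sym (length-tuples n (l * r)))))))

-- Relations with few injective blow-ups are sparse.

module Rare {n : ℕ} (k D : ℕ) where

  bc = blowConst D (suc k)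
  n₁ = suc k * 2

  -- A dense `R` forces blow-ups of density `1 / bc`. The factor 2 in `2 * bc` splits this between
  -- blow-ups with a repeated vertex, excluded by the size of `n`, and injective ones, excluded by
  -- hypothesis.
  rare : 2 * bc * (n₁ * n₁) < n → (R : Vec (Fin n) (suc k) → Bool) →
    ∑ (tuples n n₁) (λ φ → ⟦ Blow (suc k) R φ ∧ uniqueᵇ φ ⟧) * (2 * bc) < n ^ n₁ →
    ∑ (tuples n (suc k)) (λ x → ⟦ R x ⟧) * D < n ^ suc k
  rare n> R few = ≰⇒> λ dense → 1+n≰n (contra dense)
    where
    n≡ : ∃ λ n′ → n ≡ suc n′
    n≡ = pred n , sym (suc-pred n {{>-nonZero (≤-trans (s≤s z≤n) n>)}})
    G = ∑ (tuples n n₁) (λ φ → ⟦ Blow (suc k) R φ ∧ uniqueᵇ φ ⟧)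
    U = ∑ (tuples n n₁) (λ φ → ⟦ not (uniqueᵇ φ) ⟧)
    split : ∀ a b → ⟦ a ⟧ ≤ ⟦ a ∧ b ⟧ + ⟦ not b ⟧
    split true  true  = ≤-refl
    split true  false = ≤-refl
    split false b     = z≤n
    blown : n ^ suc k ≤ ∑ (tuples n (suc k)) (λ x → ⟦ R x ⟧) * D → n ^ n₁ ≤ (G + U) * bc
    blown dense with n≡
    ... | (n′ , eq) = ≤-trans (subst (λ z → z ^ n₁ ≤ ∑ (tuples n n₁) (λ φ → ⟦ Blow (suc k) R φ ⟧) * bc) (sym eq)
        (blow-up (allFin n) (trans (length-allFin n) eq) D (suc k) R (subst (λ z → z ^ suc k ≤ ∑ (tuples n (suc k)) (λ x → ⟦ R x ⟧) * D) eq dense)))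
        (*-monoˡ-≤ bc (≤-trans (∑-mono (tuples n n₁) λ φ → split (Blow (suc k) R φ) (uniqueᵇ φ)) (≤-reflexive (∑-+ (tuples n n₁) _ _))))
    contra : n ^ suc k ≤ ∑ (tuples n (suc k)) (λ x → ⟦ R x ⟧) * D → suc (2 * n ^ n₁ * n) ≤ 2 * n ^ n₁ * n
    contra dense = begin-strict
      2 * n ^ n₁ * n
        ≤⟨ *-monoˡ-≤ n (*-monoʳ-≤ 2 (blown dense)) ⟩
      2 * ((G + U) * bc) * n
        ≡⟨ lem₁ G U bc n ⟩
      G * (2 * bc) * n + 2 * bc * (U * n)
        ≤⟨ +-monoʳ-≤ (G * (2 * bc) * n) (*-monoʳ-≤ (2 * bc) (∑-nonunique n n₁)) ⟩
      G * (2 * bc) * n + 2 * bc * (n₁ * n₁ * n ^ n₁)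
        ≡⟨ cong (G * (2 * bc) * n +_) (sym (*-assoc (2 * bc) (n₁ * n₁) (n ^ n₁))) ⟩
      G * (2 * bc) * n + 2 * bc * (n₁ * n₁) * n ^ n₁
        <⟨ +-mono-<-≤ (*-monoˡ-< n {{>-nonZero (≤-trans (s≤s z≤n) n>)}} few) (*-monoˡ-≤ (n ^ n₁) (<⇒≤ n>)) ⟩
      n ^ n₁ * n + n * n ^ n₁
        ≡⟨ lem₂ (n ^ n₁) n ⟩
      2 * n ^ n₁ * n ∎
      where
      open ≤-Reasoning
      lem₁ : ∀ g u b n → 2 * ((g + u) * b) * n ≡ g * (2 * b) * n + 2 * b * (u * n)
      lem₁ = solve-∀
      lem₂ : ∀ a n → a * n + n * a ≡ 2 * a * n
      lem₂ = solve-∀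

-- Joint occurrence of likely clauses within one class.

module Conditioned (k′ n M d : ℕ) (1≤d : 1 ≤ d) (𝔽 : Fin M → Cl n → Bool) {m : ℕ} (W : Vec (Fin n) m) where
  open CondExp M d
  open Stability k′ n M d 𝔽

  κ : Ω → List Bool
  κ = key W

  dropsIn : Ω → Vec (Fin n) r → Cl n → ℕ
  dropsIn ω₀ y C = ∑ Ωs λ ω → ⟦ sim κ ω₀ ω ⟧ * ⟦ drop κ (key (y Vec.++ W)) (Y C) ω ⟧

  β : ℕ → Ω → ℕ
  β r ω₀ = ∑ (tuples n r) λ y → ∑ clauses (dropsIn ω₀ y)

  D : Ω → Cl n → Bool
  D ω₀ C = heavy κ (Y C) ω₀

  nonZeroL : NonZero L
  nonZeroL = m*n≢0 (2 * d) (M !) {{m*n≢0 2 d {{_}} {{>-nonZero 1≤d}}}} {{M !≢0}}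

  -- Averaged over the class of `ω` and over both tuples, the drops exceed the share `1 / J′`.
  atypical : ℕ → ℕ → Ω → Bool
  atypical r J′ ω = n ^ r * n ^ K * cls κ ω <ᵇ β r ω * J′

  ∑β : ∀ r → ∑ Ωs (λ ω → β r ω * inv (cls κ ω)) ≡ L * ∑ (tuples n r) (λ y → drops y W)
  ∑β r = begin
    ∑ Ωs (λ ω → β r ω * inv (cls κ ω))
      ≡⟨ ∑-cong Ωs (λ ω → trans (sym (∑-*ʳ (tuples n r) _ _)) (∑-cong (tuples n r) λ y → sym (∑-*ʳ clauses _ _))) ⟩
    ∑ Ωs (λ ω → ∑ (tuples n r) λ y → ∑ clauses λ C → P κ (dr y C) ω)
      ≡⟨ trans (∑-swap Ωs (tuples n r) _) (∑-cong (tuples n r) λ y → ∑-swap Ωs clauses _) ⟩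
    ∑ (tuples n r) (λ y → ∑ clauses λ C → ∑ Ωs λ ω → P κ (dr y C) ω)
      ≡⟨ ∑-cong (tuples n r) (λ y → ∑-cong clauses λ C → one y C) ⟩
    ∑ (tuples n r) (λ y → ∑ clauses λ C → L * ∑ Ωs (dr y C))
      ≡⟨ trans (∑-cong (tuples n r) λ y → ∑-*ˡ clauses L _) (∑-*ˡ (tuples n r) L _) ⟩
    L * ∑ (tuples n r) (λ y → drops y W) ∎
    where
    open ≡-Reasoning
    dr : Vec (Fin n) r → Cl n → Ω → ℕ
    dr y C ω = ⟦ drop κ (key (y Vec.++ W)) (Y C) ω ⟧
    one : ∀ y C → ∑ Ωs (λ ω → P κ (dr y C) ω) ≡ L * ∑ Ωs (dr y C)
    one y C = trans (∑-cong Ωs λ ω → sym (*-identityʳ _)) (trans (tower κ (dr y C) (λ _ → 1) (λ _ _ _ → refl))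
      (cong (L *_) (∑-cong Ωs λ ω → *-identityʳ _)))

  -- Markov's inequality. Multiplication by `inv (cls κ ω)` turns the class sum `β` into a
  -- conditional expectation, whose sum over all `ω` is given by `∑β` in terms of the drops that
  -- stability controls.
  few-atypical : ∀ r J′ J → 1 ≤ n → ∑ (tuples n r) (λ y → drops y W) * suc J ≤ n ^ r * cap →
    ∑ Ωs (λ ω → ⟦ atypical r J′ ω ⟧) * suc J ≤ J′ * (2 ^ K * (2 * d * (2 * d))) * M
  few-atypical r J′ J 1≤n st = *-cancelˡ-≤ (n ^ r * n ^ K * L)
    {{m*n≢0 (n ^ r * n ^ K) L {{m*n≢0 (n ^ r) (n ^ K) {{m^n≢0 n r {{nz}}}} {{m^n≢0 n K {{nz}}}}}} {{nonZeroL}}}} (begin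
    n ^ r * n ^ K * L * (A₀ * suc J)
      ≡⟨ lem₁ (n ^ r * n ^ K * L) A₀ (suc J) ⟩
    A₀ * (n ^ r * n ^ K * L) * suc J
      ≤⟨ *-monoˡ-≤ (suc J) sumatyp ⟩
    J′ * (L * ∑ (tuples n r) (λ y → drops y W)) * suc J
      ≡⟨ lem₂ J′ L _ (suc J) ⟩
    J′ * L * (∑ (tuples n r) (λ y → drops y W) * suc J)
      ≤⟨ *-monoʳ-≤ (J′ * L) st ⟩
    J′ * L * (n ^ r * cap)
      ≡⟨ lem₃ J′ L (n ^ r) (n ^ K) (2 ^ K) M (2 * d * (2 * d)) ⟩
    n ^ r * n ^ K * L * (J′ * (2 ^ K * (2 * d * (2 * d))) * M) ∎)
    where
    open ≤-Reasoning
    nz = >-nonZero 1≤n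
    A₀ = ∑ Ωs (λ ω → ⟦ atypical r J′ ω ⟧)
    lem₁ : ∀ a b c → a * (b * c) ≡ b * a * c
    lem₁ = solve-∀
    lem₂ : ∀ a b c d → a * (b * c) * d ≡ a * b * (c * d)
    lem₂ = solve-∀
    lem₃ : ∀ j l r k t m c → j * l * (r * (k * t * (m * c))) ≡ r * k * l * (j * (t * c) * m)
    lem₃ = solve-∀
    lem₄ : ∀ a b c → a * b * c ≡ b * (a * c)
    lem₄ = solve-∀
    pointwise : ∀ ω → ⟦ atypical r J′ ω ⟧ * (n ^ r * n ^ K * L) ≤ J′ * (β r ω * inv (cls κ ω))
    pointwise ω with atypical r J′ ω in eq
    ... | false = z≤n
    ... | true  = begin
      1 * (n ^ r * n ^ K * L)                      ≡⟨ *-identityˡ _ ⟩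
      n ^ r * n ^ K * L                            ≡⟨ cong (n ^ r * n ^ K *_) (sym (cls*inv κ ω)) ⟩
      n ^ r * n ^ K * (cls κ ω * inv (cls κ ω))    ≡⟨ sym (*-assoc (n ^ r * n ^ K) _ _) ⟩
      n ^ r * n ^ K * cls κ ω * inv (cls κ ω)      ≤⟨ *-monoˡ-≤ (inv (cls κ ω)) (<⇒≤ (≤ᵇ-true {suc _} {β r ω * J′} eq)) ⟩
      β r ω * J′ * inv (cls κ ω)                   ≡⟨ lem₄ (β r ω) J′ _ ⟩
      J′ * (β r ω * inv (cls κ ω)) ∎
    sumatyp : A₀ * (n ^ r * n ^ K * L) ≤ J′ * (L * ∑ (tuples n r) (λ y → drops y W))
    sumatyp = ≤-trans (≤-reflexive (sym (∑-*ʳ Ωs _ _))) (≤-trans (∑-mono Ωs pointwise)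
      (≤-reflexive (trans (∑-*ˡ Ωs J′ _) (cong (J′ *_) (∑β r)))))

  -- Being light is measurable with respect to `κ`, and where `C` is light its conditional
  -- probability is below `1 / d`; `tower` averages this over the classes.
  few-light : ∀ C → d * ∑ Ωs (λ ω → ⟦ 𝔽 ω C ∧ not (D ω C) ⟧) ≤ M
  few-light C = *-cancelˡ-≤ (2 * M !) {{m*n≢0 2 (M !) {{_}} {{M !≢0}}}} (begin
    2 * M ! * (d * ∑ Ωs (λ ω → ⟦ 𝔽 ω C ∧ not (D ω C) ⟧))
      ≡⟨ lem (M !) d _ ⟩
    L * ∑ Ωs (λ ω → ⟦ 𝔽 ω C ∧ not (D ω C) ⟧)
      ≡⟨ cong (L *_) (∑-cong Ωs λ ω → ⟦∧⟧ (𝔽 ω C) (not (D ω C))) ⟩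
    L * ∑ Ωs (λ ω → Y C ω * ⟦ not (D ω C) ⟧)
      ≡⟨ sym (tower κ (Y C) (λ ω → ⟦ not (D ω C) ⟧) (λ ω ω′ e → cong (λ z → ⟦ not (2 * M ! ≤ᵇ z) ⟧) (P-inv κ (Y C) ω ω′ e))) ⟩
    ∑ Ωs (λ ω → P κ (Y C) ω * ⟦ not (D ω C) ⟧)
      ≤⟨ ∑-bound Ωs (λ ω → small (P κ (Y C) ω) (2 * M !)) ⟩
    length Ωs * (2 * M !)
      ≡⟨ trans (cong (_* (2 * M !)) (length-allFin M)) (*-comm M _) ⟩
    2 * M ! * M ∎)
    where
    open ≤-Reasoning
    lem : ∀ f d x → 2 * f * (d * x) ≡ 2 * d * f * x
    lem = solve-∀
    small : ∀ a b → a * ⟦ not (b ≤ᵇ a) ⟧ ≤ b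
    small a b with b ≤ᵇ a in e
    ... | true  = ≤-trans (≤-reflexive (*-zeroʳ a)) z≤n
    ... | false = ≤-trans (≤-reflexive (*-identityʳ a)) (<⇒≤ (≤ᵇ-false {b} {a} e))

  Selection : Set
  Selection = Code (suc K) K (2 + K) × Vec Bool K

  Apart : Selection → Selection → Set
  Apart (σ , _) (τ , _) = erase σ ≢ erase τ

  chosen : Vec (Fin n) (suc K * 2) → Selection → Cl n
  chosen φ (σ , c) = cl (sel σ φ) c

  module _ (ω₀ : Ω) where

    allIn : Vec (Fin n) (suc K * 2) → List Selection → Ω → ℕ
    allIn φ []      ω = ⟦ sim κ ω₀ ω ⟧
    allIn φ (s ∷ S) ω = Y (chosen φ s) ω * allIn φ S ω

    dropsAt : Vec (Fin n) (suc K * 2) → Selection → ℕ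
    dropsAt φ (σ , c) = dropsIn ω₀ (rest σ φ) (cl (sel σ φ) c)

    allIn≤ : ∀ φ S ω → allIn φ S ω ≤ ⟦ sim κ ω₀ ω ⟧
    allIn≤ φ []      ω = ≤-refl
    allIn≤ φ (s ∷ S) ω = ≤-trans (*-mono-≤ (⟦⟧≤1 (𝔽 ω (chosen φ s))) (allIn≤ φ S ω)) (≤-reflexive (*-identityˡ _))

    -- Each other selected clause meets the variables that `σ` leaves over, by `codes-meet`, so
    -- revealing those variables decides it.
    allIn-invariant : ∀ φ → Unique φ → ∀ σ c S → ListAll.All (Apart (σ , c)) S →
      Invariant (key (rest σ φ Vec.++ W)) (allIn φ S)
    allIn-invariant φ u σ c [] ListAll.[] ω ω′ e =
      cong ⟦_⟧ (trans (sim-sym κ ω₀ ω) (trans (sim-inv κ ω′ ω (key-refines (rest σ φ) W ω ω′ e) ω₀) (sim-sym κ ω′ ω₀)))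
    allIn-invariant φ u σ c ((τ , c′) ∷ S) (ne ListAll.∷ ap) ω ω′ e =
      cong₂ (λ a b → ⟦ a ⟧ * b) (key-determines (sel τ φ) (rest σ φ Vec.++ W) (Unique-sel τ u) meet c′ ω ω′ e)
        (allIn-invariant φ u σ c S ap ω ω′ e)
      where
      meet : Meet (sel τ φ) (rest σ φ Vec.++ W)
      meet with codes-meet τ σ ≤-refl
      ... | inj₂ (_ , e′) = ⊥-elim (ne (sym e′))
      ... | inj₁ mt with mt φ
      ... | (i , i′ , ev) = i , i′ ↑ˡ m , trans ev (sym (lookup-++ˡ (rest σ φ) W i′))

    -- The clauses are imposed one by one. By `allIn-invariant` the clauses imposed so far are
    -- decided after revealing the variables outside the new one, so `condition` keeps a share
    -- `1 / (2 * d)` up to the drops. Likeliness is measured by `κ` alone and is therefore the same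
    -- throughout the class of `ω₀`.
    realise : ∀ φ → Unique φ → ∀ S → AllPairs Apart S → ListAll.All (λ s → D ω₀ (chosen φ s) ≡ true) S →
      cls κ ω₀ ≤ (2 * d) ^ length S * (∑ Ωs (allIn φ S) + ∑ S (dropsAt φ))
    realise φ u [] _ _ = ≤-reflexive (sym (trans (*-identityˡ _) (+-identityʳ _)))
    realise φ u ((σ , c) ∷ S) (ap ∷ aps) (h ListAll.∷ hs) = begin
      cls κ ω₀
        ≤⟨ realise φ u S aps hs ⟩
      (2 * d) ^ length S * (∑ Ωs (allIn φ S) + Δ)
        ≤⟨ *-monoʳ-≤ ((2 * d) ^ length S) (+-monoˡ-≤ Δ (condition κ κ′ (Y C) (allIn φ S) (key-refines (rest σ φ) W)
             (allIn-invariant φ u σ c S ap) heavy-on)) ⟩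
      (2 * d) ^ length S * (2 * d * X + ∑ Ωs (λ ω → ⟦ drop κ κ′ (Y C) ω ⟧ * allIn φ S ω) + Δ)
        ≤⟨ *-monoʳ-≤ ((2 * d) ^ length S) (+-monoˡ-≤ Δ (+-monoʳ-≤ (2 * d * X) (∑-mono Ωs λ ω →
             ≤-trans (*-monoʳ-≤ ⟦ drop κ κ′ (Y C) ω ⟧ (allIn≤ φ S ω)) (≤-reflexive (*-comm ⟦ drop κ κ′ (Y C) ω ⟧ _))))) ⟩
      (2 * d) ^ length S * (2 * d * X + dropsAt φ (σ , c) + Δ)
        ≡⟨ cong ((2 * d) ^ length S *_) (+-assoc (2 * d * X) _ Δ) ⟩
      (2 * d) ^ length S * (2 * d * X + (dropsAt φ (σ , c) + Δ))
        ≤⟨ *-monoʳ-≤ ((2 * d) ^ length S) (+-monoʳ-≤ (2 * d * X) (m≤n*m _ (2 * d) {{m*n≢0 2 d {{_}} {{>-nonZero 1≤d}}}})) ⟩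
      (2 * d) ^ length S * (2 * d * X + 2 * d * (dropsAt φ (σ , c) + Δ))
        ≡⟨ lem ((2 * d) ^ length S) (2 * d) X _ ⟩
      (2 * d) ^ length ((σ , c) ∷ S) * (X + (dropsAt φ (σ , c) + Δ)) ∎
      where
      open ≤-Reasoning
      C = cl (sel σ φ) c
      κ′ = key (rest σ φ Vec.++ W)
      Δ = ∑ S (dropsAt φ)
      X = ∑ Ωs (λ ω → Y C ω * allIn φ S ω)
      lem : ∀ t e x b → t * (e * x + e * b) ≡ e * t * (x + b)
      lem = solve-∀
      heavy-on : ∀ ω → 1 ≤ allIn φ S ω → heavy κ (Y C) ω ≡ true
      heavy-on ω 1≤ with sim κ ω₀ ω in eq | ≤-trans 1≤ (allIn≤ φ S ω)
      ... | true  | _ = trans (cong (2 * M ! ≤ᵇ_) (P-inv κ (Y C) ω ω₀ (sym (sim⇒≡ κ ω₀ ω eq)))) h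

    -- `∑-code` separates the variables of the clause from those revealed, and `β` sums over all
    -- choices of both.
    ∑-dropsAt : ∀ s → ∑ (tuples n (suc K * 2)) (λ φ → dropsAt φ s) ≤ β (2 + K) ω₀
    ∑-dropsAt (σ , c) = begin
      ∑ (tuples n (suc K * 2)) (λ φ → dropsAt φ (σ , c))
        ≡⟨ ∑-code (allFin n) σ (λ x y → dropsIn ω₀ y (cl x c)) ⟩
      ∑ (tuples n K) (λ x → ∑ (tuples n (2 + K)) λ y → dropsIn ω₀ y (cl x c))
        ≡⟨ ∑-swap (tuples n K) (tuples n (2 + K)) _ ⟩
      ∑ (tuples n (2 + K)) (λ y → ∑ (tuples n K) λ x → dropsIn ω₀ y (cl x c))
        ≤⟨ ∑-mono (tuples n (2 + K)) (λ y → ∑-mono (tuples n K) λ x → ∑-∈ (λ c → dropsIn ω₀ y (cl x c)) (∈-signs c)) ⟩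
      ∑ (tuples n (2 + K)) (λ y → ∑ (tuples n K) λ x → ∑ (signs K) λ c → dropsIn ω₀ y (cl x c))
        ≡⟨ ∑-cong (tuples n (2 + K)) (λ y → sym (∑-clausesOn (tuples n K) (dropsIn ω₀ y))) ⟩
      β (2 + K) ω₀ ∎
      where open ≤-Reasoning

    allIn-pos : ∀ φ S ω → 1 ≤ allIn φ S ω → ListAll.All (λ s → 𝔽 ω (chosen φ s) ≡ true) S
    allIn-pos φ []      ω _ = ListAll.[]
    allIn-pos φ (s@(_ , _) ∷ S) ω h with 𝔽 ω (chosen φ s) in eq
    ... | true = eq ListAll.∷ allIn-pos φ S ω (subst (1 ≤_) (+-identityʳ _) h)

    -- On an injective blow-up `realise` would yield a forbidden configuration in some formula,
    -- unless the drops account for the whole class. Summed over `φ`, so many drops contradict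
    -- typicality; injective blow-ups are therefore few, and `Rare.rare` applies.
    rare-selection : ∀ D₁ J′ S → AllPairs Apart S → (R : Vec (Fin n) (suc K) → Bool) →
      (∀ φ → Blow (suc K) R φ ≡ true → ListAll.All (λ s → D ω₀ (chosen φ s) ≡ true) S) →
      (∀ φ → Unique φ → ∀ ω → ¬ ListAll.All (λ s → 𝔽 ω (chosen φ s) ≡ true) S) →
      β (2 + K) ω₀ * J′ ≤ n ^ (2 + K) * n ^ K * cls κ ω₀ →
      let bc = blowConst D₁ (suc K); n₁ = suc K * 2 in
      2 * bc * (n₁ * n₁) < n → 2 * bc * ((2 * d) ^ length S * length S) < J′ →
      ∑ (tuples n (suc K)) (λ x → ⟦ R x ⟧) * D₁ < n ^ suc K
    rare-selection D₁ J′ S ap R blowD none-real typ n> J′> =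
      Rare.rare K D₁ n> R (*-cancelʳ-< (J′ * cls κ ω₀) _ _ (begin-strict
        G * (2 * bc) * (J′ * cls κ ω₀)
          ≡⟨ lem₁ G (2 * bc) J′ (cls κ ω₀) ⟩
        2 * bc * (G * cls κ ω₀) * J′
          ≤⟨ *-monoˡ-≤ J′ (*-monoʳ-≤ (2 * bc) bounded) ⟩
        2 * bc * (θ * (length S * β (2 + K) ω₀)) * J′
          ≡⟨ lem₂ (2 * bc) θ (length S) (β (2 + K) ω₀) J′ ⟩
        2 * bc * (θ * length S) * (β (2 + K) ω₀ * J′)
          ≤⟨ *-monoʳ-≤ (2 * bc * (θ * length S)) typ ⟩
        2 * bc * (θ * length S) * (n ^ (2 + K) * n ^ K * cls κ ω₀)
          <⟨ *-monoˡ-< (n ^ (2 + K) * n ^ K * cls κ ω₀) {{m*n≢0 _ _ {{m*n≢0 _ _ {{m^n≢0 n (2 + K) {{nz}}}} {{m^n≢0 n K {{nz}}}}}} {{>-nonZero (1≤cls κ ω₀)}}}} J′> ⟩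
        J′ * (n ^ (2 + K) * n ^ K * cls κ ω₀)
          ≡⟨ lem₃ J′ (n ^ (2 + K) * n ^ K) (cls κ ω₀) ⟩
        n ^ (2 + K) * n ^ K * (J′ * cls κ ω₀)
          ≡⟨ cong (_* (J′ * cls κ ω₀)) (trans (sym (^-distribˡ-+-* n (2 + K) K)) (cong (n ^_) (lem₄ K))) ⟩
        n ^ n₁ * (J′ * cls κ ω₀) ∎))
      where
      open ≤-Reasoning
      bc = blowConst D₁ (suc K)
      n₁ = suc K * 2
      nz = >-nonZero (≤-trans (s≤s z≤n) n>)
      θ = (2 * d) ^ length S
      G = ∑ (tuples n n₁) (λ φ → ⟦ Blow (suc K) R φ ∧ uniqueᵇ φ ⟧)
      lem₁ : ∀ g b j c → g * b * (j * c) ≡ b * (g * c) * j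
      lem₁ = solve-∀
      lem₂ : ∀ b t l x j → b * (t * (l * x)) * j ≡ b * (t * l) * (x * j)
      lem₂ = solve-∀
      lem₃ : ∀ j a c → j * (a * c) ≡ a * (j * c)
      lem₃ = solve-∀
      lem₄ : ∀ k → 2 + k + k ≡ (1 + k) * 2
      lem₄ = solve-∀
      pointwise : ∀ φ → ⟦ Blow (suc K) R φ ∧ uniqueᵇ φ ⟧ * cls κ ω₀ ≤ θ * ∑ S (dropsAt φ)
      pointwise φ with Blow (suc K) R φ in eb | uniqueᵇ φ in eu
      ... | false | _     = z≤n
      ... | true  | false = z≤n
      ... | true  | true  = ≤-trans (≤-reflexive (*-identityˡ _)) (≤-trans
        (realise φ (uniqueᵇ⇒Unique φ eu) S ap (blowD φ eb))
        (≤-reflexive (cong (λ z → θ * (z + ∑ S (dropsAt φ))) (trans (∑-cong Ωs λ ω → n<1⇒n≡0 (≰⇒> λ h →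
          none-real φ (uniqueᵇ⇒Unique φ eu) ω (allIn-pos φ S ω h))) (∑-zero Ωs)))))
      bounded : G * cls κ ω₀ ≤ θ * (length S * β (2 + K) ω₀)
      bounded = begin
        G * cls κ ω₀
          ≡⟨ sym (∑-*ʳ (tuples n n₁) _ (cls κ ω₀)) ⟩
        ∑ (tuples n n₁) (λ φ → ⟦ Blow (suc K) R φ ∧ uniqueᵇ φ ⟧ * cls κ ω₀)
          ≤⟨ ∑-mono (tuples n n₁) pointwise ⟩
        ∑ (tuples n n₁) (λ φ → θ * ∑ S (dropsAt φ))
          ≡⟨ trans (∑-*ˡ (tuples n n₁) θ _) (cong (θ *_) (∑-swap (tuples n n₁) S _)) ⟩
        θ * ∑ S (λ s → ∑ (tuples n n₁) λ φ → dropsAt φ s)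
          ≤⟨ *-monoʳ-≤ θ (∑-bound S ∑-dropsAt) ⟩
        θ * (length S * β (2 + K) ω₀) ∎

-- The rare patterns of likely clauses.

Far : Vec A k → Vec A k → Set
Far s t = ∃ λ i → ∃ λ i′ → i ≢ i′ × lookup s i ≢ lookup t i × lookup s i′ ≢ lookup t i′

far? : DecidableEquality A → (s t : Vec A k) → Dec (Far s t)
far? _≟_ s t = Fin.any? λ i → Fin.any? λ i′ → ¬? (i Fin.≟ i′) ×-dec ¬? (lookup s i ≟ lookup t i) ×-dec ¬? (lookup s i′ ≟ lookup t i′)

lookup-mix : ∀ (s t : Vec Bool k) i → lookup s i ≢ lookup t i → lookup (mix s t) i ≡ true
lookup-mix (true ∷ s)  (true ∷ t)  zero ne = ⊥-elim (ne refl)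
lookup-mix (true ∷ s)  (false ∷ t) zero ne = refl
lookup-mix (false ∷ s) (true ∷ t)  zero ne = refl
lookup-mix (false ∷ s) (false ∷ t) zero ne = ⊥-elim (ne refl)
lookup-mix (_ ∷ s) (_ ∷ t) (suc i) ne = lookup-mix s t i ne

lookup-flip : ∀ (l i : Fin k) → lookup (flip l) i ≡ true → i ≡ l
lookup-flip l i e with i Fin.≟ l
... | yes p = p
... | no ne with trans (sym e) (trans (lookup∘update′ ne none true) (lookup-replicate i false))
... | ()

-- The reason for asking two differences: with exactly one, `mix s t` would be a `flip`, and the
-- second clause would share its variables with a twin clause, violating `Apart`.
far⇒mix≢flip : ∀ {s t : Vec Bool k} → Far s t → ∀ l → mix s t ≢ flip l
far⇒mix≢flip {s = s} {t} (i , i′ , i≢ , ne , ne′) l e =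
  i≢ (trans (lookup-flip l i (trans (sym (cong (λ z → lookup z i) e)) (lookup-mix s t i ne)))
       (sym (lookup-flip l i′ (trans (sym (cong (λ z → lookup z i′) e)) (lookup-mix s t i′ ne′)))))

far⇒≢ : ∀ {s t : Vec A k} → Far s t → s ≢ t
far⇒≢ (i , _ , _ , ne , _) refl = ne refl

flip-injective : ∀ {l l′ : Fin k} → flip l ≡ flip l′ → l ≡ l′
flip-injective {l = l} {l′} e = lookup-flip l′ l (trans (sym (cong (λ z → lookup z l) e)) (lookup∘update l none true))

pairOn : (Cl n → Bool) → (s t : Vec Bool k) → Vec (Fin n) k → Bool
pairOn Q s t x = Q (cl x s) ∧ Q (cl x t)

-- The last entry of z is ignored, so that all types are predicates on (k + 1)-tuples.
pairType : (Cl n → Bool) → (s t : Vec Bool k) → Vec (Fin n) (suc k) → Bool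
pairType {k = k} Q s t z = pairOn Q s t (removeAt z (fromℕ k))

-- The edges of T_k on z, with signs s and t on the undirected ones; for the directed edge one of
-- its two signs u is enough, namely the one opposite to t at the vertex the edge points to.
tType : ∀ {j} → (Cl n → Bool) → (s t u : Vec Bool (suc j)) → Vec (Fin n) (suc (suc j)) → Bool
tType {j = j} Q s t u z = Q (cl (removeAt z (fromℕ (suc j))) s) ∧ Q (cl (removeAt z zero) t)
  ∧ Q (cl (removeAt z (inject₁ (fromℕ j))) u)

blow-codeRm : (R : Vec (Fin n) (suc k) → Bool) → ∀ φ → Blow (suc k) R φ ≡ true → ∀ i h (f : Vec (Fin n) k → Bool) →
  (∀ z → R z ≡ true → f (removeAt z i) ≡ true) → f (sel (codeRm i h) φ) ≡ true
blow-codeRm R φ e i h f Rf = trans (cong f (sel-codeRm i h φ)) (Rf _ (Blow-pick R (insertAt h i false) φ e))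

pair-left : (Q : Cl n → Bool) (s t : Vec Bool k) → ∀ z → pairType Q s t z ≡ true → Q (cl (removeAt z (fromℕ k)) s) ≡ true
pair-left {k = k} Q s t z e = proj₁ (∧-true {Q (cl (removeAt z (fromℕ k)) s)} e)

pair-right : (Q : Cl n → Bool) (s t : Vec Bool k) → ∀ z → pairType Q s t z ≡ true → Q (cl (removeAt z (fromℕ k)) t) ≡ true
pair-right {k = k} Q s t z e = proj₂ (∧-true {Q (cl (removeAt z (fromℕ k)) s)} e)

-- The blow-up lies in an actual formula here, so no conditioning is involved: there is no injective
-- blow-up at all, and any difference between `s` and `t` suffices.
rare-double : ∀ {k} D₁ (𝔽 : Cl n → Bool) → Minimal 𝔽 → {s t : Vec Bool k} → s ≢ t →
  2 * blowConst D₁ (suc k) * ((suc k * 2) * (suc k * 2)) < n →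
  ∑ (tuples n (suc k)) (λ z → ⟦ pairType 𝔽 s t z ⟧) * D₁ < n ^ suc k
rare-double {n} {k} D₁ 𝔽 min {s} {t} s≢t n> = Rare.rare k D₁ n> (pairType 𝔽 s t)
  (≤-trans (s≤s (≤-reflexive (cong (_* (2 * blowConst D₁ (suc k))) (trans (∑-cong (tuples n (suc k * 2)) zeroes) (∑-zero (tuples n (suc k * 2)))))))
    (m^n>0 n {{>-nonZero (≤-trans (s≤s z≤n) n>)}} (suc k * 2)))
  where
  zeroes : ∀ φ → ⟦ Blow (suc k) (pairType 𝔽 s t) φ ∧ uniqueᵇ φ ⟧ ≡ 0
  zeroes φ with Blow (suc k) (pairType 𝔽 s t) φ in eb | uniqueᵇ φ in eu
  ... | false | _     = refl
  ... | true  | false = refl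
  ... | true  | true  = ⊥-elim (Twins.no-pair 𝔽 min s φ (uniqueᵇ⇒Unique φ eu) s≢t (left none) (λ i → left (flip i))
        (blow-codeRm (pairType 𝔽 s t) φ eb (fromℕ k) (mix s t) (λ x → 𝔽 (cl x t)) (pair-right 𝔽 s t)))
    where
    left : ∀ h → 𝔽 (cl (sel (rmLast h) φ) s) ≡ true
    left h = blow-codeRm (pairType 𝔽 s t) φ eb (fromℕ k) h (λ x → 𝔽 (cl x s)) (pair-left 𝔽 s t)

module RareTypes (j n M d : ℕ) (1≤d : 1 ≤ d) (𝔽 : Fin M → Cl n → Bool) (min : ∀ ω → Minimal (𝔽 ω))
    {m : ℕ} (W : Vec (Fin n) m) (ω₀ : Fin M) (D₁ J′ : ℕ) where
  open CondExp M d
  open Stability (suc j) n M d 𝔽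
  open Conditioned (suc j) n M d 1≤d 𝔽 W

  bc = blowConst D₁ (suc K)
  n₁ = suc K * 2

  module _ (typ : β (2 + K) ω₀ * J′ ≤ n ^ (2 + K) * n ^ K * cls κ ω₀) (n> : 2 * bc * (n₁ * n₁) < n)
           (J′> : 2 * bc * ((2 * d) ^ (3 + K) * (3 + K)) < J′) where

    twin : Vec Bool K → Fin K → Selection
    twin s i = rmLast (flip i) , s

    twins : Vec Bool K → List Selection
    twins s = List.tabulate (twin s)

    twins-apart : ∀ s → AllPairs Apart (twins s)
    twins-apart s = AllPairs.tabulate⁺ {f = twin s} λ i≢ → rmLast-≢ λ e → i≢ (flip-injective e)

    -- `3 + K` is the size of the configuration for `T_k`: a base clause, its `K` twins and two
    -- further edges. The one for far pairs is smaller by one.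
    enough : ∀ {l} → l ≤ 3 + K → 2 * bc * ((2 * d) ^ l * l) < J′
    enough l≤ = ≤-trans (s≤s (*-monoʳ-≤ (2 * bc) (*-mono-≤ (^-monoʳ-≤ (2 * d) {{m*n≢0 2 d {{_}} {{>-nonZero 1≤d}}}} l≤) l≤))) J′>

    rare-far : ∀ {s t} → Far s t → ∑ (tuples n (suc K)) (λ z → ⟦ pairType (D ω₀) s t z ⟧) * D₁ < n ^ suc K
    rare-far {s} {t} far = rare-selection ω₀ D₁ J′ S apart (pairType (D ω₀) s t) blowD none-real typ n>
        (enough (≤-trans (≤-reflexive (cong (2 +_) (ListP.length-tabulate {n = K} (twin s)))) (n≤1+n _)))
      where
      S : List Selection
      S = (rmLast none , s) ∷ (rmLast (mix s t) , t) ∷ twins s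
      apart : AllPairs Apart S
      apart = (rmLast-≢ (λ e → far⇒≢ far (mix-none s t (sym e)))
                ListAll.∷ ListAll.tabulate⁺ {f = twin s} λ i → rmLast-≢ λ e → flip≢none i (sym e))
            ∷ ListAll.tabulate⁺ {f = twin s} (λ i → rmLast-≢ (far⇒mix≢flip far i)) ∷ twins-apart s
      blowD : ∀ φ → Blow (suc K) (pairType (D ω₀) s t) φ ≡ true → ListAll.All (λ q → D ω₀ (chosen φ q) ≡ true) S
      blowD φ e = left none ListAll.∷
          blow-codeRm (pairType (D ω₀) s t) φ e (fromℕ K) (mix s t) (λ x → D ω₀ (cl x t)) (pair-right (D ω₀) s t) ListAll.∷
          ListAll.tabulate⁺ {f = twin s} (λ i → left (flip i))
        where
        left : ∀ h → D ω₀ (cl (sel (rmLast h) φ) s) ≡ true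
        left h = blow-codeRm (pairType (D ω₀) s t) φ e (fromℕ K) h (λ x → D ω₀ (cl x s)) (pair-left (D ω₀) s t)
      none-real : ∀ φ → Unique φ → ∀ ω → ¬ ListAll.All (λ q → 𝔽 ω (chosen φ q) ≡ true) S
      none-real φ u ω (e₁ ListAll.∷ e₂ ListAll.∷ es) =
        Twins.no-pair (𝔽 ω) (min ω) s φ u (far⇒≢ far) e₁ (ListAll.tabulate⁻ {f = twin s} es) e₂

    rare-T : ∀ s t u → Vec.last u ≡ not (Vec.last t) → ∑ (tuples n (suc K)) (λ z → ⟦ tType (D ω₀) s t u z ⟧) * D₁ < n ^ suc K
    rare-T (b ∷ s) t u lst = rare-selection ω₀ D₁ J′ S apart (tType (D ω₀) (b ∷ s) t u) blowD none-real typ n>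
        (enough (≤-reflexive (cong (3 +_) (ListP.length-tabulate {n = K} (twin (b ∷ s))))))
      where
      pen = inject₁ (fromℕ (suc j))
      ct = codeRm zero (mixTail s t)
      cu = codeRm pen (mixPen (b ∷ s) u)
      S : List Selection
      S = (rmLast none , b ∷ s) ∷ (ct , t) ∷ (cu , u) ∷ twins (b ∷ s)
      last≢pen : fromℕ K ≢ pen
      last≢pen = Fin.fromℕ≢inject₁
      apart : AllPairs Apart S
      apart = ((λ ()) ListAll.∷ codeRm-≢ {i = fromℕ K} {pen} {none} {mixPen (b ∷ s) u} last≢pen ListAll.∷
                ListAll.tabulate⁺ {f = twin (b ∷ s)} λ i → rmLast-≢ λ e → flip≢none i (sym e))
            ∷ (codeRm-≢ {i = zero} {pen} {mixTail s t} {mixPen (b ∷ s) u} (λ ()) ListAll.∷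
                ListAll.tabulate⁺ {f = twin (b ∷ s)} λ i → codeRm-≢ {i = zero} {fromℕ K} {mixTail s t} {flip i} (λ ()))
            ∷ ListAll.tabulate⁺ {f = twin (b ∷ s)} (λ i → codeRm-≢ {i = pen} {fromℕ K} {mixPen (b ∷ s) u} {flip i} λ e → last≢pen (sym e))
            ∷ twins-apart (b ∷ s)
      R = tType (D ω₀) (b ∷ s) t u
      Q₁ Q₂ Q₃ : Vec (Fin n) (suc K) → Bool
      Q₁ z = D ω₀ (cl (removeAt z (fromℕ K)) (b ∷ s))
      Q₂ z = D ω₀ (cl (removeAt z zero) t)
      Q₃ z = D ω₀ (cl (removeAt z pen) u)
      blowD : ∀ φ → Blow (suc K) R φ ≡ true → ListAll.All (λ q → D ω₀ (chosen φ q) ≡ true) S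
      blowD φ e = base none ListAll.∷
          blow-codeRm R φ e zero (mixTail s t) (λ x → D ω₀ (cl x t)) (λ z q → proj₁ (∧-true {Q₂ z} (proj₂ (∧-true {Q₁ z} q)))) ListAll.∷
          blow-codeRm R φ e pen (mixPen (b ∷ s) u) (λ x → D ω₀ (cl x u)) (λ z q → proj₂ (∧-true {Q₂ z} (proj₂ (∧-true {Q₁ z} q)))) ListAll.∷
          ListAll.tabulate⁺ {f = twin (b ∷ s)} (λ i → base (flip i))
        where
        base : ∀ h → D ω₀ (cl (sel (rmLast h) φ) (b ∷ s)) ≡ true
        base h = blow-codeRm R φ e (fromℕ K) h (λ x → D ω₀ (cl x (b ∷ s))) (λ z q → proj₁ (∧-true {Q₁ z} q))
      none-real : ∀ φ → Unique φ → ∀ ω → ¬ ListAll.All (λ q → 𝔽 ω (chosen φ q) ≡ true) S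
      none-real φ uq ω (e₁ ListAll.∷ e₂ ListAll.∷ e₃ ListAll.∷ es) =
        no-T (𝔽 ω) (min ω) b s t u φ uq e₁ (ListAll.tabulate⁻ {f = twin (b ∷ s)} es) e₂ e₃ lst

-- Supports of clauses, and sums over k-sets.

≡-of-⇔ : ∀ {a b : Bool} → (a ≡ true → b ≡ true) → (b ≡ true → a ≡ true) → a ≡ b
≡-of-⇔ {true}  {b}     f g = sym (f refl)
≡-of-⇔ {false} {true}  f g = g refl
≡-of-⇔ {false} {false} f g = refl

lookup-ext : {x y : Vec A n} → (∀ i → lookup x i ≡ lookup y i) → x ≡ y
lookup-ext {x = x} {y} e = trans (sym (tabulate∘lookup x)) (trans (tabulate-cong e) (tabulate∘lookup y))

subset-ext : {S T : Subset n} → (∀ v → lookup S v ≡ true → lookup T v ≡ true) →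
  (∀ v → lookup T v ≡ true → lookup S v ≡ true) → S ≡ T
subset-ext f g = lookup-ext λ v → ≡-of-⇔ (f v) (g v)

im : Vec (Fin n) k → Subset n
im []      = replicate _ false
im (v ∷ x) = im x [ v ]≔ true

im⁺ : (x : Vec (Fin n) k) → ∀ i → lookup (im x) (lookup x i) ≡ true
im⁺ (v ∷ x) zero    = lookup∘update v (im x) true
im⁺ (v ∷ x) (suc i) with lookup x i Fin.≟ v
... | yes e rewrite e = lookup∘update v (im x) true
... | no ne = trans (lookup∘update′ ne (im x) true) (im⁺ x i)

im⁻ : (x : Vec (Fin n) k) → ∀ v → lookup (im x) v ≡ true → ∃ λ i → lookup x i ≡ v
im⁻ [] v e with trans (sym (lookup-replicate v false)) e
... | ()
im⁻ (w ∷ x) v e with v Fin.≟ w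
... | yes p = zero , sym p
... | no ne = let (i , q) = im⁻ x v (trans (sym (lookup∘update′ ne (im x) true)) e) in suc i , q

supp : Cl n → Subset n
supp = Vec.map is-just

supp-cl : (x : Vec (Fin n) k) (c : Vec Bool k) → supp (cl x c) ≡ im x
supp-cl {n} []      []      = map-replicate is-just nothing n
supp-cl     (v ∷ x) (b ∷ c) = trans (map-[]≔ is-just (cl x c) v) (cong (_[ v ]≔ true) (supp-cl x c))

signAt : Cl n → Fin n → Bool
signAt C v with lookup C v
... | just b  = b
-- A default off the support; `cl-signAt` reads signs on the support only.
... | nothing = false

lookup-signAt : (C : Cl n) → ∀ v → is-just (lookup C v) ≡ true → just (signAt C v) ≡ lookup C v
lookup-signAt C v e with lookup C v
... | just b = refl

lookup-cl-sign : (f : Fin n → Bool) (x : Vec (Fin n) k) → ∀ v → lookup (im x) v ≡ true →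
  lookup (cl x (Vec.map f x)) v ≡ just (f v)
lookup-cl-sign f [] v e with trans (sym (lookup-replicate v false)) e
... | ()
lookup-cl-sign f (w ∷ x) v e with v Fin.≟ w
... | yes refl = lookup∘update v (cl x (Vec.map f x)) (just (f v))
... | no ne = trans (lookup∘update′ ne (cl x (Vec.map f x)) (just (f w)))
    (lookup-cl-sign f x v (trans (sym (lookup∘update′ ne (im x) true)) e))

isNothing : (b : Maybe Bool) → is-just b ≡ false → b ≡ nothing
isNothing nothing _ = refl

cl-signAt : (C : Cl n) (x : Vec (Fin n) k) → supp C ≡ im x → C ≡ cl x (Vec.map (signAt C) x)
cl-signAt C x e = lookup-ext go
  where
  go : ∀ v → lookup C v ≡ lookup (cl x (Vec.map (signAt C) x)) v
  go v with lookup (im x) v in eq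
  ... | true  = trans (sym (lookup-signAt C v (trans (sym (lookup-map v is-just C)) (trans (cong (λ z → lookup z v) e) eq))))
                      (sym (lookup-cl-sign (signAt C) x v eq))
  ... | false = trans (isNothing (lookup C v) (trans (sym (lookup-map v is-just C)) (trans (cong (λ z → lookup z v) e) eq)))
                      (sym (isNothing _ (trans (sym (lookup-map v is-just (cl x _))) (trans (cong (λ z → lookup z v) (supp-cl x _)) eq))))

clOf : Subset n → List (Cl n)
clOf []          = [] ∷ []
clOf (true ∷ e)  = map (just true ∷_) (clOf e) ++ map (just false ∷_) (clOf e)
clOf (false ∷ e) = map (nothing ∷_) (clOf e)

∈-clOf : (C : Cl n) → C ∈ clOf (supp C)
∈-clOf []               = here refl
∈-clOf (nothing ∷ C)    = ∈-map⁺ (nothing ∷_) (∈-clOf C)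
∈-clOf (just true ∷ C)  = ∈-++⁺ˡ (∈-map⁺ (just true ∷_) (∈-clOf C))
∈-clOf (just false ∷ C) = ∈-++⁺ʳ (map (just true ∷_) (clOf (supp C))) (∈-map⁺ (just false ∷_) (∈-clOf C))

clOf-supp : (e : Subset n) {C : Cl n} → C ∈ clOf e → supp C ≡ e
clOf-supp []          (here refl) = refl
clOf-supp (false ∷ e) p with ∈-map⁻ (nothing ∷_) p
... | (C , q , refl) = cong (false ∷_) (clOf-supp e q)
clOf-supp (true ∷ e)  p with ∈-++⁻ (map (just true ∷_) (clOf e)) p
... | inj₁ p′ with ∈-map⁻ (just true ∷_) p′
...   | (C , q , refl) = cong (true ∷_) (clOf-supp e q)
clOf-supp (true ∷ e)  p | inj₂ p′ with ∈-map⁻ (just false ∷_) p′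
...   | (C , q , refl) = cong (true ∷_) (clOf-supp e q)

length-clOf : (e : Subset n) → length (clOf e) ≡ 2 ^ ∣ e ∣
length-clOf []          = refl
length-clOf (false ∷ e) = trans (length-map _ (clOf e)) (length-clOf e)
length-clOf (true ∷ e)  = trans (length-++ (map (just true ∷_) (clOf e)))
  (cong₂ _+_ (trans (length-map _ (clOf e)) (length-clOf e))
    (trans (length-map _ (clOf e)) (trans (length-clOf e) (sym (+-identityʳ _)))))

countL≡∑ : (p : A → Bool) (xs : List A) → countL p xs ≡ ∑ xs (λ x → ⟦ p x ⟧)
countL≡∑ p []       = refl
countL≡∑ p (x ∷ xs) with p x
... | true  = cong suc (countL≡∑ p xs)
... | false = countL≡∑ p xs

∑ₖ : (n k : ℕ) → (Subset n → ℕ) → ℕ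
∑ₖ n k g = ∑ (allSubsets n) λ S → ⟦ isKSet k S ⟧ * g S

∑-subsets : ∀ n (g : Subset (suc n) → ℕ) → ∑ (allSubsets (suc n)) g ≡
  ∑ (allSubsets n) (λ S → g (true ∷ S)) + ∑ (allSubsets n) (λ S → g (false ∷ S))
∑-subsets n g = trans (∑-++ (map (true ∷_) (allSubsets n)) _ g)
  (cong₂ _+_ (∑-map (true ∷_) (allSubsets n) g) (∑-map (false ∷_) (allSubsets n) g))

∑ₖ-count : ∀ n k → ∑ₖ n k (λ _ → 1) ≡ n choose k
∑ₖ-count zero    zero    = refl
∑ₖ-count zero    (suc k) = refl
∑ₖ-count (suc n) zero    = trans (∑-subsets n _) (trans (cong₂ _+_ (∑-zero (allSubsets n)) (∑ₖ-count n zero)) refl)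
∑ₖ-count (suc n) (suc k) = trans (∑-subsets n _) (trans (cong₂ _+_ (∑ₖ-count n k) (∑ₖ-count n (suc k))) (nCk+nC[k+1]≡[n+1]C[k+1] n k))

∑-allFin-suc : ∀ n (f : Fin (suc n) → ℕ) → ∑ (allFin (suc n)) f ≡ f zero + ∑ (allFin n) (λ v → f (suc v))
∑-allFin-suc n f = cong (f zero +_) (∑-tabulate {n} suc f)

-- A set of size `k + 1` arises in `k + 1` ways by adding a vertex to a `k`-set. There is only an
-- inequality because the right side also allows `v` to lie in `S` already.
∑ₖ-suc : ∀ n k (g : Subset n → ℕ) → suc k * ∑ₖ n (suc k) g ≤ ∑ (allFin n) (λ v → ∑ₖ n k λ S → g (S [ v ]≔ true))
∑ₖ-suc zero    k g = ≤-reflexive (*-zeroʳ (suc k))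
∑ₖ-suc (suc n) k g = begin
  suc k * ∑ₖ (suc n) (suc k) g
    ≡⟨ cong (suc k *_) (∑-subsets n _) ⟩
  suc k * (withTrue k + ∑ₖ n (suc k) (λ S → g (false ∷ S)))
    ≡⟨ lem k (withTrue k) _ ⟩
  withTrue k + (k * withTrue k + suc k * ∑ₖ n (suc k) (λ S → g (false ∷ S)))
    ≤⟨ +-mono-≤ (m≤n+m (withTrue k) (∑ (allSubsets n) (λ S → ⟦ isKSet k (true ∷ S) ⟧ * g (true ∷ S)))) (+-mono-≤ (trues k) (∑ₖ-suc n k (λ S → g (false ∷ S)))) ⟩
  (∑ (allSubsets n) (λ S → ⟦ isKSet k (true ∷ S) ⟧ * g (true ∷ S)) + withTrue k)
    + (∑ (allFin n) (λ v → ∑ (allSubsets n) (λ S → ⟦ isKSet k (true ∷ S) ⟧ * g (true ∷ (S [ v ]≔ true))))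
      + ∑ (allFin n) (λ v → ∑ₖ n k λ S → g (false ∷ (S [ v ]≔ true))))
    ≡⟨ cong₂ _+_ (sym (∑-subsets n _)) (trans (sym (∑-+ (allFin n) _ _)) (∑-cong (allFin n) λ v → sym (∑-subsets n _))) ⟩
  ∑ₖ (suc n) k (λ S → g (S [ zero ]≔ true)) + ∑ (allFin n) (λ v → ∑ₖ (suc n) k λ S → g (S [ suc v ]≔ true))
    ≡⟨ sym (∑-allFin-suc n _) ⟩
  ∑ (allFin (suc n)) (λ v → ∑ₖ (suc n) k λ S → g (S [ v ]≔ true)) ∎
  where
  open ≤-Reasoning
  withTrue : ℕ → ℕ
  withTrue k = ∑ₖ n k (λ S → g (true ∷ S))
  lem : ∀ k a b → (1 + k) * (a + b) ≡ a + (k * a + (1 + k) * b)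
  lem = solve-∀
  trues : ∀ k → k * withTrue k ≤ ∑ (allFin n) (λ v → ∑ (allSubsets n) (λ S → ⟦ isKSet k (true ∷ S) ⟧ * g (true ∷ (S [ v ]≔ true))))
  trues zero    = z≤n
  trues (suc k) = ∑ₖ-suc n k (λ S → g (true ∷ S))

∑ₖ≤∑-tuples : ∀ n k (g : Subset n → ℕ) → k ! * ∑ₖ n k g ≤ ∑ (tuples n k) (λ x → g (im x))
∑ₖ≤∑-tuples n zero    g = ≤-trans (≤-reflexive (*-identityˡ _)) (≤-reflexive (trans (base n g) (sym (+-identityʳ _))))
  where
  base : ∀ n g → ∑ₖ n 0 g ≡ g (replicate n false)
  base zero    g = trans (+-identityʳ _) (+-identityʳ _)
  base (suc n) g = trans (∑-subsets n _) (trans (cong (_+ ∑ₖ n 0 (λ S → g (false ∷ S))) (∑-zero (allSubsets n))) (base n λ S → g (false ∷ S)))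
∑ₖ≤∑-tuples n (suc k) g = begin
  suc k * k ! * ∑ₖ n (suc k) g                                ≡⟨ lem (suc k) (k !) _ ⟩
  k ! * (suc k * ∑ₖ n (suc k) g)                              ≤⟨ *-monoʳ-≤ (k !) (∑ₖ-suc n k g) ⟩
  k ! * ∑ (allFin n) (λ v → ∑ₖ n k λ S → g (S [ v ]≔ true))    ≡⟨ sym (∑-*ˡ (allFin n) (k !) _) ⟩
  ∑ (allFin n) (λ v → k ! * ∑ₖ n k λ S → g (S [ v ]≔ true))    ≤⟨ ∑-mono (allFin n) (λ v → ∑ₖ≤∑-tuples n k λ S → g (S [ v ]≔ true)) ⟩
  ∑ (allFin n) (λ v → ∑ (tuples n k) λ x → g (im (v ∷ x)))     ≡⟨ sym (∑-vecs (allFin n) k _) ⟩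
  ∑ (tuples n (suc k)) (λ x → g (im x)) ∎
  where
  open ≤-Reasoning
  lem : ∀ a b c → a * b * c ≡ b * (a * c)
  lem = solve-∀

-- Images of subsets under random maps

anyF⁺ : ∀ {m} (f : Fin m → Bool) i → f i ≡ true → anyF f ≡ true
anyF⁺ f zero    e rewrite e = refl
anyF⁺ f (suc i) e rewrite anyF⁺ (λ i → f (suc i)) i e = Bool.∨-zeroʳ _

anyF⁻ : ∀ {m} (f : Fin m → Bool) → anyF f ≡ true → ∃ λ i → f i ≡ true
anyF⁻ {suc m} f e with f zero in eq
... | true  = zero , eq
... | false = let (i , q) = anyF⁻ (λ i → f (suc i)) e in suc i , q

image⁺ : (f : Fin m → Fin n) (S : Subset m) → ∀ i → lookup S i ≡ true → lookup (image f S) (f i) ≡ true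
image⁺ f S i e = trans (lookup∘tabulate _ (f i)) (anyF⁺ _ i (cong₂ _∧_ e (dec-true (f i Fin.≟ f i) refl)))

image⁻ : (f : Fin m → Fin n) (S : Subset m) → ∀ v → lookup (image f S) v ≡ true → ∃ λ i → lookup S i ≡ true × f i ≡ v
image⁻ f S v e with anyF⁻ (λ i → lookup S i ∧ does (f i Fin.≟ v)) (trans (sym (lookup∘tabulate _ v)) e)
... | (i , q) with ∧-true {lookup S i} q
... | (q₁ , q₂) with f i Fin.≟ v
... | yes p = i , q₁ , p

imageVec : Vec (Fin n) m → Subset m → Subset n
imageVec []      []          = replicate _ false
imageVec (v ∷ φ) (true ∷ S)  = imageVec φ S [ v ]≔ true
imageVec (v ∷ φ) (false ∷ S) = imageVec φ S

image≡imageVec : (φ : Vec (Fin n) m) (S : Subset m) → image (lookup φ) S ≡ imageVec φ S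
image≡imageVec []      []          = lookup-ext λ v → trans (lookup∘tabulate _ v) (sym (lookup-replicate v false))
image≡imageVec (v ∷ φ) (false ∷ S) = image≡imageVec φ S
image≡imageVec (v ∷ φ) (true ∷ S)  = trans (lookup-ext go) (cong (_[ v ]≔ true) (image≡imageVec φ S))
  where
  go : ∀ w → lookup (image (lookup (v ∷ φ)) (true ∷ S)) w ≡ lookup (image (lookup φ) S [ v ]≔ true) w
  go w = trans (lookup∘tabulate _ w) (rhs w)
    where
    rhs : ∀ w → does (v Fin.≟ w) ∨ anyF (λ i → lookup S i ∧ does (lookup φ i Fin.≟ w)) ≡ lookup (image (lookup φ) S [ v ]≔ true) w
    rhs w with v Fin.≟ w
    ... | yes refl = sym (lookup∘update v (image (lookup φ) S) true)
    ... | no ne    = sym (trans (lookup∘update′ (λ e → ne (sym e)) (image (lookup φ) S) true) (lookup∘tabulate _ w))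

∑-image : ∀ n {m} (S : Subset m) (g : Subset n → ℕ) →
  ∑ (tuples n m) (λ φ → g (image (lookup φ) S)) * n ^ ∣ S ∣ ≡ n ^ m * ∑ (tuples n ∣ S ∣) (λ x → g (im x))
∑-image n {m} S g = trans (cong (_* n ^ ∣ S ∣) (∑-cong (tuples n m) λ φ → cong g (image≡imageVec φ S))) (go S g)
  where
  go : ∀ {m} (S : Subset m) (g : Subset n → ℕ) →
    ∑ (tuples n m) (λ φ → g (imageVec φ S)) * n ^ ∣ S ∣ ≡ n ^ m * ∑ (tuples n ∣ S ∣) (λ x → g (im x))
  go []          g = trans (*-identityʳ _) (sym (*-identityˡ _))
  go {suc m} (false ∷ S) g = begin
    ∑ (tuples n (suc m)) (λ φ → g (imageVec φ (false ∷ S))) * n ^ ∣ S ∣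
      ≡⟨ cong (_* n ^ ∣ S ∣) (trans (∑-vecs (allFin n) m _) (trans (∑-const (allFin n) _) (cong (_* X) (length-allFin n)))) ⟩
    n * X * n ^ ∣ S ∣        ≡⟨ *-assoc n X _ ⟩
    n * (X * n ^ ∣ S ∣)      ≡⟨ cong (n *_) (go S g) ⟩
    n * (n ^ m * _)          ≡⟨ sym (*-assoc n (n ^ m) _) ⟩
    n ^ suc m * ∑ (tuples n ∣ S ∣) (λ x → g (im x)) ∎
    where
    open ≡-Reasoning
    X = ∑ (tuples n m) (λ φ → g (imageVec φ S))
  go {suc m} (true ∷ S) g = begin
    ∑ (tuples n (suc m)) (λ φ → g (imageVec φ (true ∷ S))) * (n * n ^ ∣ S ∣)
      ≡⟨ cong (_* (n * n ^ ∣ S ∣)) (∑-vecs (allFin n) m _) ⟩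
    ∑ (allFin n) X * (n * n ^ ∣ S ∣)                      ≡⟨ lem (∑ (allFin n) X) n (n ^ ∣ S ∣) ⟩
    n * (∑ (allFin n) X * n ^ ∣ S ∣)                      ≡⟨ cong (n *_) (sym (∑-*ʳ (allFin n) X _)) ⟩
    n * ∑ (allFin n) (λ v → X v * n ^ ∣ S ∣)              ≡⟨ cong (n *_) (∑-cong (allFin n) λ v → go S (λ T → g (T [ v ]≔ true))) ⟩
    n * ∑ (allFin n) (λ v → n ^ m * ∑ (tuples n ∣ S ∣) (λ x → g (im (v ∷ x)))) ≡⟨ cong (n *_) (∑-*ˡ (allFin n) (n ^ m) _) ⟩
    n * (n ^ m * ∑ (allFin n) (λ v → ∑ (tuples n ∣ S ∣) (λ x → g (im (v ∷ x))))) ≡⟨ sym (*-assoc n (n ^ m) _) ⟩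
    n ^ suc m * ∑ (allFin n) (λ v → ∑ (tuples n ∣ S ∣) (λ x → g (im (v ∷ x)))) ≡⟨ cong (n ^ suc m *_) (sym (∑-vecs (allFin n) ∣ S ∣ _)) ⟩
    n ^ suc m * ∑ (tuples n (suc ∣ S ∣)) (λ x → g (im x)) ∎
    where
    open ≡-Reasoning
    X : Fin n → ℕ
    X v = ∑ (tuples n m) (λ φ → g (imageVec φ S [ v ]≔ true))
    lem : ∀ a b c → a * (b * c) ≡ b * (a * c)
    lem = solve-∀

∑-insertAt : ∀ n m (p : Fin (suc m)) (f : Vec (Fin n) (suc m) → ℕ) →
  ∑ (tuples n (suc m)) f ≡ ∑ (allFin n) (λ v → ∑ (tuples n m) λ φ → f (insertAt φ p v))
∑-insertAt n m       zero    f = ∑-vecs (allFin n) m f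
∑-insertAt n (suc m) (suc p) f = begin
  ∑ (tuples n (suc (suc m))) f
    ≡⟨ trans (∑-vecs (allFin n) (suc m) f) (∑-cong (allFin n) λ w → ∑-insertAt n m p λ φ → f (w ∷ φ)) ⟩
  ∑ (allFin n) (λ w → ∑ (allFin n) λ v → ∑ (tuples n m) λ φ → f (w ∷ insertAt φ p v))
    ≡⟨ ∑-swap (allFin n) (allFin n) _ ⟩
  ∑ (allFin n) (λ v → ∑ (allFin n) λ w → ∑ (tuples n m) λ φ → f (w ∷ insertAt φ p v))
    ≡⟨ ∑-cong (allFin n) (λ v → sym (∑-vecs (allFin n) m _)) ⟩
  ∑ (allFin n) (λ v → ∑ (tuples n (suc m)) λ φ → f (insertAt φ (suc p) v)) ∎
  where open ≡-Reasoning

punchOuts : {p : Fin (suc m)} (ψ : Vec (Fin (suc m)) k) → All (p ≢_) ψ → ∃ λ ψ′ → ψ ≡ Vec.map (punchIn p) ψ′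
punchOuts []      []       = [] , refl
punchOuts (i ∷ ψ) (a ∷ as) with punchOuts ψ as
... | (ψ′ , e) = punchOut a ∷ ψ′ , cong₂ _∷_ (sym (Fin.punchIn-punchOut a)) e

-- The values of a uniform map at distinct points are independent and uniform. Moving the coordinate
-- `p` to the front by `∑-insertAt` splits off one value at a time.
∑-sample : ∀ n {m k} (ψ : Vec (Fin m) k) → Unique ψ → (h : Vec (Fin n) k → ℕ) →
  ∑ (tuples n m) (λ φ → h (Vec.map (lookup φ) ψ)) * n ^ k ≡ n ^ m * ∑ (tuples n k) h
∑-sample n {m} [] _ h = trans (*-identityʳ _) (trans (∑-const (tuples n m) _)
  (cong₂ _*_ (length-tuples n m) (sym (+-identityʳ _))))
∑-sample n {suc m} {suc k} (p ∷ ψ) (d ∷ u) h with punchOuts ψ d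
... | (ψ′ , refl) = begin
  ∑ (tuples n (suc m)) (λ φ → h (Vec.map (lookup φ) (p ∷ Vec.map (punchIn p) ψ′))) * n ^ suc k
    ≡⟨ cong (_* n ^ suc k) (∑-insertAt n m p _) ⟩
  ∑ (allFin n) (λ v → ∑ (tuples n m) λ φ → h (Vec.map (lookup (insertAt φ p v)) (p ∷ Vec.map (punchIn p) ψ′))) * n ^ suc k
    ≡⟨ cong (_* n ^ suc k) (∑-cong (allFin n) λ v → ∑-cong (tuples n m) λ φ → cong h (cong₂ _∷_ (insertAt-lookup φ p v) (shift φ v ψ′))) ⟩
  ∑ (allFin n) X * (n * n ^ k)
    ≡⟨ trans (lem (∑ (allFin n) X) n (n ^ k)) (cong (n *_) (sym (∑-*ʳ (allFin n) X _))) ⟩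
  n * ∑ (allFin n) (λ v → X v * n ^ k)
    ≡⟨ cong (n *_) (trans (∑-cong (allFin n) λ v → ∑-sample n ψ′ (unmap ψ′ u) (λ t → h (v ∷ t))) (∑-*ˡ (allFin n) (n ^ m) _)) ⟩
  n * (n ^ m * ∑ (allFin n) (λ v → ∑ (tuples n k) λ t → h (v ∷ t)))
    ≡⟨ trans (sym (*-assoc n (n ^ m) _)) (cong (n ^ suc m *_) (sym (∑-vecs (allFin n) k h))) ⟩
  n ^ suc m * ∑ (tuples n (suc k)) h ∎
  where
  open ≡-Reasoning
  X : Fin n → ℕ
  X v = ∑ (tuples n m) λ φ → h (v ∷ Vec.map (lookup φ) ψ′)
  lem : ∀ a b c → a * (b * c) ≡ b * (a * c)
  lem = solve-∀
  shift : ∀ φ v {k} (ψ′ : Vec (Fin m) k) → Vec.map (lookup (insertAt φ p v)) (Vec.map (punchIn p) ψ′) ≡ Vec.map (lookup φ) ψ′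
  shift φ v []       = refl
  shift φ v (i ∷ ψ′) = cong₂ _∷_ (insertAt-punchIn φ p v i) (shift φ v ψ′)
  unmapAll : ∀ {k i} (ψ′ : Vec (Fin m) k) → All (punchIn p i ≢_) (Vec.map (punchIn p) ψ′) → All (i ≢_) ψ′
  unmapAll []       []       = []
  unmapAll (i ∷ ψ′) (a ∷ as) = (λ e → a (cong (punchIn p) e)) ∷ unmapAll ψ′ as
  unmap : ∀ {k} (ψ′ : Vec (Fin m) k) → Unique (Vec.map (punchIn p) ψ′) → Unique ψ′
  unmap []       []      = []
  unmap (i ∷ ψ′) (d ∷ u) = unmapAll ψ′ d ∷ unmap ψ′ u

-- The k-PDG of likely clauses and its pullbacks.

_≟ᵐ_ : (a b : Maybe Bool) → Dec (a ≡ b)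
_≟ᵐ_ = Maybe-≡-dec Bool._≟_

differ? : (C C′ : Cl n) → Dec (∃ λ v → lookup C v ≢ lookup C′ v)
differ? C C′ = Fin.any? λ v → ¬? (lookup C v ≟ᵐ lookup C′ v)

keep : (Cl n → Bool) → List (Cl n) → List (Cl n)
keep D []       = []
keep D (C ∷ Cs) = if D C then C ∷ keep D Cs else keep D Cs

∈-keep : (D : Cl n → Bool) (Cs : List (Cl n)) → ∀ {C} → C ∈ keep D Cs → C ∈ Cs × D C ≡ true
∈-keep D (C ∷ Cs) p with D C in eq
∈-keep D (C ∷ Cs) (here refl) | true = here refl , eq
∈-keep D (C ∷ Cs) (there p)   | true = let (a , b) = ∈-keep D Cs p in there a , b
... | false = let (a , b) = ∈-keep D Cs p in there a , b

∈-keep⁺ : (D : Cl n → Bool) (Cs : List (Cl n)) → ∀ {C} → C ∈ Cs → D C ≡ true → C ∈ keep D Cs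
∈-keep⁺ D (C ∷ Cs) (here refl) e rewrite e = here refl
∈-keep⁺ D (C ∷ Cs) (there p)   e with D C
... | true  = there (∈-keep⁺ D Cs p e)
... | false = ∈-keep⁺ D Cs p e

-- Clauses after the second do not influence the label: three different clauses on one set contain a
-- far pair by `far-among-three`, and such sets are treated as exceptional. The last case concerns
-- equal clauses only.
labelOf : List (Cl n) → Label n
labelOf []            = Defs.none
labelOf (C ∷ [])      = undir
labelOf (C ∷ C′ ∷ Cs) with differ? C C′
... | yes (v , _) = dir v
... | no _        = undir

module Pullback {n : ℕ} (j : ℕ) (D : Cl n → Bool) where

  K : ℕ
  K = suc (suc j)

  De : Subset n → List (Cl n)
  De e = keep D (clOf e)

  lab : Subset n → Label n
  lab e = labelOf (De e)

  ∈-De : ∀ e {C} → C ∈ De e → supp C ≡ e × D C ≡ true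
  ∈-De e p = let (a , b) = ∈-keep D (clOf e) p in clOf-supp e a , b

  lab-edge : ∀ e → lab e ≢ Defs.none → ∃ λ C → supp C ≡ e × D C ≡ true
  lab-edge e ne with De e in eq
  ... | []     = ⊥-elim (ne refl)
  ... | C ∷ Cs = C , ∈-De e (subst (C ∈_) (sym eq) (here refl))

  lab-dir : ∀ e v → lab e ≡ dir v → ∃ λ C → ∃ λ C′ →
    (supp C ≡ e × D C ≡ true) × (supp C′ ≡ e × D C′ ≡ true) × lookup C v ≢ lookup C′ v
  lab-dir e v q with De e in eq
  ... | C ∷ C′ ∷ Cs with differ? C C′
  lab-dir e v refl | C ∷ C′ ∷ Cs | yes (_ , ne) =
    C , C′ , ∈-De e (subst (C ∈_) (sym eq) (here refl)) , ∈-De e (subst (C′ ∈_) (sym eq) (there (here refl))) , ne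

  supp-of-differ : ∀ {e : Subset n} {C C′ : Cl n} {v} → supp C ≡ e → supp C′ ≡ e → lookup C v ≢ lookup C′ v → lookup e v ≡ true
  supp-of-differ {C = C} {C′} {v} refl e′ ne with lookup (supp C) v in eq
  ... | true  = refl
  ... | false = ⊥-elim (ne (trans (isNothing _ (trans (sym (lookup-map v is-just C)) eq))
      (sym (isNothing _ (trans (sym (lookup-map v is-just C′)) (trans (cong (λ z → lookup z v) e′) eq))))))

  lab-dir-∈ : ∀ e v → lab e ≡ dir v → lookup e v ≡ true
  lab-dir-∈ e v q with lab-dir e v q
  ... | (C , C′ , (p , _) , (p′ , _) , ne) = supp-of-differ p p′ ne

  module _ {m : ℕ} (φ : Vec (Fin n) m) where

    preimage? : ∀ S v → Dec (∃ λ i → lookup S i ≡ true × lookup φ i ≡ v)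
    preimage? S v = Fin.any? λ i → (lookup S i Bool.≟ true) ×-dec (lookup φ i Fin.≟ v)

    pull : Subset m → Label n → Label m
    pull S Defs.none = Defs.none
    pull S undir     = undir
    pull S (dir v) with preimage? S v
    ... | yes (i , _) = dir i
    -- Does not arise for the label of the image of `S`, whose direction lies in that image;
    -- `pull-isUndir` and `pull-isDir` refute it.
    ... | no _        = undir

    -- Sets that `φ` collapses to fewer than `K` vertices carry no edge, so every `φ`, injective or
    -- not, yields a k-PDG.
    labφ : Subset m → Label m
    labφ S = if isKSet K S ∧ isKSet K (image (lookup φ) S) then pull S (lab (image (lookup φ) S)) else Defs.none

    pull-dir : ∀ S l i → pull S l ≡ dir i → lookup S i ≡ true × l ≡ dir (lookup φ i)
    pull-dir S (dir v) i e with preimage? S v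
    pull-dir S (dir v) i refl | yes (_ , a , b) = a , cong dir (sym b)

    labφ-dir : ∀ S i → labφ S ≡ dir i → lookup S i ≡ true × lab (image (lookup φ) S) ≡ dir (lookup φ i)
    labφ-dir S i e with isKSet K S ∧ isKSet K (image (lookup φ) S)
    ... | true = pull-dir S _ i e

    labφ-edge : ∀ S → labφ S ≢ Defs.none → lab (image (lookup φ) S) ≢ Defs.none
    labφ-edge S ne q with isKSet K S ∧ isKSet K (image (lookup φ) S)
    ... | false = ne refl
    ... | true rewrite q = ne refl

    H : PDG K m
    H = record { label = labφ ; dirIn = λ S v _ e → lookup⇒[]= v S (proj₁ (labφ-dir S v e)) }

    isUndir-labφ : ∀ S → isKSet K S ≡ true →
      isUndir (labφ S) ≡ isKSet K (image (lookup φ) S) ∧ isUndir (lab (image (lookup φ) S))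
    isDir-labφ : ∀ S → isKSet K S ≡ true →
      isDir (labφ S) ≡ isKSet K (image (lookup φ) S) ∧ isDir (lab (image (lookup φ) S))

    pull-isUndir : ∀ S → isUndir (pull S (lab (image (lookup φ) S))) ≡ isUndir (lab (image (lookup φ) S))
    pull-isDir : ∀ S → isDir (pull S (lab (image (lookup φ) S))) ≡ isDir (lab (image (lookup φ) S))
    pull-isUndir S with lab (image (lookup φ) S) in eq
    ... | Defs.none = refl
    ... | undir     = refl
    ... | dir v with preimage? S v
    ...   | yes _ = refl
    ...   | no ¬p = ⊥-elim (¬p (image⁻ (lookup φ) S v (lab-dir-∈ (image (lookup φ) S) v eq)))
    pull-isDir S with lab (image (lookup φ) S) in eq
    ... | Defs.none = refl
    ... | undir     = refl
    ... | dir v with preimage? S v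
    ...   | yes _ = refl
    ...   | no ¬p = ⊥-elim (¬p (image⁻ (lookup φ) S v (lab-dir-∈ (image (lookup φ) S) v eq)))

    isUndir-labφ S e rewrite e with isKSet K (image (lookup φ) S)
    ... | true  = pull-isUndir S
    ... | false = refl
    isDir-labφ S e rewrite e with isKSet K (image (lookup φ) S)
    ... | true  = pull-isDir S
    ... | false = refl

  opp : Vec Bool K → Vec Bool K → Bool
  opp t u = does (Vec.last u Bool.≟ not (Vec.last t))

  tTypes : Vec (Fin n) (suc K) → ℕ
  tTypes z = ∑ (signs K) λ s → ∑ (signs K) λ t → ∑ (signs K) λ u → ⟦ opp t u ∧ tType D s t u z ⟧

  -- Injectivity is asked of `ψ` alone: a copy of `T_k` in the pullback provides it, and it is what
  -- `∑-sample` requires.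
  tCount : ∀ {m} → Vec (Fin n) m → ℕ
  tCount {m} φ = ∑ (tuples m (suc K)) λ ψ → ⟦ uniqueᵇ ψ ⟧ * tTypes (Vec.map (lookup φ) ψ)

-- The edges of `Tk` as complements of single vertices.

lookup-∁⁅⁆-self : (i : Fin n) → lookup (∁ ⁅ i ⁆) i ≡ false
lookup-∁⁅⁆-self zero    = refl
lookup-∁⁅⁆-self (suc i) = lookup-∁⁅⁆-self i

lookup-∁⊥ : (l : Fin n) → lookup (∁ (replicate n false)) l ≡ true
lookup-∁⊥ zero    = refl
lookup-∁⊥ (suc l) = lookup-∁⊥ l

lookup-∁⁅⁆ : (i l : Fin n) → i ≢ l → lookup (∁ ⁅ i ⁆) l ≡ true
lookup-∁⁅⁆ zero    zero    ne = ⊥-elim (ne refl)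
lookup-∁⁅⁆ zero    (suc l) ne = lookup-∁⊥ l
lookup-∁⁅⁆ (suc i) zero    ne = refl
lookup-∁⁅⁆ (suc i) (suc l) ne = lookup-∁⁅⁆ i l (λ e → ne (cong suc e))

∣∁⊥∣ : ∀ n → ∣ ∁ (replicate n false) ∣ ≡ n
∣∁⊥∣ zero    = refl
∣∁⊥∣ (suc n) = cong suc (∣∁⊥∣ n)

∣∁⁅⁆∣ : (i : Fin (suc n)) → ∣ ∁ ⁅ i ⁆ ∣ ≡ n
∣∁⁅⁆∣ {n}     zero    = ∣∁⊥∣ n
∣∁⁅⁆∣ {suc n} (suc i) = cong suc (∣∁⁅⁆∣ i)

image-∁⁅⁆ : (f : Fin (suc m) → Fin n) (z : Vec (Fin n) (suc m)) → (∀ i → lookup z i ≡ f i) → ∀ i →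
  image f (∁ ⁅ i ⁆) ≡ im (removeAt z i)
image-∁⁅⁆ {m} f z zf i = subset-ext to from
  where
  to : ∀ v → lookup (image f (∁ ⁅ i ⁆)) v ≡ true → lookup (im (removeAt z i)) v ≡ true
  to v e with image⁻ f (∁ ⁅ i ⁆) v e
  ... | (l , a , refl) = subst (λ w → lookup (im (removeAt z i)) w ≡ true) (trans (removeAt-punchOut z i≢l) (zf l))
                           (im⁺ (removeAt z i) (punchOut i≢l))
    where
    i≢l : i ≢ l
    i≢l refl with trans (sym a) (lookup-∁⁅⁆-self i)
    ... | ()
  from : ∀ v → lookup (im (removeAt z i)) v ≡ true → lookup (image f (∁ ⁅ i ⁆)) v ≡ true
  from v e with im⁻ (removeAt z i) v e
  ... | (l′ , q) = subst (λ w → lookup (image f (∁ ⁅ i ⁆)) w ≡ true) (trans (sym (zf l)) (trans (sym at) q))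
                     (image⁺ f (∁ ⁅ i ⁆) l (lookup-∁⁅⁆ i l i≢l))
    where
    l = punchIn i l′
    i≢l : i ≢ l
    i≢l p = Fin.punchInᵢ≢i i l′ (sym p)
    at : lookup (removeAt z i) l′ ≡ lookup z l
    at = trans (cong (lookup (removeAt z i)) (sym (Fin.punchOut-punchIn i {l′}))) (removeAt-punchOut z _)

image-∘ : ∀ {l} (g : Fin m → Fin n) (f : Fin l → Fin m) (S : Subset l) → image g (image f S) ≡ image (λ i → g (f i)) S
image-∘ g f S = subset-ext to from
  where
  to : ∀ v → lookup (image g (image f S)) v ≡ true → lookup (image (λ i → g (f i)) S) v ≡ true
  to v e with image⁻ g (image f S) v e
  ... | (i , a , refl) with image⁻ f S i a
  ... | (l , b , refl) = image⁺ (λ i → g (f i)) S l b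
  from : ∀ v → lookup (image (λ i → g (f i)) S) v ≡ true → lookup (image g (image f S)) v ≡ true
  from v e with image⁻ (λ i → g (f i)) S v e
  ... | (l , b , refl) = image⁺ g (image f S) (f l) (image⁺ f S l b)

=S-refl : (S : Subset n) → (S =S S) ≡ true
=S-refl S = dec-true (≡-dec Bool._≟_ S S) refl

Tk-last : ∀ k → Tk k (∁ ⁅ fromℕ k ⁆) ≡ undir
Tk-last k rewrite =S-refl (∁ ⁅ fromℕ k ⁆) = refl

Tk-zero : ∀ k → Tk k (∁ ⁅ zero ⁆) ≡ undir
Tk-zero k with ∁ ⁅ zero ⁆ =S ∁ ⁅ fromℕ k ⁆
... | true  = refl
... | false rewrite =S-refl (∁ ⁅ zero {n = k} ⁆) = refl

∁⁅⁆-≢ : {i l : Fin n} → i ≢ l → (∁ ⁅ i ⁆ =S ∁ ⁅ l ⁆) ≡ false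
∁⁅⁆-≢ {i = i} {l} ne = dec-false (≡-dec Bool._≟_ _ _) contra
  where
  contra : ∁ ⁅ i ⁆ ≢ ∁ ⁅ l ⁆
  contra e with trans (sym (lookup-∁⁅⁆-self i)) (trans (cong (λ z → lookup z i) e) (lookup-∁⁅⁆ l i (λ q → ne (sym q))))
  ... | ()

Tk-pen : ∀ j → let k = suc (suc j) in Tk k (∁ ⁅ km1 k ⁆) ≡ dir (fromℕ k)
Tk-pen j rewrite ∁⁅⁆-≢ {i = km1 (suc (suc j))} {fromℕ (suc (suc j))} (λ e → Fin.fromℕ≢inject₁ (sym e))
  | ∁⁅⁆-≢ {i = km1 (suc (suc j))} {zero} (λ ()) | =S-refl (∁ ⁅ km1 (suc (suc j)) ⁆) = refl

memᵇ-∉ : ∀ {l} (v : Fin n) (g : Fin l → Fin n) → (∀ i → v ≢ g i) → memᵇ v (tabulate g) ≡ false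
memᵇ-∉ {l = zero}  v g ne = refl
memᵇ-∉ {l = suc l} v g ne = cong₂ _∨_ (dec-false (v Fin.≟ g zero) (ne zero)) (memᵇ-∉ v (λ i → g (suc i)) (λ i → ne (suc i)))

injective⇒uniqueᵇ : (f : Fin k → Fin n) → Injective _≡_ _≡_ f → uniqueᵇ (tabulate f) ≡ true
injective⇒uniqueᵇ {zero}  f inj = refl
injective⇒uniqueᵇ {suc k} f inj = cong₂ (λ a b → not a ∧ b) (memᵇ-∉ (f zero) (λ i → f (suc i)) (λ i e → 0≢suc (inj e)))
  (injective⇒uniqueᵇ (λ i → f (suc i)) (λ e → Fin.suc-injective (inj e)))
  where
  0≢suc : ∀ {i : Fin k} → zero ≢ suc i
  0≢suc ()

last-removeAt-pen : ∀ {A : Set} j (z : Vec A (suc (suc j))) → Vec.last (removeAt z (inject₁ (fromℕ j))) ≡ lookup z (fromℕ (suc j))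
last-removeAt-pen zero    (a ∷ b ∷ [])    = refl
last-removeAt-pen (suc j) (a ∷ b ∷ c ∷ z) = trans (last-∷ a (removeAt (b ∷ c ∷ z) (inject₁ (fromℕ j)))) (last-removeAt-pen j (b ∷ c ∷ z))
  where
  last-∷ : ∀ {A : Set} {m} (a : A) (x : Vec A (suc m)) → Vec.last (a ∷ x) ≡ Vec.last x
  last-∷ a (b ∷ x) = refl

last-map : ∀ {A B : Set} (f : A → B) (x : Vec A (suc m)) → Vec.last (Vec.map f x) ≡ f (Vec.last x)
last-map f (a ∷ [])    = refl
last-map f (a ∷ b ∷ x) = last-map f (b ∷ x)

-- Averaging the admissible bound over random maps.

choose-pos : ∀ m k → k ≤ m → 1 ≤ m choose k
choose-pos m       zero    _       = ≤-reflexive (sym refl)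
choose-pos (suc m) (suc k) (s≤s h) = ≤-trans (choose-pos m k h)
  (≤-trans (m≤m+n _ (m choose suc k)) (≤-reflexive (nCk+nC[k+1]≡[n+1]C[k+1] m k)))

*-^ : ∀ a b c → (a * b) ^ c ≡ a ^ c * b ^ c
*-^ a b zero    = refl
*-^ a b (suc c) = trans (cong (a * b *_) (*-^ a b c)) (lem a b (a ^ c) (b ^ c))
  where
  lem : ∀ a b c d → a * b * (c * d) ≡ a * c * (b * d)
  lem = solve-∀

^-cancelʳ-≤ : ∀ a b c → 1 ≤ c → a ^ c ≤ b ^ c → a ≤ b
^-cancelʳ-≤ a b (suc c) _ h = ≮⇒≥ λ b<a → <⇒≱ (^-monoˡ-< (suc c) b<a) h

2^3^-root : ∀ u v w c → 1 ≤ c → 2 ^ (u * c) * 3 ^ (v * c) ≤ 2 ^ (w * c) → 2 ^ u * 3 ^ v ≤ 2 ^ w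
2^3^-root u v w c 1≤c h = ^-cancelʳ-≤ _ _ c 1≤c (subst₂ _≤_
  (trans (sym (cong₂ _*_ (^-*-assoc 2 u c) (^-*-assoc 3 v c))) (sym (*-^ (2 ^ u) (3 ^ v) c))) (sym (^-*-assoc 2 w c)) h)

-- Replaces the summation of `u + v * log₂ 3 ≤ w` over `xs`.
2^3^-∏ : ∀ {A : Set} (xs : List A) (u v w : A → ℕ) → (∀ x → 2 ^ u x * 3 ^ v x ≤ 2 ^ w x) →
  2 ^ ∑ xs u * 3 ^ ∑ xs v ≤ 2 ^ ∑ xs w
2^3^-∏ []       u v w h = ≤-refl
2^3^-∏ (x ∷ xs) u v w h = begin
  2 ^ (u x + ∑ xs u) * 3 ^ (v x + ∑ xs v)
    ≡⟨ cong₂ _*_ (^-distribˡ-+-* 2 (u x) _) (^-distribˡ-+-* 3 (v x) _) ⟩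
  2 ^ u x * 2 ^ ∑ xs u * (3 ^ v x * 3 ^ ∑ xs v)
    ≡⟨ lem (2 ^ u x) _ _ _ ⟩
  2 ^ u x * 3 ^ v x * (2 ^ ∑ xs u * 3 ^ ∑ xs v)
    ≤⟨ *-mono-≤ (h x) (2^3^-∏ xs u v w h) ⟩
  2 ^ w x * 2 ^ ∑ xs w
    ≡⟨ sym (^-distribˡ-+-* 2 (w x) _) ⟩
  2 ^ (w x + ∑ xs w) ∎
  where
  open ≤-Reasoning
  lem : ∀ a b c d → a * b * (c * d) ≡ a * c * (b * d)
  lem = solve-∀

weigh : ∀ a {b c} → (a ≡ true → b ≡ c) → ⟦ a ⟧ * ⟦ b ⟧ ≡ ⟦ a ⟧ * ⟦ c ⟧
weigh true  h = cong (λ z → 1 * ⟦ z ⟧) (h refl)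
weigh false h = refl

module Sampling {n : ℕ} (j : ℕ) (D : Cl n → Bool) where
  open Pullback j D

  module _ {m : ℕ} (φ : Vec (Fin n) m) (ψ : Fin (suc K) → Fin m) where

    zs : Vec (Fin n) (suc K)
    zs = Vec.map (lookup φ) (tabulate ψ)

    lookup-zs : ∀ i → lookup zs i ≡ lookup φ (ψ i)
    lookup-zs i = trans (lookup-map i (lookup φ) (tabulate ψ)) (cong (lookup φ) (lookup∘tabulate ψ i))

    image-zs : ∀ i → image (lookup φ) (image ψ (∁ ⁅ i ⁆)) ≡ im (removeAt zs i)
    image-zs i = trans (image-∘ (lookup φ) ψ (∁ ⁅ i ⁆)) (image-∁⁅⁆ (λ i → lookup φ (ψ i)) zs lookup-zs i)

    sign-exists : ∀ i → labφ φ (image ψ (∁ ⁅ i ⁆)) ≢ Defs.none → ∃ λ s → D (cl (removeAt zs i) s) ≡ true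
    sign-exists i ne with lab-edge _ (labφ-edge φ (image ψ (∁ ⁅ i ⁆)) ne)
    ... | (C , e , d) = _ , trans (cong D (sym (cl-signAt C (removeAt zs i) (trans e (image-zs i))))) d

    pen : Fin (suc K)
    pen = inject₁ (fromℕ (suc j))

    last-sign : ∀ (f : Fin n → Bool) → Vec.last (Vec.map f (removeAt zs pen)) ≡ f (lookup φ (ψ (fromℕ K)))
    last-sign f = trans (last-map f (removeAt zs pen)) (cong f (trans (last-removeAt-pen (suc j) zs) (lookup-zs (fromℕ K))))

    -- The two clauses behind a directed edge differ at the vertex it points to, so one of them has
    -- the sign `b` there; that vertex comes last once `pen` is removed.
    both-signs : labφ φ (image ψ (∁ ⁅ pen ⁆)) ≡ dir (ψ (fromℕ K)) → ∀ b →
      ∃ λ u → D (cl (removeAt zs pen) u) ≡ true × Vec.last u ≡ b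
    both-signs e b with labφ-dir φ (image ψ (∁ ⁅ pen ⁆)) (ψ (fromℕ K)) e
    ... | (_ , q) with lab-dir _ _ q
    ... | (C , C′ , (p , d) , (p′ , d′) , ne) = choose (signAt C v Bool.≟ b)
      where
      v = lookup φ (ψ (fromℕ K))
      e₀ = image (lookup φ) (image ψ (∁ ⁅ pen ⁆))
      v∈ : lookup e₀ v ≡ true
      v∈ = lab-dir-∈ e₀ v q
      at : ∀ C → supp C ≡ e₀ → just (signAt C v) ≡ lookup C v
      at C s = lookup-signAt C v (trans (sym (lookup-map v is-just C)) (trans (cong (λ z → lookup z v) s) v∈))
      third : ∀ {a b c : Bool} → a ≢ b → a ≢ c → b ≡ c
      third {true}  {true}  ne _ = ⊥-elim (ne refl)
      third {true}  {false} {true} _ ne = ⊥-elim (ne refl)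
      third {true}  {false} {false} _ _ = refl
      third {false} {false} ne _ = ⊥-elim (ne refl)
      third {false} {true} {false} _ ne = ⊥-elim (ne refl)
      third {false} {true} {true} _ _ = refl
      choose : Dec (signAt C v ≡ b) → ∃ λ u → D (cl (removeAt zs pen) u) ≡ true × Vec.last u ≡ b
      choose (yes r) = Vec.map (signAt C) (removeAt zs pen) ,
        trans (cong D (sym (cl-signAt C (removeAt zs pen) (trans p (image-zs pen))))) d , trans (last-sign (signAt C)) r
      choose (no r) = Vec.map (signAt C′) (removeAt zs pen) ,
        trans (cong D (sym (cl-signAt C′ (removeAt zs pen) (trans p′ (image-zs pen))))) d′ ,
        trans (last-sign (signAt C′)) (third {signAt C v} (λ q → ne (trans (sym (at C p)) (trans (cong just q) (at C′ p′)))) r)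

    1≤tTypes : ∀ s t u → D (cl (removeAt zs (fromℕ K)) s) ≡ true → D (cl (removeAt zs zero) t) ≡ true →
      D (cl (removeAt zs pen) u) ≡ true → Vec.last u ≡ not (Vec.last t) → 1 ≤ tTypes zs
    1≤tTypes s t u ds dt du l = ≤-trans (≤-reflexive (sym one))
      (≤-trans (∑-∈ (λ u → ⟦ opp t u ∧ tType D s t u zs ⟧) (∈-signs u))
      (≤-trans (∑-∈ (λ t → ∑ (signs K) λ u → ⟦ opp t u ∧ tType D s t u zs ⟧) (∈-signs t))
        (∑-∈ (λ s → ∑ (signs K) λ t → ∑ (signs K) λ u → ⟦ opp t u ∧ tType D s t u zs ⟧) (∈-signs s))))
      where
      one : ⟦ opp t u ∧ tType D s t u zs ⟧ ≡ 1
      one = cong ⟦_⟧ (cong₂ _∧_ (dec-true (Vec.last u Bool.≟ not (Vec.last t)) l) (cong₂ _∧_ ds (cong₂ _∧_ dt du)))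

  -- A copy of `T_k` supplies some signs on its undirected edges. The clause on the directed edge is
  -- chosen after `t`, with the opposite sign at the last vertex, and the triple is then counted by
  -- `tTypes`.
  free : ∀ {m} (φ : Vec (Fin n) m) → tCount φ ≡ 0 → TkFree (H φ)
  free {m} φ z (ψ , inj , match) = contra (1≤tTypes φ ψ s t u ds dt du lst)
    where
    mS = subst (λ l → Match ψ l (labφ φ (image ψ (∁ ⁅ fromℕ K ⁆)))) (Tk-last K) (match (∁ ⁅ fromℕ K ⁆) (∣∁⁅⁆∣ (fromℕ K)))
    mT = subst (λ l → Match ψ l (labφ φ (image ψ (∁ ⁅ zero ⁆)))) (Tk-zero K) (match (∁ ⁅ zero ⁆) (∣∁⁅⁆∣ zero))
    mU = subst (λ l → Match ψ l (labφ φ (image ψ (∁ ⁅ pen φ ψ ⁆)))) (Tk-pen j) (match (∁ ⁅ pen φ ψ ⁆) (∣∁⁅⁆∣ (pen φ ψ)))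
    s = proj₁ (sign-exists φ ψ (fromℕ K) mS)
    ds = proj₂ (sign-exists φ ψ (fromℕ K) mS)
    t = proj₁ (sign-exists φ ψ zero mT)
    dt = proj₂ (sign-exists φ ψ zero mT)
    U = both-signs φ ψ mU (not (Vec.last t))
    u = proj₁ U
    du = proj₁ (proj₂ U)
    lst = proj₂ (proj₂ U)
    contra : 1 ≤ tTypes (zs φ ψ) → ⊥
    contra h = 1+n≰n (≤-trans h (≤-trans (≤-reflexive (sym (trans (cong (λ b → ⟦ b ⟧ * tTypes (zs φ ψ)) (injective⇒uniqueᵇ ψ inj)) (*-identityˡ _))))
      (≤-trans (∑-∈ (λ ψ → ⟦ uniqueᵇ ψ ⟧ * tTypes (Vec.map (lookup φ) ψ)) (∈-tuples (tabulate ψ))) (≤-reflexive z))))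

  module _ (1≤n : 1 ≤ n) (D₁ : ℕ) (rareT : ∀ s t u → Vec.last u ≡ not (Vec.last t) →
             ∑ (tuples n (suc K)) (λ z → ⟦ tType D s t u z ⟧) * D₁ ≤ n ^ suc K) where

    private instance
      nz : NonZero n
      nz = >-nonZero 1≤n

    length-signs : length (signs K) ≡ 2 ^ K
    length-signs = length-vecs bools K

    ∑-tTypes : ∑ (tuples n (suc K)) tTypes * D₁ ≤ 2 ^ K * (2 ^ K * (2 ^ K * n ^ suc K))
    ∑-tTypes = begin
      ∑ zz tTypes * D₁
        ≡⟨ cong (_* D₁) (trans (∑-swap zz (signs K) _) (∑-cong (signs K) λ s → trans (∑-swap zz (signs K) _)
             (∑-cong (signs K) λ t → ∑-swap zz (signs K) _))) ⟩
      ∑ (signs K) (λ s → ∑ (signs K) λ t → ∑ (signs K) λ u → X s t u) * D₁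
        ≡⟨ trans (sym (∑-*ʳ (signs K) _ D₁)) (∑-cong (signs K) λ s → trans (sym (∑-*ʳ (signs K) _ D₁)) (∑-cong (signs K) λ t → sym (∑-*ʳ (signs K) _ D₁))) ⟩
      ∑ (signs K) (λ s → ∑ (signs K) λ t → ∑ (signs K) λ u → X s t u * D₁)
        ≤⟨ ∑-bound (signs K) (λ s → ∑-bound (signs K) λ t → ∑-bound (signs K) λ u → each s t u) ⟩
      length (signs K) * (length (signs K) * (length (signs K) * n ^ suc K))
        ≡⟨ cong (λ l → l * (l * (l * n ^ suc K))) length-signs ⟩
      2 ^ K * (2 ^ K * (2 ^ K * n ^ suc K)) ∎
      where
      open ≤-Reasoning
      zz = tuples n (suc K)
      X : Vec Bool K → Vec Bool K → Vec Bool K → ℕ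
      X s t u = ∑ zz λ z → ⟦ opp t u ∧ tType D s t u z ⟧
      each : ∀ s t u → X s t u * D₁ ≤ n ^ suc K
      each s t u with Vec.last u Bool.≟ not (Vec.last t)
      ... | yes l = rareT s t u l
      ... | no _  = ≤-trans (≤-reflexive (cong (_* D₁) (∑-zero zz))) z≤n

    ∑-tCount : ∀ m → ∑ (tuples n m) tCount * D₁ ≤ n ^ m * (m ^ suc K * (2 ^ K * (2 ^ K * 2 ^ K)))
    ∑-tCount m = begin
      ∑ (tuples n m) tCount * D₁
        ≡⟨ trans (cong (_* D₁) (∑-swap (tuples n m) (tuples m (suc K)) _)) (sym (∑-*ʳ (tuples m (suc K)) _ D₁)) ⟩
      ∑ (tuples m (suc K)) (λ ψ → ∑ (tuples n m) (λ φ → ⟦ uniqueᵇ ψ ⟧ * tTypes (Vec.map (lookup φ) ψ)) * D₁)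
        ≤⟨ ∑-bound (tuples m (suc K)) each ⟩
      length (tuples m (suc K)) * (n ^ m * (2 ^ K * (2 ^ K * 2 ^ K)))
        ≡⟨ trans (cong (_* (n ^ m * (2 ^ K * (2 ^ K * 2 ^ K)))) (length-tuples m (suc K))) (lem (m ^ suc K) (n ^ m) (2 ^ K * (2 ^ K * 2 ^ K))) ⟩
      n ^ m * (m ^ suc K * (2 ^ K * (2 ^ K * 2 ^ K))) ∎
      where
      open ≤-Reasoning
      lem : ∀ a b c → a * (b * c) ≡ b * (a * c)
      lem = solve-∀
      lem₂ : ∀ a b c → a * b * c ≡ a * c * b
      lem₂ = solve-∀
      lem₃ : ∀ a b c → a * (b * (b * (b * c))) ≡ a * (b * (b * b)) * c
      lem₃ = solve-∀
      each : ∀ ψ → ∑ (tuples n m) (λ φ → ⟦ uniqueᵇ ψ ⟧ * tTypes (Vec.map (lookup φ) ψ)) * D₁ ≤ n ^ m * (2 ^ K * (2 ^ K * 2 ^ K))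
      each ψ with uniqueᵇ ψ in eq
      ... | false = ≤-trans (≤-reflexive (cong (_* D₁) (∑-zero (tuples n m)))) z≤n
      ... | true  = *-cancelʳ-≤ _ _ (n ^ suc K) {{m^n≢0 n (suc K)}} (begin
        ∑ (tuples n m) (λ φ → 1 * tTypes (Vec.map (lookup φ) ψ)) * D₁ * n ^ suc K
          ≡⟨ cong (λ z → z * D₁ * n ^ suc K) (∑-cong (tuples n m) λ φ → *-identityˡ _) ⟩
        ∑ (tuples n m) (λ φ → tTypes (Vec.map (lookup φ) ψ)) * D₁ * n ^ suc K
          ≡⟨ lem₂ (∑ (tuples n m) (λ φ → tTypes (Vec.map (lookup φ) ψ))) D₁ (n ^ suc K) ⟩
        ∑ (tuples n m) (λ φ → tTypes (Vec.map (lookup φ) ψ)) * n ^ suc K * D₁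
          ≡⟨ cong (_* D₁) (∑-sample n ψ (uniqueᵇ⇒Unique ψ eq) tTypes) ⟩
        n ^ m * ∑ (tuples n (suc K)) tTypes * D₁
          ≡⟨ *-assoc (n ^ m) _ D₁ ⟩
        n ^ m * (∑ (tuples n (suc K)) tTypes * D₁)
          ≤⟨ *-monoʳ-≤ (n ^ m) ∑-tTypes ⟩
        n ^ m * (2 ^ K * (2 ^ K * (2 ^ K * n ^ suc K)))
          ≡⟨ lem₃ (n ^ m) (2 ^ K) (n ^ suc K) ⟩
        n ^ m * (2 ^ K * (2 ^ K * 2 ^ K)) * n ^ suc K ∎)

    module _ (m : ℕ) (f : Subset n → Bool) where

      hits : Vec (Fin n) m → ℕ
      hits φ = ∑ (allSubsets m) λ S → ⟦ isKSet K S ⟧ * ⟦ isKSet K (image (lookup φ) S) ∧ f (image (lookup φ) S) ⟧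

      ∑-hits : (m choose K) * (n ^ m * (K ! * ∑ₖ n K (λ e → ⟦ f e ⟧))) ≤ ∑ (tuples n m) hits * n ^ K
      ∑-hits = begin
        (m choose K) * (n ^ m * (K ! * ∑ₖ n K (λ e → ⟦ f e ⟧)))
          ≡⟨ cong (_* (n ^ m * (K ! * ∑ₖ n K (λ e → ⟦ f e ⟧)))) (sym (trans (∑-cong (allSubsets m) λ S → sym (*-identityʳ _)) (∑ₖ-count m K))) ⟩
        ∑ (allSubsets m) (λ S → ⟦ isKSet K S ⟧) * (n ^ m * (K ! * ∑ₖ n K (λ e → ⟦ f e ⟧)))
          ≡⟨ sym (∑-*ʳ (allSubsets m) _ _) ⟩
        ∑ (allSubsets m) (λ S → ⟦ isKSet K S ⟧ * (n ^ m * (K ! * ∑ₖ n K (λ e → ⟦ f e ⟧))))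
          ≤⟨ ∑-mono (allSubsets m) each ⟩
        ∑ (allSubsets m) (λ S → ∑ (tuples n m) (λ φ → ⟦ isKSet K S ⟧ * ⟦ g (image (lookup φ) S) ⟧) * n ^ K)
          ≡⟨ trans (∑-*ʳ (allSubsets m) _ (n ^ K)) (cong (_* n ^ K) (∑-swap (allSubsets m) (tuples n m) _)) ⟩
        ∑ (tuples n m) hits * n ^ K ∎
        where
        open ≤-Reasoning
        g : Subset n → Bool
        g e = isKSet K e ∧ f e
        dup : ∀ a b → ⟦ a ⟧ * ⟦ b ⟧ ≡ ⟦ a ⟧ * ⟦ a ∧ b ⟧
        dup true  b = refl
        dup false b = refl
        each : ∀ S → ⟦ isKSet K S ⟧ * (n ^ m * (K ! * ∑ₖ n K (λ e → ⟦ f e ⟧))) ≤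
                     ∑ (tuples n m) (λ φ → ⟦ isKSet K S ⟧ * ⟦ g (image (lookup φ) S) ⟧) * n ^ K
        each S with ∣ S ∣ ≟ K
        ... | no ¬p rewrite dec-false (∣ S ∣ ≟ K) ¬p = z≤n
        ... | yes p rewrite dec-true (∣ S ∣ ≟ K) p = begin
          1 * (n ^ m * (K ! * ∑ₖ n K (λ e → ⟦ f e ⟧)))
            ≡⟨ trans (*-identityˡ _) (cong (λ z → n ^ m * (K ! * z)) (∑-cong (allSubsets n) λ e → dup (isKSet K e) (f e))) ⟩
          n ^ m * (K ! * ∑ₖ n K (λ e → ⟦ g e ⟧))
            ≤⟨ *-monoʳ-≤ (n ^ m) (∑ₖ≤∑-tuples n K (λ e → ⟦ g e ⟧)) ⟩
          n ^ m * ∑ (tuples n K) (λ x → ⟦ g (im x) ⟧)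
            ≡⟨ sym (subst (λ l → ∑ (tuples n m) (λ φ → ⟦ g (image (lookup φ) S) ⟧) * n ^ l ≡ n ^ m * ∑ (tuples n l) (λ x → ⟦ g (im x) ⟧)) p (∑-image n S (λ e → ⟦ g e ⟧))) ⟩
          ∑ (tuples n m) (λ φ → ⟦ g (image (lookup φ) S) ⟧) * n ^ K
            ≡⟨ cong (_* n ^ K) (∑-cong (tuples n m) λ φ → sym (*-identityˡ _)) ⟩
          ∑ (tuples n m) (λ φ → 1 * ⟦ g (image (lookup φ) S) ⟧) * n ^ K ∎

    undirected directed : ℕ
    undirected = ∑ₖ n K λ e → ⟦ isUndir (lab e) ⟧
    directed   = ∑ₖ n K λ e → ⟦ isDir (lab e) ⟧

    eU≡hits : ∀ {m} (φ : Vec (Fin n) m) → eU (H φ) ≡ hits m (λ e → isUndir (lab e)) φ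
    eU≡hits {m} φ = trans (countL≡∑ _ (allSubsets m)) (∑-cong (allSubsets m) λ S →
      trans (⟦∧⟧ (isKSet K S) _) (weigh (isKSet K S) (isUndir-labφ φ S)))

    eD≡hits : ∀ {m} (φ : Vec (Fin n) m) → eD (H φ) ≡ hits m (λ e → isDir (lab e)) φ
    eD≡hits {m} φ = trans (countL≡∑ _ (allSubsets m)) (∑-cong (allSubsets m) λ S →
      trans (⟦∧⟧ (isKSet K S) _) (weigh (isKSet K S) (isDir-labφ φ S)))

    eU+eD≤ : ∀ {m} (G : PDG K m) → eU G + eD G ≤ m choose K
    eU+eD≤ {m} G = begin
      eU G + eD G
        ≡⟨ trans (cong₂ _+_ (countL≡∑ _ (allSubsets m)) (countL≡∑ _ (allSubsets m))) (sym (∑-+ (allSubsets m) _ _)) ⟩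
      ∑ (allSubsets m) (λ S → ⟦ isKSet K S ∧ isUndir (label G S) ⟧ + ⟦ isKSet K S ∧ isDir (label G S) ⟧)
        ≤⟨ ∑-mono (allSubsets m) (λ S → one (isKSet K S) (label G S)) ⟩
      ∑ₖ m K (λ _ → 1)
        ≡⟨ ∑ₖ-count m K ⟩
      m choose K ∎
      where
      open ≤-Reasoning
      one : ∀ {m} a (l : Label m) → ⟦ a ∧ isUndir l ⟧ + ⟦ a ∧ isDir l ⟧ ≤ ⟦ a ⟧ * 1
      one false l         = z≤n
      one true  Defs.none = z≤n
      one true  undir     = ≤-refl
      one true  (dir v)   = ≤-refl

    -- Multiplying the bounds for the pullbacks along all maps `φ` averages in the exponent. A map
    -- that meets a copy of `T_k` gets a trivial bound, whose excess `2 * x` per `K`-set is covered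
    -- by `2 * x * tCount φ`; the hypothesis on `D₁` keeps the total excess within the `1` of
    -- `y + 1`.
    sampling : ∀ m x y → K ≤ m → m ^ suc K * (2 ^ K * (2 ^ K * 2 ^ K)) * (2 * x) ≤ D₁ →
      (∀ (G : PDG K m) → TkFree G → 2 ^ (x * eU G) * 3 ^ (x * eD G) ≤ 2 ^ (y * (m choose K))) →
      2 ^ (x * (K ! * undirected)) * 3 ^ (x * (K ! * directed)) ≤ 2 ^ (n ^ K * (y + 1))
    sampling m x y K≤m D₁≥ adm = 2^3^-root (x * (K ! * undirected)) (x * (K ! * directed)) (n ^ K * (y + 1)) (C₀ * n ^ m)
      (*-mono-≤ (choose-pos m K K≤m) (m^n>0 n m)) (begin
        2 ^ (x * (K ! * undirected) * (C₀ * n ^ m)) * 3 ^ (x * (K ! * directed) * (C₀ * n ^ m))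
          ≤⟨ *-mono-≤ (^-monoʳ-≤ 2 (scale undirected (∑-hits m (λ e → isUndir (lab e))) (∑-cong Φ eU≡hits)))
                      (^-monoʳ-≤ 3 (scale directed (∑-hits m (λ e → isDir (lab e))) (∑-cong Φ eD≡hits))) ⟩
        2 ^ (∑ Φ (λ φ → x * eU (H φ)) * n ^ K) * 3 ^ (∑ Φ (λ φ → x * eD (H φ)) * n ^ K)
          ≡⟨ trans (sym (cong₂ _*_ (^-*-assoc 2 (∑ Φ (λ φ → x * eU (H φ))) (n ^ K)) (^-*-assoc 3 (∑ Φ (λ φ → x * eD (H φ))) (n ^ K)))) (sym (*-^ (2 ^ ∑ Φ (λ φ → x * eU (H φ))) _ (n ^ K))) ⟩
        (2 ^ ∑ Φ (λ φ → x * eU (H φ)) * 3 ^ ∑ Φ (λ φ → x * eD (H φ))) ^ (n ^ K)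
          ≤⟨ ^-monoˡ-≤ (n ^ K) (2^3^-∏ Φ _ _ (λ φ → (y + 2 * x * tCount φ) * C₀) each) ⟩
        (2 ^ ∑ Φ (λ φ → (y + 2 * x * tCount φ) * C₀)) ^ (n ^ K)
          ≡⟨ ^-*-assoc 2 (∑ Φ (λ φ → (y + 2 * x * tCount φ) * C₀)) (n ^ K) ⟩
        2 ^ (∑ Φ (λ φ → (y + 2 * x * tCount φ) * C₀) * n ^ K)
          ≤⟨ ^-monoʳ-≤ 2 (*-monoˡ-≤ (n ^ K) total) ⟩
        2 ^ (n ^ m * (y + 1) * C₀ * n ^ K)
          ≡⟨ cong (2 ^_) (lem₁ (n ^ m) (y + 1) C₀ (n ^ K)) ⟩
        2 ^ (n ^ K * (y + 1) * (C₀ * n ^ m)) ∎)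
      where
      open ≤-Reasoning
      C₀ = m choose K
      Φ = tuples n m
      Q = m ^ suc K * (2 ^ K * (2 ^ K * 2 ^ K))
      lem₁ : ∀ a b c d → a * b * c * d ≡ d * b * (c * a)
      lem₁ = solve-∀
      lem₂ : ∀ x k c a → x * k * (c * a) ≡ x * (c * (a * k))
      lem₂ = solve-∀
      scale : ∀ u {h e : Vec (Fin n) m → ℕ} → C₀ * (n ^ m * (K ! * u)) ≤ ∑ Φ h * n ^ K → ∑ Φ e ≡ ∑ Φ h →
        x * (K ! * u) * (C₀ * n ^ m) ≤ ∑ Φ (λ φ → x * e φ) * n ^ K
      scale u {h} {e} le eq = begin
        x * (K ! * u) * (C₀ * n ^ m)     ≡⟨ lem₂ x (K ! * u) C₀ (n ^ m) ⟩
        x * (C₀ * (n ^ m * (K ! * u)))   ≤⟨ *-monoʳ-≤ x le ⟩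
        x * (∑ Φ h * n ^ K)              ≡⟨ sym (*-assoc x (∑ Φ h) (n ^ K)) ⟩
        x * ∑ Φ h * n ^ K                ≡⟨ cong (_* n ^ K) (trans (cong (x *_) (sym eq)) (sym (∑-*ˡ Φ x e))) ⟩
        ∑ Φ (λ φ → x * e φ) * n ^ K ∎
      each : ∀ φ → 2 ^ (x * eU (H φ)) * 3 ^ (x * eD (H φ)) ≤ 2 ^ ((y + 2 * x * tCount φ) * C₀)
      each φ with tCount φ in eq
      ... | zero  = ≤-trans (adm (H φ) (free φ eq)) (≤-reflexive (cong (λ z → 2 ^ (z * C₀)) (sym (trans (cong (y +_) (*-zeroʳ (2 * x))) (+-identityʳ y)))))
      -- Both bases are raised to 4, so that `eU + eD ≤ C₀` suffices.
      ... | suc c = begin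
        2 ^ (x * eU (H φ)) * 3 ^ (x * eD (H φ))
          ≤⟨ *-mono-≤ (^-monoˡ-≤ (x * eU (H φ)) (s≤s (s≤s (z≤n {2})))) (^-monoˡ-≤ (x * eD (H φ)) (n≤1+n 3)) ⟩
        4 ^ (x * eU (H φ)) * 4 ^ (x * eD (H φ))
          ≡⟨ trans (sym (^-distribˡ-+-* 4 (x * eU (H φ)) _)) (cong (4 ^_) (sym (*-distribˡ-+ x (eU (H φ)) _))) ⟩
        4 ^ (x * (eU (H φ) + eD (H φ)))
          ≡⟨ ^-*-assoc 2 2 (x * (eU (H φ) + eD (H φ))) ⟩
        2 ^ (2 * (x * (eU (H φ) + eD (H φ))))
          ≤⟨ ^-monoʳ-≤ 2 (≤-trans (*-monoʳ-≤ 2 (*-monoʳ-≤ x (eU+eD≤ (H φ)))) (≤-trans (≤-reflexive (sym (*-assoc 2 x C₀)))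
               (*-monoˡ-≤ C₀ (≤-trans (m≤m*n (2 * x) (suc c)) (m≤n+m _ y))))) ⟩
        2 ^ ((y + 2 * x * suc c) * C₀) ∎
      rare : 2 * x * ∑ Φ tCount ≤ n ^ m
      rare = *-cancelʳ-≤ _ _ Q {{m*n≢0 (m ^ suc K) _ {{m^n≢0 m (suc K) {{>-nonZero (≤-trans (s≤s z≤n) K≤m)}}}}
               {{m*n≢0 (2 ^ K) _ {{m^n≢0 2 K}} {{m*n≢0 (2 ^ K) _ {{m^n≢0 2 K}} {{m^n≢0 2 K}}}}}}}} (begin
        2 * x * ∑ Φ tCount * Q     ≡⟨ lem₃ (2 * x) (∑ Φ tCount) Q ⟩
        ∑ Φ tCount * (Q * (2 * x)) ≤⟨ *-monoʳ-≤ (∑ Φ tCount) D₁≥ ⟩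
        ∑ Φ tCount * D₁            ≤⟨ ∑-tCount m ⟩
        n ^ m * Q ∎)
        where
        lem₃ : ∀ a b c → a * b * c ≡ b * (c * a)
        lem₃ = solve-∀
      total : ∑ Φ (λ φ → (y + 2 * x * tCount φ) * C₀) ≤ n ^ m * (y + 1) * C₀
      total = begin
        ∑ Φ (λ φ → (y + 2 * x * tCount φ) * C₀)
          ≡⟨ trans (∑-*ʳ Φ _ C₀) (cong (_* C₀) (trans (∑-+ Φ _ _) (cong₂ _+_ (trans (∑-const Φ y) (cong (_* y) (length-tuples n m))) (∑-*ˡ Φ (2 * x) tCount)))) ⟩
        (n ^ m * y + 2 * x * ∑ Φ tCount) * C₀
          ≤⟨ *-monoˡ-≤ C₀ (+-monoʳ-≤ (n ^ m * y) rare) ⟩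
        (n ^ m * y + n ^ m) * C₀
          ≡⟨ cong (_* C₀) (trans (cong (n ^ m * y +_) (sym (*-identityʳ (n ^ m)))) (sym (*-distribˡ-+ (n ^ m) y 1))) ⟩
        n ^ m * (y + 1) * C₀ ∎

-- Minimal formulas.

_≟ᶜ_ : DecidableEquality (Cl n)
_≟ᶜ_ = ≡-dec _≟ᵐ_

_∈?_ : (C : Cl n) (Φ : List (Cl n)) → Dec (C ∈ Φ)
_∈?_ = DecMem._∈?_ _≟ᶜ_

sat-cong : {a a′ : Fin n → Bool} → (∀ i → a i ≡ a′ i) → ∀ C → sat a C ≡ sat a′ C
sat-cong e []      = refl
sat-cong e (m ∷ C) = cong₂ (λ x y → lit m x ∧ y) (e zero) (sat-cong (λ i → e (suc i)) C)

Represents : List (Cl n) → BoolFun n → Set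
Represents Φ f = (∀ a C → C ∈ Φ → sat a C ≡ true → f a ≡ true) ×
                 (∀ a → f a ≡ true → ∃ λ C → C ∈ Φ × sat a C ≡ true)

-- An assignment given as a vector, so that the search for a witness is finite; `sat-cong` transfers
-- the outcome to functions.
IsWitness : List (Cl n) → Cl n → Vec Bool n → Set
IsWitness Φ C v = sat (lookup v) C ≡ true × ListAll.All (λ C′ → C′ ≡ C ⊎ sat (lookup v) C′ ≡ false) Φ

module _ (Φ : List (Cl n)) (C : Cl n) where

  other? : ∀ v C′ → Dec (C′ ≡ C ⊎ sat (lookup v) C′ ≡ false)
  other? v C′ = (C′ ≟ᶜ C) ⊎-dec (sat (lookup v) C′ Bool.≟ false)

  witness? : Dec (Any.Any (IsWitness Φ C) (vecs bools n))
  witness? = Any.any? (λ v → (sat (lookup v) C Bool.≟ true) ×-dec ListAll.all? (other? v) Φ) (vecs bools n)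

  covered : ¬ Any.Any (IsWitness Φ C) (vecs bools n) → ∀ a → sat a C ≡ true → ∃ λ C′ → C′ ∈ Φ × C′ ≢ C × sat a C′ ≡ true
  covered ¬w a a⊨ with ListAll.all? (other? v) Φ
    where v = tabulate a
  ... | yes all = ⊥-elim (¬w (lose (∈-vecs ∈-bools (tabulate a)) (trans (sat-cong (lookup∘tabulate a) C) a⊨ , all)))
  ... | no ¬all with find (¬All⇒Any¬ (other? (tabulate a)) Φ ¬all)
  ... | (C′ , C′∈ , ¬o) = C′ , C′∈ , (λ e → ¬o (inj₁ e)) ,
    trans (sym (sat-cong (lookup∘tabulate a) C′)) (Bool.¬-not λ e → ¬o (inj₂ e))

-- By `covered`, every assignment that satisfies a clause without witness satisfies another clause
-- too, so this clause can be deleted without changing the function. The filter deletes all its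
-- copies, and the length decreases.
minimise : ∀ l (Φ : List (Cl n)) (f : BoolFun n) → length Φ ≤ l → Represents Φ f →
  ∃ λ Φ′ → Represents Φ′ f × (∀ C → C ∈ Φ′ → C ∈ Φ) × (∀ C → C ∈ Φ′ → Any.Any (IsWitness Φ′ C) (vecs bools n))
minimise {n} l Φ f len rep@(sound , complete) with ListAll.all? (witness? Φ) Φ
... | yes all = Φ , rep , (λ C p → p) , λ C p → ListAll.lookup all p
... | no ¬all with find (¬All⇒Any¬ (witness? Φ) Φ ¬all)
minimise zero [] f len rep | no ¬all | (C , () , _)
minimise {n} (suc l) Φ f len rep@(sound , complete) | no ¬all | (C , C∈ , ¬w) =
  let (Φ″ , rep″ , sub , wit) = minimise l Φ′ f (s≤s⁻¹ (≤-trans shorter len)) rep′ in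
  Φ″ , rep″ , (λ C′ p → proj₁ (∈-filter⁻ differs? (sub C′ p))) , wit
  where
  differs? : (C′ : Cl n) → Dec (C′ ≢ C)
  differs? C′ = ¬? (C′ ≟ᶜ C)
  Φ′ = filter differs? Φ
  shorter : length Φ′ < length Φ
  shorter = filter-notAll differs? Φ (Any.map (λ { refl ne → ne refl }) C∈)
  rep′ : Represents Φ′ f
  rep′ = (λ a C′ p → sound a C′ (proj₁ (∈-filter⁻ differs? p))) , complete′
    where
    complete′ : ∀ a → f a ≡ true → ∃ λ C′ → C′ ∈ Φ′ × sat a C′ ≡ true
    complete′ a fa with complete a fa
    ... | (C′ , C′∈ , a⊨) with C′ ≟ᶜ C
    ...   | no ne = C′ , ∈-filter⁺ differs? C′∈ ne , a⊨
    ...   | yes refl with covered Φ C ¬w a a⊨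
    ...     | (C₂ , C₂∈ , ne , a⊨₂) = C₂ , ∈-filter⁺ differs? C₂∈ ne , a⊨₂

record MinimalFormula (k : ℕ) (f : BoolFun n) : Set where
  field
    formula  : Cl n → Bool
    minimal  : Minimal formula
    size     : ∀ C → formula C ≡ true → ∣ supp C ∣ ≡ k
    sound    : ∀ a C → formula C ≡ true → sat a C ≡ true → f a ≡ true
    complete : ∀ a → f a ≡ true → ∃ λ C → formula C ≡ true × sat a C ≡ true

toCl : Clause k n → Cl n
toCl c = cl (tabulate (var c)) (tabulate (sign c))

toCl-unique : (c : Clause k n) → Unique (tabulate (var c))
toCl-unique c = uniqueᵇ⇒Unique _ (injective⇒uniqueᵇ (var c) (distinct c))

sat-toCl : (c : Clause k n) → ∀ a → sat a (toCl c) ≡ evalClause c a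
sat-toCl c a = trans (sat-cl a _ _ (toCl-unique c)) (go (var c) (sign c))
  where
  evalLit≡lit : ∀ x s → lit (just s) (a x) ≡ evalLit x s a
  evalLit≡lit x true  = refl
  evalLit≡lit x false = refl
  go : ∀ {k} (x : Fin k → Fin _) (s : Fin k → Bool) → satV a (tabulate x) (tabulate s) ≡ allF (λ i → evalLit (x i) (s i) a)
  go {zero}  x s = refl
  go {suc k} x s = cong₂ _∧_ (evalLit≡lit (x zero) (s zero)) (go (λ i → x (suc i)) (λ i → s (suc i)))

∣update∣ : ∀ (S : Subset n) v → lookup S v ≡ false → ∣ S [ v ]≔ true ∣ ≡ suc ∣ S ∣
∣update∣ (false ∷ S) zero    e = refl
∣update∣ (true ∷ S)  (suc v) e = cong suc (∣update∣ S v e)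
∣update∣ (false ∷ S) (suc v) e = ∣update∣ S v e

∣im∣ : (x : Vec (Fin n) k) → Unique x → ∣ im x ∣ ≡ k
∣im∣ {n} [] u = empty n
  where
  empty : ∀ n → ∣ replicate n false ∣ ≡ 0
  empty zero    = refl
  empty (suc n) = empty n
∣im∣ (v ∷ x) (d ∷ u) = trans (∣update∣ (im x) v v∉) (cong suc (∣im∣ x u))
  where
  v∉ : lookup (im x) v ≡ false
  v∉ with lookup (im x) v in eq
  ... | false = refl
  ... | true  = let (i , e) = im⁻ x v eq in ⊥-elim (lookup⁺ d i (sym e))

minimalFormula : (f : BoolFun n) → IsKSAT k f → MinimalFormula k f
minimalFormula {n} {k} f (Ψ , fΨ) = build (minimise (length Φ) Φ f ≤-refl rep)
  where
  Φ = map toCl Ψ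
  anyL⁻ : ∀ {A : Set} (p : A → Bool) xs → anyL p xs ≡ true → ∃ λ x → x ∈ xs × p x ≡ true
  anyL⁻ p (x ∷ xs) e with p x in eq
  ... | true  = x , here refl , eq
  ... | false = let (y , m , q) = anyL⁻ p xs e in y , there m , q
  anyL⁺ : ∀ {A : Set} (p : A → Bool) {xs x} → x ∈ xs → p x ≡ true → anyL p xs ≡ true
  anyL⁺ p {_ ∷ xs} (here refl) e rewrite e = refl
  anyL⁺ p {y ∷ xs} (there m)   e rewrite anyL⁺ p m e = Bool.∨-zeroʳ (p y)
  rep : Represents Φ f
  rep = snd , cmp
    where
    snd : ∀ a C → C ∈ Φ → sat a C ≡ true → f a ≡ true
    snd a C C∈ e with ∈-map⁻ toCl C∈
    ... | (c , c∈ , refl) = trans (fΨ a) (anyL⁺ (λ c → evalClause c a) c∈ (trans (sym (sat-toCl c a)) e))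
    cmp : ∀ a → f a ≡ true → ∃ λ C → C ∈ Φ × sat a C ≡ true
    cmp a fa with anyL⁻ (λ c → evalClause c a) Ψ (trans (sym (fΨ a)) fa)
    ... | (c , c∈ , e) = toCl c , ∈-map⁺ toCl c∈ , trans (sat-toCl c a) e
  build : (∃ λ Φ′ → Represents Φ′ f × (∀ C → C ∈ Φ′ → C ∈ Φ) × (∀ C → C ∈ Φ′ → Any.Any (IsWitness Φ′ C) (vecs bools n))) →
    MinimalFormula k f
  build (Φ′ , (snd , cmp) , sub , wit) = record
    { formula  = λ C → does (C ∈? Φ′)
    ; minimal  = min
    ; size     = sz
    ; sound    = λ a C e → snd a C (mem C e)
    ; complete = λ a fa → let (C , p , q) = cmp a fa in C , dec-true (C ∈? Φ′) p , q
    }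
    where
    mem : ∀ C → does (C ∈? Φ′) ≡ true → C ∈ Φ′
    mem C e with C ∈? Φ′
    ... | yes p = p
    min : Minimal (λ C → does (C ∈? Φ′))
    min C e with find (wit C (mem C e))
    ... | (v , _ , a⊨ , others) = lookup v , a⊨ , λ C′ e′ ne → resolve ne (ListAll.lookup others (mem C′ e′))
      where
      resolve : ∀ {A B : Set} → ¬ A → A ⊎ B → B
      resolve ¬a (inj₁ a) = ⊥-elim (¬a a)
      resolve ¬a (inj₂ b) = b
    sz : ∀ C → does (C ∈? Φ′) ≡ true → ∣ supp C ∣ ≡ k
    sz C e with ∈-map⁻ toCl (sub C (mem C e))
    ... | (c , _ , refl) = trans (cong ∣_∣ (supp-cl (tabulate (var c)) (tabulate (sign c)))) (∣im∣ (tabulate (var c)) (toCl-unique c))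

-- Products and the encoding of objects with few abnormal coordinates.

∏ : List A → (A → ℕ) → ℕ
∏ []       f = 1
∏ (x ∷ xs) f = f x * ∏ xs f

∏-mono : (xs : List A) {f g : A → ℕ} → (∀ x → x ∈ xs → f x ≤ g x) → ∏ xs f ≤ ∏ xs g
∏-mono []       h = ≤-refl
∏-mono (x ∷ xs) h = *-mono-≤ (h x (here refl)) (∏-mono xs λ y p → h y (there p))

∏-* : (xs : List A) (f g : A → ℕ) → ∏ xs (λ x → f x * g x) ≡ ∏ xs f * ∏ xs g
∏-* []       f g = refl
∏-* (x ∷ xs) f g = trans (cong (f x * g x *_) (∏-* xs f g)) (lem (f x) (g x) (∏ xs f) (∏ xs g))
  where
  lem : ∀ a b c d → a * b * (c * d) ≡ a * c * (b * d)
  lem = solve-∀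

∏-const : (xs : List A) (c : ℕ) → ∏ xs (λ _ → c) ≡ c ^ length xs
∏-const []       c = refl
∏-const (x ∷ xs) c = cong (c *_) (∏-const xs c)

∏-^ : (xs : List A) (c : ℕ) (f : A → ℕ) → ∏ xs (λ x → c ^ f x) ≡ c ^ ∑ xs f
∏-^ []       c f = refl
∏-^ (x ∷ xs) c f = trans (cong (c ^ f x *_) (∏-^ xs c f)) (sym (^-distribˡ-+-* c (f x) _))

∑-filter : (p : A → Bool) (xs : List A) (f : A → ℕ) → ∑ (filterᵇ p xs) f ≡ ∑ xs (λ x → ⟦ p x ⟧ * f x)
∑-filter p []       f = refl
∑-filter p (x ∷ xs) f with p x
... | true  = cong₂ _+_ (sym (+-identityʳ (f x))) (∑-filter p xs f)
... | false = ∑-filter p xs f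

-- Giving weight t to every coordinate with a normal value turns the number of objects with few
-- abnormal coordinates into a generating function, which is a product over the coordinates.
module Encoding {I Ω V : Set} (_≟ᵛ_ : DecidableEquality V) (X : Ω → I → V) (normal values : I → List V) (t : ℕ)
    (X∈ : ∀ ω i → X ω i ∈ values i) where

  isNormal : Ω → I → Bool
  isNormal ω i = does (DecMem._∈?_ _≟ᵛ_ (X ω i) (normal i))

  Differ : List I → Ω → Ω → Set
  Differ E ω ω′ = ∃ λ i → i ∈ E × X ω i ≢ X ω′ i

  with-value : I → V → List Ω → List Ω
  with-value i a = filterᵇ λ ω → does (X ω i ≟ᵛ a)

  weight : List I → Ω → ℕ
  weight E ω = t ^ ∑ E (λ i → ⟦ isNormal ω i ⟧)

  ∑-≟ᵛ : ∀ {xs : List V} {a} (c : ℕ) → a ∈ xs → c ≤ ∑ xs (λ b → ⟦ does (a ≟ᵛ b) ⟧ * c)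
  ∑-≟ᵛ {xs} {a} c a∈ = ≤-trans (≤-reflexive (sym (trans (cong (λ b → ⟦ b ⟧ * c) (dec-true (a ≟ᵛ a) refl)) (*-identityˡ c))))
    (∑-∈ (λ b → ⟦ does (a ≟ᵛ b) ⟧ * c) a∈)

  restrict : ∀ i a E Ws → AllPairs (Differ (i ∷ E)) Ws → AllPairs (Differ E) (with-value i a Ws)
  restrict i a E []       []       = []
  restrict i a E (ω ∷ Ws) (d ∷ ds) with X ω i ≟ᵛ a
  ... | no _   = restrict i a E Ws ds
  ... | yes eq = go Ws d ∷ restrict i a E Ws ds
    where
    go : ∀ Ws → ListAll.All (Differ (i ∷ E) ω) Ws → ListAll.All (Differ E ω) (with-value i a Ws)
    go []        ListAll.[]      = ListAll.[]
    go (ω′ ∷ Ws) (p ListAll.∷ ps) with X ω′ i ≟ᵛ a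
    ... | no _ = go Ws ps
    go (ω′ ∷ Ws) ((_ , here refl , ne) ListAll.∷ ps) | yes eq′ = ⊥-elim (ne (trans eq (sym eq′)))
    go (ω′ ∷ Ws) ((l , there m , ne) ListAll.∷ ps)   | yes eq′ = (l , m , ne) ListAll.∷ go Ws ps

  encode : ∀ E Ws → AllPairs (Differ E) Ws → ∑ Ws (weight E) ≤ ∏ E (λ i → t * length (normal i) + length (values i))
  encode [] []            _                       = z≤n
  encode [] (ω ∷ [])      _                       = ≤-refl
  encode [] (ω ∷ ω′ ∷ Ws) (((_ , () , _) ListAll.∷ _) ∷ _)
  encode (i ∷ E) Ws d = begin
    ∑ Ws (weight (i ∷ E))
      ≤⟨ ∑-mono Ws pointwise ⟩
    ∑ Ws (λ ω → ∑ (normal i) (λ a → ⟦ does (X ω i ≟ᵛ a) ⟧ * (t * weight E ω)) + ∑ (values i) (λ a → ⟦ does (X ω i ≟ᵛ a) ⟧ * weight E ω))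
      ≡⟨ trans (∑-+ Ws _ _) (cong₂ _+_ (∑-swap Ws (normal i) _) (∑-swap Ws (values i) _)) ⟩
    ∑ (normal i) (λ a → ∑ Ws λ ω → ⟦ does (X ω i ≟ᵛ a) ⟧ * (t * weight E ω)) + ∑ (values i) (λ a → ∑ Ws λ ω → ⟦ does (X ω i ≟ᵛ a) ⟧ * weight E ω)
      ≡⟨ sym (cong₂ _+_ (∑-cong (normal i) λ a → ∑-filter _ Ws _) (∑-cong (values i) λ a → ∑-filter _ Ws _)) ⟩
    ∑ (normal i) (λ a → ∑ (with-value i a Ws) λ ω → t * weight E ω) + ∑ (values i) (λ a → ∑ (with-value i a Ws) (weight E))
      ≤⟨ +-mono-≤ (∑-bound (normal i) λ a → ≤-trans (≤-reflexive (∑-*ˡ (with-value i a Ws) t _)) (*-monoʳ-≤ t (encode E _ (restrict i a E Ws d))))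
                  (∑-bound (values i) λ a → encode E _ (restrict i a E Ws d)) ⟩
    length (normal i) * (t * R) + length (values i) * R
      ≡⟨ lem (length (normal i)) t R (length (values i)) ⟩
    (t * length (normal i) + length (values i)) * R ∎
    where
    open ≤-Reasoning
    R = ∏ E (λ i → t * length (normal i) + length (values i))
    lem : ∀ a t r b → a * (t * r) + b * r ≡ (t * a + b) * r
    lem = solve-∀
    pointwise : ∀ ω → weight (i ∷ E) ω ≤
      ∑ (normal i) (λ a → ⟦ does (X ω i ≟ᵛ a) ⟧ * (t * weight E ω)) + ∑ (values i) (λ a → ⟦ does (X ω i ≟ᵛ a) ⟧ * weight E ω)
    pointwise ω with DecMem._∈?_ _≟ᵛ_ (X ω i) (normal i)
    ... | yes p = ≤-trans (∑-≟ᵛ (t * weight E ω) p) (m≤m+n _ _)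
    ... | no _  = ≤-trans (∑-≟ᵛ (weight E ω) (X∈ ω i)) (m≤n+m _ _)

-- Normal and abnormal traces of a formula on a k-set.

sublists : List A → List (List A)
sublists []       = [] ∷ []
sublists (x ∷ xs) = map (x ∷_) (sublists xs) ++ sublists xs

length-sublists : (xs : List A) → length (sublists xs) ≡ 2 ^ length xs
length-sublists []       = refl
length-sublists (x ∷ xs) = trans (length-++ (map (x ∷_) (sublists xs)))
  (cong₂ _+_ (trans (length-map _ (sublists xs)) (length-sublists xs)) (trans (length-sublists xs) (sym (+-identityʳ _))))

keep∈sublists : (D : Cl n → Bool) (Cs : List (Cl n)) → keep D Cs ∈ sublists Cs
keep∈sublists D []       = here refl
keep∈sublists D (C ∷ Cs) with D C
... | true  = ∈-++⁺ˡ (∈-map⁺ (C ∷_) (keep∈sublists D Cs))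
... | false = ∈-++⁺ʳ (map (C ∷_) (sublists Cs)) (keep∈sublists D Cs)

clOf-unique : (e : Subset n) → AllPairs _≢_ (clOf e)
clOf-unique []          = ListAll.[] ∷ []
clOf-unique (false ∷ e) = AllPairs.map⁺ (AllPairs.map (λ ne q → ne (proj₂ (∷-injective q))) (clOf-unique e))
clOf-unique (true ∷ e)  = AllPairs.++⁺
  (AllPairs.map⁺ (AllPairs.map (λ ne q → ne (proj₂ (∷-injective q))) (clOf-unique e)))
  (AllPairs.map⁺ (AllPairs.map (λ ne q → ne (proj₂ (∷-injective q))) (clOf-unique e)))
  (ListAll.map⁺ (ListAll.universal (λ C → ListAll.map⁺ (ListAll.universal (λ C′ ()) (clOf e))) (clOf e)))

keep-unique : (D : Cl n → Bool) (Cs : List (Cl n)) → AllPairs _≢_ Cs → AllPairs _≢_ (keep D Cs)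
keep-unique D []       []       = []
keep-unique D (C ∷ Cs) (d ∷ ds) with D C
... | true  = keep-all Cs d ∷ keep-unique D Cs ds
  where
  keep-all : ∀ Cs → ListAll.All (C ≢_) Cs → ListAll.All (C ≢_) (keep D Cs)
  keep-all []        ListAll.[]      = ListAll.[]
  keep-all (C′ ∷ Cs) (p ListAll.∷ ps) with D C′
  ... | true  = p ListAll.∷ keep-all Cs ps
  ... | false = keep-all Cs ps
... | false = keep-unique D Cs ds

differ⇒≢ : {C C′ : Cl n} → C ≢ C′ → ∃ λ v → lookup C v ≢ lookup C′ v
differ⇒≢ {C = C} {C′} ne with differ? C C′
... | yes p = p
... | no ¬p = ⊥-elim (ne (lookup-ext go))
  where
  go : ∀ v → lookup C v ≡ lookup C′ v
  go v with lookup C v ≟ᵐ lookup C′ v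
  ... | yes e = e
  ... | no q  = ⊥-elim (¬p (v , q))

-- Without a far pair all differences would occur at a single vertex, and two signs cannot tell
-- three clauses apart. Equality of supports excludes `nothing` as a third value there.
far-among-three : {C₁ C₂ C₃ : Cl n} → supp C₁ ≡ supp C₂ → supp C₁ ≡ supp C₃ → C₁ ≢ C₂ → C₁ ≢ C₃ → C₂ ≢ C₃ →
  Far C₁ C₂ ⊎ Far C₁ C₃ ⊎ Far C₂ C₃
far-among-three {C₁ = C₁} {C₂} {C₃} e₂ e₃ n₁₂ n₁₃ n₂₃ with differ⇒≢ n₁₂ | differ⇒≢ n₁₃ | differ⇒≢ n₂₃
... | (v , d) | (w , d′) | (x , d″) with v Fin.≟ w
...   | no v≢w with lookup C₁ w ≟ᵐ lookup C₂ w | lookup C₁ v ≟ᵐ lookup C₃ v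
...     | no q  | _     = inj₁ (v , w , v≢w , d , q)
...     | yes _ | no q  = inj₂ (inj₁ (v , w , v≢w , q , d′))
...     | yes p | yes q = inj₂ (inj₂ (v , w , v≢w , (λ r → d (trans q (sym r))) , (λ r → d′ (trans p r))))
far-among-three {C₁ = C₁} {C₂} {C₃} e₂ e₃ n₁₂ n₁₃ n₂₃ | (v , d) | (w , d′) | (x , d″) | yes refl with x Fin.≟ v
...   | yes refl = ⊥-elim (d″ (third (lookup C₁ v) (lookup C₂ v) (lookup C₃ v) (at e₂) (at e₃) d d′))
  where
  at : ∀ {C′} → supp C₁ ≡ supp C′ → is-just (lookup C₁ v) ≡ is-just (lookup C′ v)
  at {C′} e = trans (sym (lookup-map v is-just C₁)) (trans (cong (λ z → lookup z v) e) (lookup-map v is-just C′))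
  third : ∀ (a b c : Maybe Bool) → is-just a ≡ is-just b → is-just a ≡ is-just c → a ≢ b → a ≢ c → b ≡ c
  third nothing      nothing      c            _ _ p _ = ⊥-elim (p refl)
  third (just true)  (just true)  c            _ _ p _ = ⊥-elim (p refl)
  third (just false) (just false) c            _ _ p _ = ⊥-elim (p refl)
  third (just true)  (just false) (just true)  _ _ _ q = ⊥-elim (q refl)
  third (just true)  (just false) (just false) _ _ _ _ = refl
  third (just false) (just true)  (just false) _ _ _ q = ⊥-elim (q refl)
  third (just false) (just true)  (just true)  _ _ _ _ = refl
...   | no x≢v with lookup C₁ x ≟ᵐ lookup C₂ x
...     | no q = inj₁ (x , v , x≢v , q , d)
...     | yes p = inj₂ (inj₁ (x , v , x≢v , (λ r → d″ (trans (sym p) r)) , d′))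

_≟ˡ_ : DecidableEquality (List (Cl n))
_≟ˡ_ = ListP.≡-dec _≟ᶜ_

Far-cl : (x : Vec (Fin n) k) (s t : Vec Bool k) → ∀ v → lookup (cl x s) v ≢ lookup (cl x t) v →
  ∃ λ i → lookup x i ≡ v × lookup s i ≢ lookup t i
Far-cl []      []      []      v ne = ⊥-elim (ne refl)
Far-cl (w ∷ x) (b ∷ s) (d ∷ t) v ne with v Fin.≟ w
... | yes refl = zero , refl , λ e → ne (trans (lookup∘update v (cl x s) (just b)) (trans (cong just e) (sym (lookup∘update v (cl x t) (just d)))))
... | no v≢w with Far-cl x s t v (λ e → ne (trans (lookup∘update′ v≢w (cl x s) (just b)) (trans e (sym (lookup∘update′ v≢w (cl x t) (just d))))))
...   | (i , p , q) = suc i , p , q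

far-signs : (x : Vec (Fin n) k) (s t : Vec Bool k) → Far (cl x s) (cl x t) → Far s t
far-signs x s t (v , w , v≢w , p , q) with Far-cl x s t v p | Far-cl x s t w q
... | (i , e , d) | (i′ , e′ , d′) = i , i′ , (λ { refl → v≢w (trans (sym e) e′) }) , d , d′

FarIn : List (Cl n) → Set
FarIn Cs = Any.Any (λ C → Any.Any (Far C) Cs) Cs

farIn? : (Cs : List (Cl n)) → Dec (FarIn Cs)
farIn? Cs = Any.any? (λ C → Any.any? (far? _≟ᵐ_ C) Cs) Cs

-- Normal means no clause or a single likely one. A set with a far pair gets no normal value and is
-- thus always abnormal; this is affordable as such sets are rare, and it keeps the number of normal
-- values within `options`.
normalOf : List (Cl n) → List (List (Cl n))
normalOf Cs = if does (farIn? Cs) then [] else [] ∷ map (_∷ []) Cs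

options : Label n → ℕ
options l = 2 ^ ⟦ isUndir l ⟧ * 3 ^ ⟦ isDir l ⟧

far-in-three : {C C′ C″ : Cl n} {Cs : List (Cl n)} → Far C C′ ⊎ Far C C″ ⊎ Far C′ C″ → FarIn (C ∷ C′ ∷ C″ ∷ Cs)
far-in-three (inj₁ f)        = here (there (here f))
far-in-three (inj₂ (inj₁ f)) = here (there (there (here f)))
far-in-three (inj₂ (inj₂ f)) = there (here (there (there (here f))))

length-normalOf : (e : Subset n) (Cs : List (Cl n)) → AllPairs _≢_ Cs → (∀ {C} → C ∈ Cs → supp C ≡ e) →
  length (normalOf Cs) ≤ options (labelOf Cs)
length-normalOf e []       u sp = s≤s z≤n
length-normalOf e (C ∷ []) u sp with does (farIn? (C ∷ []))
... | true  = z≤n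
... | false = ≤-refl
length-normalOf e (C ∷ C′ ∷ []) ((ne ListAll.∷ _) ∷ u) sp with differ? C C′ | does (farIn? (C ∷ C′ ∷ []))
... | yes _ | true  = z≤n
... | yes _ | false = ≤-refl
... | no ¬p | _     = ⊥-elim (¬p (differ⇒≢ ne))
length-normalOf e Cs@(C ∷ C′ ∷ C″ ∷ Cs′) ((n₁ ListAll.∷ n₂ ListAll.∷ _) ∷ (n₃ ListAll.∷ _) ∷ u) sp
  rewrite dec-true (farIn? Cs) (far-in-three {Cs = Cs′} (far-among-three (trans (sp (here refl)) (sym (sp (there (here refl)))))
    (trans (sp (here refl)) (sym (sp (there (there (here refl)))))) n₁ n₂ n₃)) = z≤n

module Pairs {n k : ℕ} (Q : Cl n → Bool) (ρ : Vec Bool k → Vec Bool k → Bool) (D₁ : ℕ) (1≤n : 1 ≤ n)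
    (rare : ∀ s t → ρ s t ≡ true → ∑ (tuples n (suc k)) (λ z → ⟦ pairType Q s t z ⟧) * D₁ ≤ n ^ suc k) where

  pairTypes : Vec (Fin n) k → ℕ
  pairTypes x = ∑ (signs k) λ s → ∑ (signs k) λ t → ⟦ ρ s t ∧ pairOn Q s t x ⟧

  -- The ignored last entry of `pairType` is free, which gives a factor `n` on both sides.
  rare-pairOn : ∀ s t → ρ s t ≡ true → ∑ (tuples n k) (λ x → ⟦ pairOn Q s t x ⟧) * D₁ ≤ n ^ k
  rare-pairOn s t e = *-cancelˡ-≤ n {{>-nonZero 1≤n}} (begin
    n * (∑ (tuples n k) (λ x → ⟦ pairOn Q s t x ⟧) * D₁)
      ≡⟨ trans (sym (*-assoc n _ D₁)) (cong (_* D₁) (sym (trans (∑-const (allFin n) _) (cong (_* ∑ (tuples n k) (λ x → ⟦ pairOn Q s t x ⟧)) (length-allFin n))))) ⟩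
    ∑ (allFin n) (λ v → ∑ (tuples n k) λ x → ⟦ pairOn Q s t x ⟧) * D₁
      ≡⟨ cong (_* D₁) (∑-cong (allFin n) λ v → ∑-cong (tuples n k) λ x → cong (λ y → ⟦ pairOn Q s t y ⟧) (sym (removeAt-insertAt x (fromℕ k) v))) ⟩
    ∑ (allFin n) (λ v → ∑ (tuples n k) λ x → ⟦ pairType Q s t (insertAt x (fromℕ k) v) ⟧) * D₁
      ≡⟨ cong (_* D₁) (sym (∑-insertAt n k (fromℕ k) _)) ⟩
    ∑ (tuples n (suc k)) (λ z → ⟦ pairType Q s t z ⟧) * D₁
      ≤⟨ rare s t e ⟩
    n ^ suc k ∎)
    where
    open ≤-Reasoning

  ∑-pairTypes : ∑ (tuples n k) pairTypes * D₁ ≤ 2 ^ k * (2 ^ k * n ^ k)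
  ∑-pairTypes = begin
    ∑ (tuples n k) pairTypes * D₁
      ≡⟨ cong (_* D₁) (trans (∑-swap (tuples n k) (signs k) _) (∑-cong (signs k) λ s → ∑-swap (tuples n k) (signs k) _)) ⟩
    ∑ (signs k) (λ s → ∑ (signs k) λ t → ∑ (tuples n k) λ x → ⟦ ρ s t ∧ pairOn Q s t x ⟧) * D₁
      ≡⟨ trans (sym (∑-*ʳ (signs k) _ D₁)) (∑-cong (signs k) λ s → sym (∑-*ʳ (signs k) _ D₁)) ⟩
    ∑ (signs k) (λ s → ∑ (signs k) λ t → ∑ (tuples n k) (λ x → ⟦ ρ s t ∧ pairOn Q s t x ⟧) * D₁)
      ≤⟨ ∑-bound (signs k) (λ s → ∑-bound (signs k) λ t → each s t) ⟩
    length (signs k) * (length (signs k) * n ^ k)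
      ≡⟨ cong (λ l → l * (l * n ^ k)) (length-vecs bools k) ⟩
    2 ^ k * (2 ^ k * n ^ k) ∎
    where
    open ≤-Reasoning
    each : ∀ s t → ∑ (tuples n k) (λ x → ⟦ ρ s t ∧ pairOn Q s t x ⟧) * D₁ ≤ n ^ k
    each s t with ρ s t in eq
    ... | true  = rare-pairOn s t eq
    ... | false = ≤-trans (≤-reflexive (cong (_* D₁) (∑-zero (tuples n k)))) z≤n

  1≤pairTypes : ∀ x s t → ρ s t ≡ true → Q (cl x s) ≡ true → Q (cl x t) ≡ true → 1 ≤ pairTypes x
  1≤pairTypes x s t e q q′ = ≤-trans (≤-reflexive (sym (cong ⟦_⟧ (cong₂ _∧_ e (cong₂ _∧_ q q′)))))
    (≤-trans (∑-∈ (λ t → ⟦ ρ s t ∧ pairOn Q s t x ⟧) (∈-signs t))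
      (∑-∈ (λ s → ∑ (signs k) λ t → ⟦ ρ s t ∧ pairOn Q s t x ⟧) (∈-signs s)))

  rare-edges : (g : Subset n → Bool) →
    (∀ x → g (im x) ≡ true → ∃ λ s → ∃ λ t → ρ s t ≡ true × Q (cl x s) ≡ true × Q (cl x t) ≡ true) →
    ∑ₖ n k (λ e → ⟦ g e ⟧) * D₁ ≤ 2 ^ k * (2 ^ k * n ^ k)
  rare-edges g h = ≤-trans (*-monoˡ-≤ D₁ (≤-trans (m≤n*m _ (k !) {{k !≢0}}) (≤-trans (∑ₖ≤∑-tuples n k (λ e → ⟦ g e ⟧)) (∑-mono (tuples n k) each)))) ∑-pairTypes
    where
    each : ∀ x → ⟦ g (im x) ⟧ ≤ pairTypes x
    each x with g (im x) in eq
    ... | false = z≤n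
    ... | true  = let (s , t , a , b , c) = h x eq in 1≤pairTypes x s t a b c

does⇒ : ∀ {P : Set} (d : Dec P) → does d ≡ true → P
does⇒ (yes p) _ = p

far-type ne-type : Vec Bool k → Vec Bool k → Bool
far-type s t = does (far? Bool._≟_ s t)
ne-type s t  = does (¬? (≡-dec Bool._≟_ s t))

module Abnormal {n : ℕ} (j : ℕ) (D F : Cl n → Bool) (D₁ : ℕ) (1≤n : 1 ≤ n) where
  open Pullback j D

  far-edge : Subset n → Bool
  far-edge e = does (farIn? (De e))

  values : Subset n → List (List (Cl n))
  values e = sublists (clOf e)

  normal : Subset n → List (List (Cl n))
  normal e = normalOf (De e)

  trace : Subset n → List (Cl n)
  trace e = keep F (clOf e)

  double : Subset n → Bool
  double e = 2 ≤ᵇ length (trace e)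

  light : Subset n → ℕ
  light e = ∑ (clOf e) λ C → ⟦ F C ∧ not (D C) ⟧

  normal? : ∀ e → Dec (trace e ∈ normal e)
  normal? e = DecMem._∈?_ _≟ˡ_ (trace e) (normal e)

  abnormal≤ : ∀ e → ⟦ not (does (normal? e)) ⟧ ≤ ⟦ far-edge e ⟧ + light e + ⟦ double e ⟧
  abnormal≤ e with normal? e
  ... | yes _ = z≤n
  ... | no ¬p with farIn? (De e)
  ...   | yes _ = s≤s z≤n
  ...   | no _ = go (trace e) refl ¬p
    where
    go : ∀ Cs → trace e ≡ Cs → ¬ (trace e ∈ [] ∷ map (_∷ []) (De e)) → 1 ≤ light e + ⟦ double e ⟧
    go []           q np = ⊥-elim (np (here q))
    go (C ∷ C′ ∷ Cs) q np rewrite q = m≤n+m 1 (light e)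
    go (C ∷ [])     q np with ∈-keep F (clOf e) (subst (C ∈_) (sym q) (here refl))
    ... | (C∈ , FC) with D C in dc
    ...   | true  = ⊥-elim (np (there (subst (_∈ map (_∷ []) (De e)) (sym q) (∈-map⁺ (_∷ []) (∈-keep⁺ D (clOf e) C∈ dc)))))
    ...   | false = ≤-trans (≤-reflexive (sym (cong ⟦_⟧ (cong₂ (λ a b → a ∧ not b) FC dc))))
                      (≤-trans (∑-∈ (λ C → ⟦ F C ∧ not (D C) ⟧) C∈) (m≤m+n _ _))

  ∑-far : (∀ s t → Far s t → ∑ (tuples n (suc K)) (λ z → ⟦ pairType D s t z ⟧) * D₁ ≤ n ^ suc K) →
    ∑ₖ n K (λ e → ⟦ far-edge e ⟧) * D₁ ≤ 2 ^ K * (2 ^ K * n ^ K)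
  ∑-far rare = Pairs.rare-edges D far-type D₁ 1≤n (λ s t e → rare s t (does⇒ (far? Bool._≟_ s t) e)) far-edge find-pair
    where
    find-pair : ∀ x → far-edge (im x) ≡ true → ∃ λ s → ∃ λ t → far-type s t ≡ true × D (cl x s) ≡ true × D (cl x t) ≡ true
    find-pair x e with find (does⇒ (farIn? (De (im x))) e)
    ... | (C , C∈ , any) with find any
    ... | (C′ , C′∈ , far) with ∈-De (im x) C∈ | ∈-De (im x) C′∈
    ... | (sp , d) | (sp′ , d′) = _ , _ ,
        dec-true (far? Bool._≟_ (Vec.map (signAt C) x) (Vec.map (signAt C′) x)) (far-signs x (Vec.map (signAt C) x) (Vec.map (signAt C′) x) (subst₂ Far (cl-signAt C x sp) (cl-signAt C′ x sp′) far)) ,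
        trans (cong D (sym (cl-signAt C x sp))) d , trans (cong D (sym (cl-signAt C′ x sp′))) d′

  ∑-double : (∀ s t → s ≢ t → ∑ (tuples n (suc K)) (λ z → ⟦ pairType F s t z ⟧) * D₁ ≤ n ^ suc K) →
    ∑ₖ n K (λ e → ⟦ double e ⟧) * D₁ ≤ 2 ^ K * (2 ^ K * n ^ K)
  ∑-double rare = Pairs.rare-edges F ne-type D₁ 1≤n (λ s t e → rare s t (does⇒ (¬? (≡-dec Bool._≟_ s t)) e)) double find-pair
    where
    find-pair : ∀ x → double (im x) ≡ true → ∃ λ s → ∃ λ t → ne-type s t ≡ true × F (cl x s) ≡ true × F (cl x t) ≡ true
    find-pair x e = go (trace (im x)) refl (≤ᵇ-true {2} e)
      where
      go : ∀ Cs → trace (im x) ≡ Cs → 2 ≤ length (trace (im x)) → ∃ λ s → ∃ λ t → ne-type s t ≡ true × F (cl x s) ≡ true × F (cl x t) ≡ true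
      go [] q le rewrite q = ⊥-elim (1+n≰n (≤-trans le z≤n))
      go (C ∷ []) q le rewrite q = ⊥-elim (1+n≰n le)
      go (C ∷ C′ ∷ Cs) q le with ∈-keep F (clOf (im x)) (subst (C ∈_) (sym q) (here refl)) | ∈-keep F (clOf (im x)) (subst (C′ ∈_) (sym q) (there (here refl)))
        | subst (AllPairs _≢_) q (keep-unique F (clOf (im x)) (clOf-unique (im x)))
      ... | (C∈ , d) | (C′∈ , d′) | ((ne ListAll.∷ _) ∷ _) = _ , _ ,
        dec-true (¬? (≡-dec Bool._≟_ _ _)) (λ s≡t → ne (trans (cl-signAt C x sp) (trans (cong (cl x) s≡t) (sym (cl-signAt C′ x sp′))))) ,
        trans (cong F (sym (cl-signAt C x sp))) d , trans (cong F (sym (cl-signAt C′ x sp′))) d′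
        where
        sp = clOf-supp (im x) C∈
        sp′ = clOf-supp (im x) C′∈

-- Counting the formulas of one class.

∈-allSubsets : (S : Subset n) → S ∈ allSubsets n
∈-allSubsets []          = here refl
∈-allSubsets (true ∷ S)  = ∈-++⁺ˡ (∈-map⁺ (true ∷_) (∈-allSubsets S))
∈-allSubsets {suc n} (false ∷ S) = ∈-++⁺ʳ (map (true ∷_) (allSubsets n)) (∈-map⁺ (false ∷_) (∈-allSubsets S))

∈-filterᵇ : (p : A → Bool) {xs : List A} {x : A} → x ∈ xs → p x ≡ true → x ∈ filterᵇ p xs
∈-filterᵇ p {_ ∷ _} (here refl) e rewrite e = here refl
∈-filterᵇ p {y ∷ _} (there m)   e with p y
... | true  = there (∈-filterᵇ p m e)
... | false = ∈-filterᵇ p m e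

filterᵇ-∈ : (p : A → Bool) (xs : List A) {x : A} → x ∈ filterᵇ p xs → p x ≡ true
filterᵇ-∈ p (y ∷ xs) m with p y in eq
filterᵇ-∈ p (y ∷ xs) (here refl) | true = eq
filterᵇ-∈ p (y ∷ xs) (there m)   | true = filterᵇ-∈ p xs m
... | false = filterᵇ-∈ p xs m

isKSet⇒ : ∀ {n} k (e : Subset n) → isKSet k e ≡ true → ∣ e ∣ ≡ k
isKSet⇒ k e q with ∣ e ∣ ≟ k
... | yes p = p
... | no ¬p with trans (sym (dec-false (∣ e ∣ ≟ k) ¬p)) q
... | ()

module ClassCount {n M : ℕ} (j : ℕ) (𝔽 : Fin M → Cl n → Bool) (D : Cl n → Bool) (D₁ : ℕ) (1≤n : 1 ≤ n) where
  open Pullback j D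

  edges : List (Subset n)
  edges = filterᵇ (isKSet K) (allSubsets n)

  ∑-edges : ∀ f → ∑ edges f ≡ ∑ₖ n K f
  ∑-edges = ∑-filter (isKSet K) (allSubsets n)

  length-edges : length edges ≡ n choose K
  length-edges = trans (length≡∑1 edges) (trans (∑-edges _) (∑ₖ-count n K))

  X : Fin M → Subset n → List (Cl n)
  X ω e = keep (𝔽 ω) (clOf e)

  abnormal : Fin M → Subset n → ℕ
  abnormal ω e = ⟦ not (does (Abnormal.normal? j D (𝔽 ω) D₁ 1≤n e)) ⟧

  U V : ℕ
  U = ∑ₖ n K λ e → ⟦ isUndir (lab e) ⟧
  V = ∑ₖ n K λ e → ⟦ isDir (lab e) ⟧

  -- The number of possible traces on a `K`-set, that is, of sets of clauses among the `2 ^ K` on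
  -- it.
  Q : ℕ
  Q = 2 ^ 2 ^ K

  Distinguished : Fin M → Fin M → Set
  Distinguished ω ω′ = ∃ λ C → ∣ supp C ∣ ≡ K × 𝔽 ω C ≢ 𝔽 ω′ C

  module _ (s g : ℕ) (Ws : List (Fin M)) (dist : AllPairs Distinguished Ws)
           (few : ∀ ω → ω ∈ Ws → ∑ₖ n K (abnormal ω) ≤ g) where

    open Encoding _≟ˡ_ X (λ e → normalOf (De e)) (λ e → sublists (clOf e)) (Q * s) (λ ω e → keep∈sublists (𝔽 ω) (clOf e))

    T₀ = Q * s
    N = n choose K

    differ : ∀ {ω ω′} → Distinguished ω ω′ → Differ edges ω ω′
    differ {ω} {ω′} (C , size , ne) = supp C , ∈-filterᵇ (isKSet K) (∈-allSubsets (supp C)) (dec-true (∣ supp C ∣ ≟ K) size) ,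
      λ e → ne (≡-of-⇔ (λ p → proj₂ (∈-keep (𝔽 ω′) (clOf (supp C)) (subst (C ∈_) e (∈-keep⁺ (𝔽 ω) (clOf (supp C)) (∈-clOf C) p))))
                       (λ p → proj₂ (∈-keep (𝔽 ω) (clOf (supp C)) (subst (C ∈_) (sym e) (∈-keep⁺ (𝔽 ω′) (clOf (supp C)) (∈-clOf C) p)))))

    N≤ : ∀ ω → ω ∈ Ws → N ≤ ∑ edges (λ e → ⟦ isNormal ω e ⟧) + g
    N≤ ω ω∈ = begin
      N                                                                       ≡⟨ sym length-edges ⟩
      length edges                                                            ≡⟨ length≡∑1 edges ⟩
      ∑ edges (λ _ → 1)                                                       ≡⟨ ∑-cong edges (λ e → one (isNormal ω e)) ⟩
      ∑ edges (λ e → ⟦ isNormal ω e ⟧ + ⟦ not (isNormal ω e) ⟧)               ≡⟨ ∑-+ edges _ _ ⟩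
      ∑ edges (λ e → ⟦ isNormal ω e ⟧) + ∑ edges (abnormal ω)                 ≤⟨ +-monoʳ-≤ _ (≤-trans (≤-reflexive (∑-edges (abnormal ω))) (few ω ω∈)) ⟩
      ∑ edges (λ e → ⟦ isNormal ω e ⟧) + g ∎
      where
      open ≤-Reasoning
      one : ∀ b → 1 ≡ ⟦ b ⟧ + ⟦ not b ⟧
      one true  = refl
      one false = refl

    instance
      Q≢0 : NonZero Q
      Q≢0 = m^n≢0 2 (2 ^ K)

    -- With weight `Q * s` on normal values, all `Q` values together weigh only a share `1 / s` of
    -- one normal value. So abnormal values cost no more than a factor `(s + 1) / s` on each set.
    factor : ∀ e → e ∈ edges → T₀ * length (normalOf (De e)) + length (sublists (clOf e)) ≤ Q * (s + 1) * options (lab e)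
    factor e e∈ = begin
      Q * s * length (normalOf (De e)) + length (sublists (clOf e))
        ≤⟨ +-mono-≤ (*-monoʳ-≤ (Q * s) (length-normalOf e (De e) (keep-unique D (clOf e) (clOf-unique e)) (λ p → proj₁ (∈-De e p))))
                    (≤-reflexive (trans (length-sublists (clOf e)) (cong (2 ^_) (trans (length-clOf e) (cong (2 ^_) size))))) ⟩
      Q * s * options (lab e) + Q
        ≤⟨ +-monoʳ-≤ (Q * s * options (lab e)) (m≤m*n Q (options (lab e)) {{m*n≢0 _ _ {{m^n≢0 2 ⟦ isUndir (lab e) ⟧}} {{m^n≢0 3 ⟦ isDir (lab e) ⟧}}}}) ⟩
      Q * s * options (lab e) + Q * options (lab e)
        ≡⟨ lem Q s (options (lab e)) ⟩
      Q * (s + 1) * options (lab e) ∎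
      where
      open ≤-Reasoning
      lem : ∀ q s o → q * s * o + q * o ≡ q * (s + 1) * o
      lem = solve-∀
      size : ∣ e ∣ ≡ K
      size = isKSet⇒ K e (filterᵇ-∈ (isKSet K) (allSubsets n) e∈)

    class-count : 1 ≤ s → length Ws * s ^ N ≤ (Q * s) ^ g * (s + 1) ^ N * (2 ^ U * 3 ^ V)
    class-count 1≤s = *-cancelˡ-≤ (Q ^ N) {{m^n≢0 Q N}} (begin
      Q ^ N * (length Ws * s ^ N)
        ≡⟨ lem₁ (Q ^ N) (length Ws) (s ^ N) ⟩
      length Ws * (Q ^ N * s ^ N)
        ≡⟨ cong (length Ws *_) (sym (*-^ Q s N)) ⟩
      length Ws * T₀ ^ N
        ≡⟨ sym (∑-const Ws _) ⟩
      ∑ Ws (λ _ → T₀ ^ N)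
        ≤⟨ ∑-mono-∈ Ws (λ ω ω∈ → ≤-trans (^-monoʳ-≤ T₀ {{m*n≢0 Q s {{Q≢0}} {{>-nonZero 1≤s}}}} (N≤ ω ω∈)) (≤-reflexive (^-distribˡ-+-* T₀ (∑ edges (λ e → ⟦ isNormal ω e ⟧)) g))) ⟩
      ∑ Ws (λ ω → weight edges ω * T₀ ^ g)
        ≡⟨ ∑-*ʳ Ws _ _ ⟩
      ∑ Ws (weight edges) * T₀ ^ g
        ≤⟨ *-monoˡ-≤ (T₀ ^ g) (≤-trans (encode edges Ws (AllPairs.map differ dist)) (∏-mono edges factor)) ⟩
      ∏ edges (λ e → Q * (s + 1) * options (lab e)) * T₀ ^ g
        ≡⟨ cong (_* T₀ ^ g) (trans (∏-* edges _ _) (cong₂ _*_ (trans (∏-const edges _) (trans (cong ((Q * (s + 1)) ^_) length-edges) (*-^ Q (s + 1) N)))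
             (trans (∏-* edges _ _) (cong₂ _*_ (trans (∏-^ edges 2 _) (cong (2 ^_) (∑-edges _))) (trans (∏-^ edges 3 _) (cong (3 ^_) (∑-edges _))))))) ⟩
      Q ^ N * (s + 1) ^ N * (2 ^ U * 3 ^ V) * T₀ ^ g
        ≡⟨ lem₂ (Q ^ N) ((s + 1) ^ N) (2 ^ U * 3 ^ V) (T₀ ^ g) ⟩
      Q ^ N * (T₀ ^ g * (s + 1) ^ N * (2 ^ U * 3 ^ V)) ∎)
      where
      open ≤-Reasoning
      lem₁ : ∀ a b c → a * (b * c) ≡ b * (a * c)
      lem₁ = solve-∀
      lem₂ : ∀ a b c d → a * b * c * d ≡ a * (d * b * c)
      lem₂ = solve-∀

-- Elementary estimates for powers and binomial coefficients.

-- The inequality `(1 - 1 / (t + 1)) ^ i ≥ 1 - i / (t + 1)` with denominators and subtraction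
-- cleared.
bernoulli : ∀ t i → suc t ^ suc i ≤ t ^ i * suc t + i * suc t ^ i
bernoulli t zero    = ≤-reflexive (lem (suc t))
  where
  lem : ∀ a → a * 1 ≡ 1 * a + 0 * 1
  lem = solve-∀
bernoulli t (suc i) = begin
  suc t * suc t ^ suc i
    ≤⟨ *-monoʳ-≤ (suc t) (bernoulli t i) ⟩
  suc t * (t ^ i * suc t + i * suc t ^ i)
    ≡⟨ lem₁ t (t ^ i) i (suc t ^ i) ⟩
  t ^ suc i * suc t + (t ^ i * suc t + i * (suc t * suc t ^ i))
    ≤⟨ +-monoʳ-≤ (t ^ suc i * suc t) (+-monoˡ-≤ (i * (suc t * suc t ^ i)) (*-monoˡ-≤ (suc t) (^-monoˡ-≤ i (n≤1+n t)))) ⟩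
  t ^ suc i * suc t + (suc t ^ i * suc t + i * (suc t * suc t ^ i))
    ≡⟨ lem₂ (t ^ suc i * suc t) (suc t ^ i) (suc t) i ⟩
  t ^ suc i * suc t + suc i * suc t ^ suc i ∎
  where
  open ≤-Reasoning
  lem₁ : ∀ t a i b → (1 + t) * (a * (1 + t) + i * b) ≡ t * a * (1 + t) + (a * (1 + t) + i * ((1 + t) * b))
  lem₁ = solve-∀
  lem₂ : ∀ a b t i → a + (b * t + i * (t * b)) ≡ a + (1 + i) * (t * b)
  lem₂ = solve-∀

-- For `t + 1 = 2 * B` the lower bound in `bernoulli` at `i = B` is one half.
[1+1/t]^B≤2 : ∀ B t → suc t ≡ 2 * B → suc t ^ B ≤ 2 * t ^ B
[1+1/t]^B≤2 B@(suc _) t e = *-cancelˡ-≤ B (+-cancelʳ-≤ (B * suc t ^ B) _ _ (begin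
  B * suc t ^ B + B * suc t ^ B         ≡⟨ lem₁ B (suc t ^ B) ⟩
  2 * B * suc t ^ B                     ≡⟨ cong (_* suc t ^ B) (sym e) ⟩
  suc t ^ suc B                         ≤⟨ bernoulli t B ⟩
  t ^ B * suc t + B * suc t ^ B         ≡⟨ cong (λ z → t ^ B * z + B * suc t ^ B) e ⟩
  t ^ B * (2 * B) + B * suc t ^ B       ≡⟨ cong (_+ B * suc t ^ B) (lem₂ (t ^ B) B) ⟩
  B * (2 * t ^ B) + B * suc t ^ B ∎))
  where
  open ≤-Reasoning
  lem₁ : ∀ b x → b * x + b * x ≡ 2 * b * x
  lem₁ = solve-∀
  lem₂ : ∀ x b → x * (2 * b) ≡ b * (2 * x)
  lem₂ = solve-∀

-- The absorption identity `(k + 1) * C(n, k + 1) = (n - k) * C(n, k)`, free of subtraction.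
choose-absorb : ∀ n k → suc k * (n choose suc k) + k * (n choose k) ≡ n * (n choose k)
choose-absorb zero    zero    = refl
choose-absorb zero    (suc k) = trans (cong₂ _+_ (*-zeroʳ (suc (suc k))) (*-zeroʳ (suc k))) refl
choose-absorb (suc n) zero    = begin
  1 * (suc n choose 1) + 0 ≡⟨ cong (λ z → 1 * z + 0) (sym (nCk+nC[k+1]≡[n+1]C[k+1] n 0)) ⟩
  1 * (n choose 0 + n choose 1) + 0 ≡⟨ lem (n choose 1) ⟩
  1 + (1 * (n choose 1) + 0 * (n choose 0)) ≡⟨ cong suc (choose-absorb n 0) ⟩
  1 + n * 1 ∎
  where
  open ≡-Reasoning
  lem : ∀ a → 1 * (1 + a) + 0 ≡ 1 + (1 * a + 0 * 1)
  lem = solve-∀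
choose-absorb (suc n) (suc k) = begin
  suc (suc k) * (suc n choose suc (suc k)) + suc k * (suc n choose suc k)
    ≡⟨ cong₂ (λ a b → suc (suc k) * a + suc k * b) (sym (nCk+nC[k+1]≡[n+1]C[k+1] n (suc k))) (sym (nCk+nC[k+1]≡[n+1]C[k+1] n k)) ⟩
  suc (suc k) * (c₁ + c₂) + suc k * (c₀ + c₁)
    ≡⟨ lem₁ k c₀ c₁ c₂ ⟩
  (suc (suc k) * c₂ + suc k * c₁) + c₁ + ((suc k * c₁ + k * c₀) + c₀)
    ≡⟨ cong₂ (λ a b → a + c₁ + (b + c₀)) (choose-absorb n (suc k)) (choose-absorb n k) ⟩
  n * c₁ + c₁ + (n * c₀ + c₀)
    ≡⟨ lem₂ n c₀ c₁ ⟩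
  suc n * (c₀ + c₁)
    ≡⟨ cong (suc n *_) (nCk+nC[k+1]≡[n+1]C[k+1] n k) ⟩
  suc n * (suc n choose suc k) ∎
  where
  open ≡-Reasoning
  c₀ = n choose k
  c₁ = n choose suc k
  c₂ = n choose suc (suc k)
  lem₁ : ∀ k a b c → (2 + k) * (b + c) + (1 + k) * (a + b) ≡ ((2 + k) * c + (1 + k) * b) + b + (((1 + k) * b + k * a) + a)
  lem₁ = solve-∀
  lem₂ : ∀ n a b → n * b + b + (n * a + a) ≡ (1 + n) * (a + b)
  lem₂ = solve-∀

k!*choose≤ : ∀ n k → k ! * (n choose k) ≤ n ^ k
k!*choose≤ n zero    = ≤-refl
k!*choose≤ n (suc k) = begin
  suc k * k ! * (n choose suc k)          ≡⟨ lem (suc k) (k !) _ ⟩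
  k ! * (suc k * (n choose suc k))        ≤⟨ *-monoʳ-≤ (k !) (≤-trans (m≤m+n _ (k * (n choose k))) (≤-reflexive (choose-absorb n k))) ⟩
  k ! * (n * (n choose k))                ≡⟨ lem₂ (k !) n _ ⟩
  n * (k ! * (n choose k))                ≤⟨ *-monoʳ-≤ n (k!*choose≤ n k) ⟩
  n ^ suc k ∎
  where
  open ≤-Reasoning
  lem : ∀ a b c → a * b * c ≡ b * (a * c)
  lem = solve-∀
  lem₂ : ∀ a b c → a * (b * c) ≡ b * (a * c)
  lem₂ = solve-∀

≤k!*choose : ∀ n k → n ^ k * n ≤ k ! * (n choose k) * n + k * k * n ^ k
≤k!*choose n zero    = ≤-trans (≤-reflexive refl) (m≤m+n _ _)
≤k!*choose n (suc k) = begin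
  n * n ^ k * n
    ≡⟨ *-assoc n (n ^ k) n ⟩
  n * (n ^ k * n)
    ≤⟨ *-monoʳ-≤ n (≤k!*choose n k) ⟩
  n * (k ! * c * n + k * k * n ^ k)
    ≡⟨ lem₁ n (k !) c k (n ^ k) ⟩
  k ! * n * (n * c) + k * k * (n * n ^ k)
    ≡⟨ cong (λ z → k ! * n * z + k * k * (n * n ^ k)) (sym (choose-absorb n k)) ⟩
  k ! * n * (suc k * c′ + k * c) + k * k * (n * n ^ k)
    ≡⟨ lem₂ (k !) n k c c′ (n ^ k) ⟩
  suc k * k ! * c′ * n + (k * n * (k ! * c) + k * k * (n * n ^ k))
    ≤⟨ +-monoʳ-≤ (suc k * k ! * c′ * n) (+-monoˡ-≤ (k * k * (n * n ^ k)) (*-monoʳ-≤ (k * n) (k!*choose≤ n k))) ⟩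
  suc k * k ! * c′ * n + (k * n * n ^ k + k * k * (n * n ^ k))
    ≤⟨ +-monoʳ-≤ (suc k * k ! * c′ * n) (m≤m+n _ ((1 + k) * (n * n ^ k))) ⟩
  suc k * k ! * c′ * n + (k * n * n ^ k + k * k * (n * n ^ k) + (1 + k) * (n * n ^ k))
    ≡⟨ cong (suc k * k ! * c′ * n +_) (lem₃ k n (n ^ k)) ⟩
  suc k * k ! * c′ * n + suc k * suc k * (n * n ^ k) ∎
  where
  open ≤-Reasoning
  c = n choose k
  c′ = n choose suc k
  lem₁ : ∀ n f c k a → n * (f * c * n + k * k * a) ≡ f * n * (n * c) + k * k * (n * a)
  lem₁ = solve-∀
  lem₂ : ∀ f n k c d a → f * n * ((1 + k) * d + k * c) + k * k * (n * a) ≡ (1 + k) * f * d * n + (k * n * (f * c) + k * k * (n * a))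
  lem₂ = solve-∀
  lem₃ : ∀ k n a → k * n * a + k * k * (n * a) + (1 + k) * (n * a) ≡ (1 + k) * (1 + k) * (n * a)
  lem₃ = solve-∀

-- The relative loss `k * k / n` of `≤k!*choose` is at most `1 / (2 + y)` for such `n`.
n^k≈k!*choose : ∀ n k y → 1 ≤ n → k * k * (2 + y) ≤ n → n ^ k * (1 + y) ≤ k ! * (n choose k) * (2 + y)
n^k≈k!*choose n k y 1≤n n≥ = *-cancelʳ-≤ _ _ n {{>-nonZero 1≤n}} (+-cancelʳ-≤ (n ^ k * n) _ _ (begin
  n ^ k * (1 + y) * n + n ^ k * n
    ≡⟨ lem₁ (n ^ k) y n ⟩
  n ^ k * n * (2 + y)
    ≤⟨ *-monoˡ-≤ (2 + y) (≤k!*choose n k) ⟩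
  (k ! * (n choose k) * n + k * k * n ^ k) * (2 + y)
    ≡⟨ lem₂ (k ! * (n choose k)) n (k * k) (n ^ k) (2 + y) ⟩
  k ! * (n choose k) * (2 + y) * n + n ^ k * (k * k * (2 + y))
    ≤⟨ +-monoʳ-≤ (k ! * (n choose k) * (2 + y) * n) (*-monoʳ-≤ (n ^ k) n≥) ⟩
  k ! * (n choose k) * (2 + y) * n + n ^ k * n ∎))
  where
  open ≤-Reasoning
  lem₁ : ∀ a y n → a * (1 + y) * n + a * n ≡ a * n * (2 + y)
  lem₁ = solve-∀
  lem₂ : ∀ a n b c y → (a * n + b * c) * y ≡ a * y * n + c * (b * y)
  lem₂ = solve-∀

∑-max : ∀ {A : Set} (xs : List A) (f : A → ℕ) → 1 ≤ length xs → ∃ λ x → ∑ xs f ≤ length xs * f x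
∑-max (x ∷ xs) f _ = go x xs
  where
  go : ∀ x xs → ∃ λ z → f x + ∑ xs f ≤ suc (length xs) * f z
  go x []       = x , ≤-refl
  go x (y ∷ xs) with go y xs
  ... | (z , h) with f x ≤? f z
  ...   | yes p = z , +-mono-≤ p h
  ...   | no ¬p = x , +-monoʳ-≤ (f x) (≤-trans h (*-monoʳ-≤ (suc (length xs)) (<⇒≤ (≰⇒> ¬p))))

AllPairs-lookup : ∀ {A : Set} {R : A → A → Set} → (∀ {a b} → R a b → R b a) → (L : List A) → AllPairs R L →
  ∀ {i i′} → i ≢ i′ → R (List.lookup L i) (List.lookup L i′)
AllPairs-lookup sy (a ∷ L) (h ∷ hs) {zero}  {zero}   ne = ⊥-elim (ne refl)
AllPairs-lookup sy (a ∷ L) (h ∷ hs) {zero}  {suc i′} ne = ListAll.lookup h (∈-lookup i′)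
AllPairs-lookup sy (a ∷ L) (h ∷ hs) {suc i} {zero}   ne = sy (ListAll.lookup h (∈-lookup i))
AllPairs-lookup sy (a ∷ L) (h ∷ hs) {suc i} {suc i′} ne = AllPairs-lookup sy L hs (λ e → ne (cong suc e))

false≢true : false ≢ true
false≢true ()

distinguish : ∀ {n k} {f g : BoolFun n} (F : MinimalFormula k f) (G : MinimalFormula k g) → Distinct f g →
  ∃ λ C → ∣ supp C ∣ ≡ k × MinimalFormula.formula F C ≢ MinimalFormula.formula G C
distinguish {f = f} {g} F G (a , ne) with f a in fa | g a in ga
... | true  | true  = ⊥-elim (ne refl)
... | false | false = ⊥-elim (ne refl)
... | true  | false = let (C , p , q) = complete F a fa in
      C , size F C p , λ e → false≢true (trans (sym ga) (sound G a C (trans (sym e) p) q))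
  where open MinimalFormula
... | false | true  = let (C , p , q) = complete G a ga in
      C , size G C p , λ e → false≢true (trans (sym fa) (sound F a C (trans e p) q))
  where open MinimalFormula

-- In the power `q * B`, the `g` exceptional sets cost `2 ^ (l * g * q * B)`, at most `2 ^ (N * q)`;
-- the factor `(s + 1) / s` on `N` sets costs at most 2 for each `B` of its occurrences, again
-- `2 ^ (N * q)`. This is the `2 * q` in the exponent.
root-bound : ∀ {w s N Q g UV B q y l} → 1 ≤ s → w * s ^ N ≤ (Q * s) ^ g * (s + 1) ^ N * UV →
  UV ^ (q * B) ≤ 2 ^ (N * (2 + y)) → (s + 1) ^ B ≤ 2 * s ^ B → Q * s ≤ 2 ^ l → g * (l * B) ≤ N →
  w ^ (q * B) ≤ 2 ^ (N * (2 + y + 2 * q))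
root-bound {w} {s} {N} {Q} {g} {UV} {B} {q} {y} {l} 1≤s h hUV hs hQ hg = *-cancelʳ-≤ _ _ ((s ^ N) ^ x) {{m^n≢0 (s ^ N) x {{m^n≢0 s N {{>-nonZero 1≤s}}}}}} (begin
  w ^ x * (s ^ N) ^ x
    ≡⟨ sym (*-^ w (s ^ N) x) ⟩
  (w * s ^ N) ^ x
    ≤⟨ ^-monoˡ-≤ x h ⟩
  ((Q * s) ^ g * (s + 1) ^ N * UV) ^ x
    ≡⟨ trans (*-^ ((Q * s) ^ g * (s + 1) ^ N) UV x) (cong (_* UV ^ x) (*-^ ((Q * s) ^ g) ((s + 1) ^ N) x)) ⟩
  ((Q * s) ^ g) ^ x * ((s + 1) ^ N) ^ x * UV ^ x
    ≤⟨ *-mono-≤ (*-mono-≤ exceptional slack) hUV ⟩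
  2 ^ (N * q) * (2 ^ (N * q) * (s ^ N) ^ x) * 2 ^ (N * (2 + y))
    ≡⟨ lem (2 ^ (N * q)) ((s ^ N) ^ x) (2 ^ (N * (2 + y))) ⟩
  2 ^ (N * q) * 2 ^ (N * q) * 2 ^ (N * (2 + y)) * (s ^ N) ^ x
    ≡⟨ cong (_* (s ^ N) ^ x) (trans (cong (_* 2 ^ (N * (2 + y))) (sym (^-distribˡ-+-* 2 (N * q) (N * q)))) (sym (^-distribˡ-+-* 2 (N * q + N * q) (N * (2 + y))))) ⟩
  2 ^ (N * q + N * q + N * (2 + y)) * (s ^ N) ^ x
    ≡⟨ cong (λ z → 2 ^ z * (s ^ N) ^ x) (lem₂ N q y) ⟩
  2 ^ (N * (2 + y + 2 * q)) * (s ^ N) ^ x ∎)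
  where
  open ≤-Reasoning
  x = q * B
  lem : ∀ a b c → a * (a * b) * c ≡ a * a * c * b
  lem = solve-∀
  lem₂ : ∀ N q y → N * q + N * q + N * (2 + y) ≡ N * (2 + y + 2 * q)
  lem₂ = solve-∀
  lem₃ : ∀ l g q B → l * g * (q * B) ≡ g * (l * B) * q
  lem₃ = solve-∀
  lem₄ : ∀ N q B → N * (q * B) ≡ B * (N * q)
  lem₄ = solve-∀
  exceptional : ((Q * s) ^ g) ^ x ≤ 2 ^ (N * q)
  exceptional = begin
    ((Q * s) ^ g) ^ x          ≤⟨ ^-monoˡ-≤ x (^-monoˡ-≤ g hQ) ⟩
    ((2 ^ l) ^ g) ^ x          ≡⟨ trans (cong (_^ x) (^-*-assoc 2 l g)) (^-*-assoc 2 (l * g) x) ⟩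
    2 ^ (l * g * x)            ≤⟨ ^-monoʳ-≤ 2 (≤-trans (≤-reflexive (lem₃ l g q B)) (*-monoˡ-≤ q hg)) ⟩
    2 ^ (N * q) ∎
  slack : ((s + 1) ^ N) ^ x ≤ 2 ^ (N * q) * (s ^ N) ^ x
  slack = begin
    ((s + 1) ^ N) ^ x            ≡⟨ trans (^-*-assoc (s + 1) N x) (trans (cong ((s + 1) ^_) (lem₄ N q B)) (sym (^-*-assoc (s + 1) B (N * q)))) ⟩
    ((s + 1) ^ B) ^ (N * q)      ≤⟨ ^-monoˡ-≤ (N * q) hs ⟩
    (2 * s ^ B) ^ (N * q)        ≡⟨ *-^ 2 (s ^ B) (N * q) ⟩
    2 ^ (N * q) * (s ^ B) ^ (N * q) ≡⟨ cong (2 ^ (N * q) *_) (trans (^-*-assoc s B (N * q)) (trans (cong (s ^_) (sym (lem₄ N q B))) (sym (^-*-assoc s N x)))) ⟩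
    2 ^ (N * q) * (s ^ N) ^ x ∎

-- From the good formulas of one class to all formulas.

markov : ∀ {A : Set} (xs : List A) (f : A → ℕ) (c N : ℕ) →
  ∑ xs (λ x → ⟦ N <ᵇ f x * c ⟧) * N ≤ ∑ xs f * c
markov xs f c N = ≤-trans (≤-reflexive (sym (∑-*ʳ xs _ N))) (≤-trans (∑-mono xs λ x → each (f x * c)) (≤-reflexive (∑-*ʳ xs f c)))
  where
  each : ∀ a → ⟦ N <ᵇ a ⟧ * N ≤ a
  each a with N <ᵇ a in e
  ... | true  = ≤-trans (≤-reflexive (*-identityˡ N)) (<⇒≤ (≤ᵇ-true {suc N} {a} e))
  ... | false = z≤n

<ᵇ-false : ∀ {a b} → (a <ᵇ b) ≡ false → b ≤ a
<ᵇ-false {a} {b} e = s≤s⁻¹ (≤ᵇ-false {suc a} {b} e)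

boolLists : ℕ → List (List Bool)
boolLists l = map Vec.toList (vecs bools l)

∈-boolLists : ∀ xs → xs ∈ boolLists (length xs)
∈-boolLists xs = subst (_∈ boolLists (length xs)) (toList∘fromList xs) (∈-map⁺ Vec.toList (∈-vecs ∈-bools (Vec.fromList xs)))

length-boolLists : ∀ l → length (boolLists l) ≡ 2 ^ l
length-boolLists l = trans (length-map Vec.toList (vecs bools l)) (length-vecs bools l)

not-true : ∀ {b} → not b ≡ true → b ≡ false
not-true {false} _ = refl

module Final (j n M d D₁ J′ J l B q y m₀ s : ℕ) (𝔽 : Fin M → Cl n → Bool) (minimal : ∀ ω → Minimal (𝔽 ω)) where

  K : ℕ
  K = suc (suc j)

  N G x bc n₁ : ℕ
  N  = n choose K
  G  = l * B
  x  = q * B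
  bc = blowConst D₁ (suc K)
  n₁ = suc K * 2

  module _
    (distinct : ∀ {ω ω′} → ω ≢ ω′ → ∃ λ C → ∣ supp C ∣ ≡ K × 𝔽 ω C ≢ 𝔽 ω′ C)
    (1≤d : 1 ≤ d) (1≤n : 1 ≤ n) (1≤G : 1 ≤ G) (1≤N : 1 ≤ N) (1≤x : 1 ≤ x) (1≤s : 1 ≤ s)
    (n> : 2 * bc * (n₁ * n₁) < n)
    (J′> : 2 * bc * ((2 * d) ^ (3 + K) * (3 + K)) < J′)
    (J≥ : 4 * (J′ * (2 ^ K * (2 * d * (2 * d)))) ≤ suc J)
    (d≥ : 4 * (3 * G * 2 ^ K) ≤ d)
    (D₁≥ : m₀ ^ suc K * (2 ^ K * (2 ^ K * 2 ^ K)) * (2 * x) ≤ D₁)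
    (D₁≥′ : 3 * G * (2 ^ K * (2 ^ K * (2 * K !))) ≤ D₁)
    (n^K≤ : n ^ K ≤ 2 * K ! * N)
    (n^K≤′ : n ^ K * (1 + y) ≤ K ! * N * (2 + y))
    (K≤m₀ : K ≤ m₀)
    (adm : ∀ (H : PDG K m₀) → TkFree H → 2 ^ (x * eU H) * 3 ^ (x * eD H) ≤ 2 ^ (y * (m₀ choose K)))
    (s≤ : (s + 1) ^ B ≤ 2 * s ^ B) (Qs≤ : 2 ^ 2 ^ K * s ≤ 2 ^ l)
    {m : ℕ} (W : Vec (Fin n) m) (st : ∑ (tuples n (2 + K)) (λ y → Stability.drops (suc j) n M d 𝔽 y W) * suc J ≤ n ^ (2 + K) * Stability.cap (suc j) n M d 𝔽) where

    open CondExp M d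
    open Conditioned (suc j) n M d 1≤d 𝔽 W using (κ; β; D; atypical; few-atypical; few-light)

    ℓ : ℕ
    ℓ = m * (n ^ suc j * 2 ^ K)

    lightTotal : Ω → ℕ
    lightTotal ω = ∑ₖ n K λ e → ∑ (clOf e) λ C → ⟦ 𝔽 ω C ∧ not (D ω C) ⟧

    manyLight : Ω → Bool
    manyLight ω = N <ᵇ lightTotal ω * (3 * G)

    good : Ω → Bool
    good ω = not (atypical (2 + K) J′ ω) ∧ not (manyLight ω)

    few-bad₁ : 4 * ∑ Ωs (λ ω → ⟦ atypical (2 + K) J′ ω ⟧) ≤ M
    few-bad₁ = *-cancelˡ-≤ Z {{Z≢0}} (begin
      Z * (4 * A₀)     ≡⟨ lem Z A₀ ⟩
      A₀ * (4 * Z)     ≤⟨ *-monoʳ-≤ A₀ J≥ ⟩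
      A₀ * suc J       ≤⟨ few-atypical (2 + K) J′ J 1≤n st ⟩
      Z * M ∎)
      where
      open ≤-Reasoning
      A₀ = ∑ Ωs (λ ω → ⟦ atypical (2 + K) J′ ω ⟧)
      Z = J′ * (2 ^ K * (2 * d * (2 * d)))
      2d≢0 : NonZero (2 * d)
      2d≢0 = m*n≢0 2 d {{_}} {{>-nonZero 1≤d}}
      Z≢0 : NonZero Z
      Z≢0 = m*n≢0 J′ _ {{>-nonZero (≤-trans (s≤s z≤n) J′>)}} {{m*n≢0 (2 ^ K) _ {{m^n≢0 2 K}} {{m*n≢0 (2 * d) (2 * d) {{2d≢0}} {{2d≢0}}}}}}
      lem : ∀ z a → z * (4 * a) ≡ a * (4 * z)
      lem = solve-∀

    ∑-light : d * ∑ Ωs lightTotal ≤ N * (2 ^ K * M)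
    ∑-light = begin
      d * ∑ Ωs lightTotal
        ≡⟨ cong (d *_) (trans (∑-swap Ωs (allSubsets n) _) (∑-cong (allSubsets n) λ e → ∑-*ˡ Ωs ⟦ isKSet K e ⟧ _)) ⟩
      d * ∑ (allSubsets n) (λ e → ⟦ isKSet K e ⟧ * ∑ Ωs (λ ω → ∑ (clOf e) λ C → f ω C))
        ≡⟨ sym (∑-*ˡ (allSubsets n) d _) ⟩
      ∑ (allSubsets n) (λ e → d * (⟦ isKSet K e ⟧ * ∑ Ωs (λ ω → ∑ (clOf e) λ C → f ω C)))
        ≤⟨ ∑-mono (allSubsets n) each ⟩
      ∑ (allSubsets n) (λ e → ⟦ isKSet K e ⟧ * 1 * (2 ^ K * M))
        ≡⟨ trans (∑-*ʳ (allSubsets n) _ (2 ^ K * M)) (cong (_* (2 ^ K * M)) (∑ₖ-count n K)) ⟩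
      N * (2 ^ K * M) ∎
      where
      open ≤-Reasoning
      f : Ω → Cl n → ℕ
      f ω C = ⟦ 𝔽 ω C ∧ not (D ω C) ⟧
      each : ∀ e → d * (⟦ isKSet K e ⟧ * ∑ Ωs (λ ω → ∑ (clOf e) λ C → f ω C)) ≤ ⟦ isKSet K e ⟧ * 1 * (2 ^ K * M)
      each e with isKSet K e in eq
      ... | false = ≤-trans (≤-reflexive (*-zeroʳ d)) z≤n
      ... | true  = begin
        d * (1 * ∑ Ωs (λ ω → ∑ (clOf e) λ C → f ω C))
          ≡⟨ cong (d *_) (trans (*-identityˡ _) (∑-swap Ωs (clOf e) f)) ⟩
        d * ∑ (clOf e) (λ C → ∑ Ωs λ ω → f ω C)
          ≡⟨ sym (∑-*ˡ (clOf e) d _) ⟩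
        ∑ (clOf e) (λ C → d * ∑ Ωs λ ω → f ω C)
          ≤⟨ ∑-bound (clOf e) few-light ⟩
        length (clOf e) * M
          ≡⟨ trans (cong (_* M) (trans (length-clOf e) (cong (2 ^_) (isKSet⇒ K e eq)))) (sym (*-identityˡ _)) ⟩
        1 * (2 ^ K * M) ∎

    few-bad₂ : 4 * ∑ Ωs (λ ω → ⟦ manyLight ω ⟧) ≤ M
    few-bad₂ = *-cancelˡ-≤ (3 * G * 2 ^ K * N) {{Z≢0}} (begin
      3 * G * 2 ^ K * N * (4 * H)       ≡⟨ lem₁ (3 * G * 2 ^ K) N H ⟩
      4 * (3 * G * 2 ^ K) * (H * N)     ≤⟨ *-monoˡ-≤ (H * N) d≥ ⟩
      d * (H * N)                       ≤⟨ *-monoʳ-≤ d (markov Ωs lightTotal (3 * G) N) ⟩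
      d * (∑ Ωs lightTotal * (3 * G))   ≡⟨ sym (*-assoc d (∑ Ωs lightTotal) (3 * G)) ⟩
      d * ∑ Ωs lightTotal * (3 * G)     ≤⟨ *-monoˡ-≤ (3 * G) ∑-light ⟩
      N * (2 ^ K * M) * (3 * G)         ≡⟨ lem₂ N (2 ^ K) M (3 * G) ⟩
      3 * G * 2 ^ K * N * M ∎)
      where
      open ≤-Reasoning
      H = ∑ Ωs (λ ω → ⟦ manyLight ω ⟧)
      Z≢0 : NonZero (3 * G * 2 ^ K * N)
      Z≢0 = m*n≢0 (3 * G * 2 ^ K) N {{m*n≢0 (3 * G) (2 ^ K) {{m*n≢0 3 G {{_}} {{>-nonZero 1≤G}}}} {{m^n≢0 2 K}}}} {{>-nonZero 1≤N}}
      lem₁ : ∀ z n h → z * n * (4 * h) ≡ 4 * z * (h * n)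
      lem₁ = solve-∀
      lem₂ : ∀ n t m g → n * (t * m) * g ≡ g * t * n * m
      lem₂ = solve-∀

    M≤2good : M ≤ 2 * ∑ Ωs (λ ω → ⟦ good ω ⟧)
    M≤2good = *-cancelˡ-≤ 2 (+-cancelʳ-≤ (M + M) _ _ (begin
      2 * M + (M + M)                   ≡⟨ lem₁ M ⟩
      4 * M                             ≡⟨ cong (4 *_) (trans (sym (length-allFin M)) (length≡∑1 Ωs)) ⟩
      4 * ∑ Ωs (λ _ → 1)                ≤⟨ *-monoʳ-≤ 4 (∑-mono Ωs λ ω → cover (atypical (2 + K) J′ ω) (manyLight ω)) ⟩
      4 * ∑ Ωs (λ ω → ⟦ good ω ⟧ + (⟦ atypical (2 + K) J′ ω ⟧ + ⟦ manyLight ω ⟧))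
        ≡⟨ cong (4 *_) (trans (∑-+ Ωs _ _) (cong (∑ Ωs (λ ω → ⟦ good ω ⟧) +_) (∑-+ Ωs _ _))) ⟩
      4 * (g₀ + (∑ Ωs (λ ω → ⟦ atypical (2 + K) J′ ω ⟧) + ∑ Ωs (λ ω → ⟦ manyLight ω ⟧)))
        ≡⟨ lem₂ g₀ (∑ Ωs (λ ω → ⟦ atypical (2 + K) J′ ω ⟧)) (∑ Ωs (λ ω → ⟦ manyLight ω ⟧)) ⟩
      2 * (2 * g₀) + (4 * ∑ Ωs (λ ω → ⟦ atypical (2 + K) J′ ω ⟧) + 4 * ∑ Ωs (λ ω → ⟦ manyLight ω ⟧))
        ≤⟨ +-monoʳ-≤ (2 * (2 * g₀)) (+-mono-≤ few-bad₁ few-bad₂) ⟩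
      2 * (2 * g₀) + (M + M) ∎))
      where
      open ≤-Reasoning
      g₀ = ∑ Ωs (λ ω → ⟦ good ω ⟧)
      lem₁ : ∀ m → 2 * m + (m + m) ≡ 4 * m
      lem₁ = solve-∀
      lem₂ : ∀ g a b → 4 * (g + (a + b)) ≡ 2 * (2 * g) + (4 * a + 4 * b)
      lem₂ = solve-∀
      cover : ∀ a b → 1 ≤ ⟦ not a ∧ not b ⟧ + (⟦ a ⟧ + ⟦ b ⟧)
      cover true  b     = s≤s z≤n
      cover false true  = s≤s z≤n
      cover false false = s≤s z≤n

    inClass : List Bool → Ω → Bool
    inClass a ω = good ω ∧ does (ListP.≡-dec Bool._≟_ (κ ω) a)

    class : List Bool → List Ω
    class a = filterᵇ (inClass a) Ωs

    class-distinct : ∀ a → AllPairs (λ ω ω′ → ∃ λ C → ∣ supp C ∣ ≡ K × 𝔽 ω C ≢ 𝔽 ω′ C) (class a)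
    class-distinct a = AllPairs.filter⁺ _ (AllPairs.tabulate⁺ distinct)

    class-key : ∀ a {ω} → ω ∈ class a → good ω ≡ true × κ ω ≡ a
    class-key a {ω} ω∈ with ∧-true {good ω} (filterᵇ-∈ (inClass a) Ωs ω∈)
    ... | (g , e) with ListP.≡-dec Bool._≟_ (κ ω) a
    ... | yes p = g , p

    ∑-good : ∑ Ωs (λ ω → ⟦ good ω ⟧) ≤ ∑ (boolLists ℓ) (λ a → length (class a))
    ∑-good = begin
      ∑ Ωs (λ ω → ⟦ good ω ⟧)
        ≤⟨ ∑-mono Ωs each ⟩
      ∑ Ωs (λ ω → ∑ (boolLists ℓ) λ a → ⟦ inClass a ω ⟧ * 1)
        ≡⟨ ∑-swap Ωs (boolLists ℓ) _ ⟩
      ∑ (boolLists ℓ) (λ a → ∑ Ωs λ ω → ⟦ inClass a ω ⟧ * 1)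
        ≡⟨ ∑-cong (boolLists ℓ) (λ a → trans (sym (∑-filter (inClass a) Ωs (λ _ → 1))) (sym (length≡∑1 (class a)))) ⟩
      ∑ (boolLists ℓ) (λ a → length (class a)) ∎
      where
      open ≤-Reasoning
      κ∈ : ∀ ω → κ ω ∈ boolLists ℓ
      κ∈ ω = subst (λ z → κ ω ∈ boolLists z) (trans (length-map (𝔽 ω) (touching (suc j) W)) (length-touching (suc j) W)) (∈-boolLists (κ ω))
      each : ∀ ω → ⟦ good ω ⟧ ≤ ∑ (boolLists ℓ) λ a → ⟦ inClass a ω ⟧ * 1
      each ω = ≤-trans (≤-reflexive (sym (trans (*-identityʳ _) (cong ⟦_⟧ (trans (cong (good ω ∧_) (dec-true (ListP.≡-dec Bool._≟_ (κ ω) (κ ω)) refl)) (Bool.∧-identityʳ _))))))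
        (∑-∈ (λ a → ⟦ inClass a ω ⟧ * 1) (κ∈ ω))

    module _ (ω₀ : Ω) (good₀ : good ω₀ ≡ true) where

      typical : β (2 + K) ω₀ * J′ ≤ n ^ (2 + K) * n ^ K * cls κ ω₀
      typical = <ᵇ-false (not-true (proj₁ (∧-true good₀)))

      open RareTypes j n M d 1≤d 𝔽 minimal W ω₀ D₁ J′ using (rare-far; rare-T)
      module CC = ClassCount j 𝔽 (D ω₀) D₁ 1≤n
      module Sam = Sampling j (D ω₀)

      -- The comparison is made after raising to the power `K !`, because `sampling` counts `K`-sets
      -- by ordered tuples and so bounds by `n ^ K` rather than by `N`.
      weights : (2 ^ CC.U * 3 ^ CC.V) ^ x ≤ 2 ^ (N * (2 + y))
      weights = ^-cancelʳ-≤ _ _ (K !) (1≤n! K) (begin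
        ((2 ^ CC.U * 3 ^ CC.V) ^ x) ^ (K !)
          ≡⟨ trans (^-*-assoc (2 ^ CC.U * 3 ^ CC.V) x (K !)) (trans (*-^ (2 ^ CC.U) (3 ^ CC.V) (x * K !))
               (cong₂ _*_ (trans (^-*-assoc 2 CC.U (x * K !)) (cong (2 ^_) (lem CC.U x (K !)))) (trans (^-*-assoc 3 CC.V (x * K !)) (cong (3 ^_) (lem CC.V x (K !)))))) ⟩
        2 ^ (x * (K ! * CC.U)) * 3 ^ (x * (K ! * CC.V))
          ≤⟨ Sam.sampling 1≤n D₁ (λ s t u e → <⇒≤ (rare-T typical n> J′> s t u e)) m₀ x y K≤m₀ D₁≥ adm ⟩
        2 ^ (n ^ K * (y + 1))
          ≤⟨ ^-monoʳ-≤ 2 (≤-trans (≤-reflexive (cong (n ^ K *_) (+-comm y 1))) n^K≤′) ⟩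
        2 ^ (K ! * N * (2 + y))
          ≡⟨ trans (cong (2 ^_) (lem₂ (K !) N (2 + y))) (sym (^-*-assoc 2 (N * (2 + y)) (K !))) ⟩
        (2 ^ (N * (2 + y))) ^ (K !) ∎)
        where
        open ≤-Reasoning
        lem : ∀ u x f → u * (x * f) ≡ x * (f * u)
        lem = solve-∀
        lem₂ : ∀ f n y → f * n * y ≡ n * y * f
        lem₂ = solve-∀

      thin : ∀ c → c * D₁ ≤ 2 ^ K * (2 ^ K * n ^ K) → c * (3 * G) ≤ N
      thin c h = *-cancelʳ-≤ _ _ (2 ^ K * (2 ^ K * (2 * K !))) {{Z≢0}} (begin
        c * (3 * G) * (2 ^ K * (2 ^ K * (2 * K !)))   ≡⟨ *-assoc c (3 * G) _ ⟩
        c * (3 * G * (2 ^ K * (2 ^ K * (2 * K !))))   ≤⟨ *-monoʳ-≤ c D₁≥′ ⟩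
        c * D₁                                        ≤⟨ h ⟩
        2 ^ K * (2 ^ K * n ^ K)                       ≤⟨ *-monoʳ-≤ (2 ^ K) (*-monoʳ-≤ (2 ^ K) n^K≤) ⟩
        2 ^ K * (2 ^ K * (2 * K ! * N))               ≡⟨ lem (2 ^ K) (2 * K !) N ⟩
        N * (2 ^ K * (2 ^ K * (2 * K !))) ∎)
        where
        open ≤-Reasoning
        lem : ∀ t f n → t * (t * (f * n)) ≡ n * (t * (t * f))
        lem = solve-∀
        Z≢0 : NonZero (2 ^ K * (2 ^ K * (2 * K !)))
        Z≢0 = m*n≢0 (2 ^ K) _ {{m^n≢0 2 K}} {{m*n≢0 (2 ^ K) _ {{m^n≢0 2 K}} {{m*n≢0 2 (K !) {{_}} {{K !≢0}}}}}}

      -- Far sets, light clauses and double clauses may each take a third of the budget `N / G`,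
      -- whence the `3 * G` in all thresholds. Far sets are determined by `ω₀`, while light and
      -- double clauses are those of the formula `ω`.
      few-abnormal : ∀ ω → good ω ≡ true → κ ω ≡ κ ω₀ → ∑ₖ n K (CC.abnormal ω) * G ≤ N
      few-abnormal ω gω eq = *-cancelˡ-≤ 3 (begin
        3 * (∑ₖ n K (CC.abnormal ω) * G)
          ≡⟨ lem₁ (∑ₖ n K (CC.abnormal ω)) G ⟩
        ∑ₖ n K (CC.abnormal ω) * (3 * G)
          ≤⟨ *-monoˡ-≤ (3 * G) (∑-mono (allSubsets n) λ e → *-monoʳ-≤ ⟦ isKSet K e ⟧ (Ab.abnormal≤ e)) ⟩
        ∑ₖ n K (λ e → ⟦ Ab.far-edge e ⟧ + Ab.light e + ⟦ Ab.double e ⟧) * (3 * G)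
          ≡⟨ cong (_* (3 * G)) (trans (∑-cong (allSubsets n) λ e → lem₂ ⟦ isKSet K e ⟧ ⟦ Ab.far-edge e ⟧ (Ab.light e) ⟦ Ab.double e ⟧)
               (trans (∑-+ (allSubsets n) _ _) (cong (∑ₖ n K (λ e → ⟦ Ab.far-edge e ⟧) +_) (∑-+ (allSubsets n) _ _)))) ⟩
        (∑ₖ n K (λ e → ⟦ Ab.far-edge e ⟧) + (∑ₖ n K Ab.light + ∑ₖ n K (λ e → ⟦ Ab.double e ⟧))) * (3 * G)
          ≡⟨ lem₃ (∑ₖ n K (λ e → ⟦ Ab.far-edge e ⟧)) (∑ₖ n K Ab.light) (∑ₖ n K (λ e → ⟦ Ab.double e ⟧)) (3 * G) ⟩
        ∑ₖ n K (λ e → ⟦ Ab.far-edge e ⟧) * (3 * G) + (∑ₖ n K Ab.light * (3 * G) + ∑ₖ n K (λ e → ⟦ Ab.double e ⟧) * (3 * G))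
          ≤⟨ +-mono-≤ (thin (∑ₖ n K (λ e → ⟦ Ab.far-edge e ⟧)) (Ab.∑-far λ s t far → <⇒≤ (rare-far typical n> J′> far))) (+-mono-≤ light≤
               (thin (∑ₖ n K (λ e → ⟦ Ab.double e ⟧)) (Ab.∑-double λ s t ne → <⇒≤ (rare-double D₁ (𝔽 ω) (minimal ω) ne n>)))) ⟩
        N + (N + N)
          ≡⟨ lem₄ N ⟩
        3 * N ∎)
        where
        open ≤-Reasoning
        module Ab = Abnormal j (D ω₀) (𝔽 ω) D₁ 1≤n
        lem₁ : ∀ a g → 3 * (a * g) ≡ a * (3 * g)
        lem₁ = solve-∀
        lem₂ : ∀ k a b c → k * (a + b + c) ≡ k * a + (k * b + k * c)
        lem₂ = solve-∀
        lem₃ : ∀ a b c g → (a + (b + c)) * g ≡ a * g + (b * g + c * g)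
        lem₃ = solve-∀
        lem₄ : ∀ n → n + (n + n) ≡ 3 * n
        lem₄ = solve-∀
        -- Likeliness depends on the class only, so the bound on light clauses that `good ω` gives
        -- for `D ω` is valid for `D ω₀`.
        same : ∀ C → D ω₀ C ≡ D ω C
        same C = cong (2 * M ! ≤ᵇ_) (P-inv κ (λ ω → ⟦ 𝔽 ω C ⟧) ω₀ ω (sym eq))
        light≤ : ∑ₖ n K Ab.light * (3 * G) ≤ N
        light≤ = ≤-trans (≤-reflexive (cong (_* (3 * G)) (∑-cong (allSubsets n) λ e → cong (⟦ isKSet K e ⟧ *_) (∑-cong (clOf e) λ C → cong (λ b → ⟦ 𝔽 ω C ∧ not b ⟧) (same C)))))
          (<ᵇ-false (not-true (proj₂ (∧-true {not (atypical (2 + K) J′ ω)} gω))))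

    private instance
      nzG : NonZero G
      nzG = >-nonZero 1≤G

    class-bound : ∀ a → length (class a) ^ x ≤ 2 ^ (N * (2 + y + 2 * q))
    class-bound a = go (class a) refl
      where
      0^x : ∀ x → 1 ≤ x → 0 ^ x ≡ 0
      0^x (suc x) _ = refl
      go : ∀ Ws → class a ≡ Ws → length (class a) ^ x ≤ 2 ^ (N * (2 + y + 2 * q))
      go []       e rewrite e | 0^x x 1≤x = z≤n
      -- Any member can represent its class, since all members are good and share their likely
      -- clauses; `N / G` is the number of exceptional sets allowed to each formula.
      go (ω₀ ∷ _) e = root-bound {w = length (class a)} {s} {N} {2 ^ 2 ^ K} {N / G} {_} {B} {q} {y} {l} 1≤s
          (CC.class-count ω₀ g₀ s (N / G) (class a) (class-distinct a) few 1≤s) (weights ω₀ g₀) s≤ Qs≤ (m/n*n≤m N G)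
        where
        ω₀∈ : ω₀ ∈ class a
        ω₀∈ = subst (ω₀ ∈_) (sym e) (here refl)
        g₀ = proj₁ (class-key a ω₀∈)
        few : ∀ ω → ω ∈ class a → ∑ₖ n K (CC.abnormal ω₀ g₀ ω) ≤ N / G
        few ω ω∈ = ≤-trans (≤-reflexive (sym (m*n/n≡m _ G))) (/-monoˡ-≤ G (few-abnormal ω₀ g₀ ω (proj₁ (class-key a ω∈))
          (trans (proj₂ (class-key a ω∈)) (sym (proj₂ (class-key a ω₀∈))))))

    -- In `1 + ℓ` the 1 pays for restricting to good formulas, at least half of all, and the `ℓ`
    -- bits for naming the largest class by its revealed key.
    total : M ^ x ≤ 2 ^ (x * (1 + ℓ) + N * (2 + y + 2 * q))
    total = begin
      M ^ x
        ≤⟨ ^-monoˡ-≤ x (≤-trans M≤2good (*-monoʳ-≤ 2 (≤-trans ∑-good (proj₂ biggest)))) ⟩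
      (2 * (length (boolLists ℓ) * w)) ^ x
        ≡⟨ cong (λ z → (2 * (z * w)) ^ x) (length-boolLists ℓ) ⟩
      (2 * (2 ^ ℓ * w)) ^ x
        ≡⟨ trans (cong (_^ x) (sym (*-assoc 2 (2 ^ ℓ) w))) (*-^ (2 ^ suc ℓ) w x) ⟩
      (2 ^ suc ℓ) ^ x * w ^ x
        ≤⟨ *-mono-≤ (≤-reflexive (trans (^-*-assoc 2 (suc ℓ) x) (cong (2 ^_) (*-comm (suc ℓ) x)))) (class-bound (proj₁ biggest)) ⟩
      2 ^ (x * (1 + ℓ)) * 2 ^ (N * (2 + y + 2 * q))
        ≡⟨ sym (^-distribˡ-+-* 2 (x * (1 + ℓ)) _) ⟩
      2 ^ (x * (1 + ℓ) + N * (2 + y + 2 * q)) ∎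
      where
      open ≤-Reasoning
      biggest = ∑-max (boolLists ℓ) (λ a → length (class a)) (subst (1 ≤_) (sym (length-boolLists ℓ)) (m^n>0 2 ℓ))
      w = length (class (proj₁ biggest))

-- Choice of the constants, and conclusion.

m≤2^m : ∀ m → m ≤ 2 ^ m
m≤2^m zero    = z≤n
m≤2^m (suc m) = ≤-trans (+-mono-≤ (m^n>0 2 m) (m≤2^m m)) (≤-reflexive (cong (2 ^ m +_) (sym (+-identityʳ _))))

module Parameters (j p q b N₀ : ℕ) where
  K B x y m₀ n₁ : ℕ
  K  = suc (suc j)
  -- The total exponent will be `N * (6 * p * b + 3 * q + 3)`. Besides the main term, `q` comes from
  -- the admissible bound with error `1 / (6 * b)`, `2 * q` from exceptional sets and slack, 2 from
  -- copies of `T_k` and from replacing `n ^ K` by `K ! * N`, and 1 from the revealed clauses and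
  -- the bad formulas. As `a` and `q` are positive, this is at most `6 * N * (p * b + a * q)`.
  B  = 6 * b
  x  = q * B
  y  = p * B + 1 * q
  -- Large enough for the admissible bound, and for `m₀ choose K` to be positive.
  m₀ = N₀ + K
  n₁ = suc K * 2

  abstract
    s l d D₁ J′ J n-min : ℕ
    -- Each constant depends on those above it and on the parameters of the module, never on `n`.
    -- The choice `s + 1 = 2 * B` makes `((s + 1) / s) ^ B ≤ 2`, and `l` is such that
    -- `2 ^ 2 ^ K * s ≤ 2 ^ l`.
    s  = pred (2 * B)
    l  = 2 ^ K + 2 * B
    d  = 4 * (3 * (l * B) * 2 ^ K)
    D₁ = m₀ ^ suc K * (2 ^ K * (2 ^ K * 2 ^ K)) * (2 * x) + 3 * (l * B) * (2 ^ K * (2 ^ K * (2 * K !)))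
    J′ = suc (2 * blowConst D₁ (suc K) * ((2 * d) ^ (3 + K) * (3 + K)))
    J  = 4 * (J′ * (2 ^ K * (2 * d * (2 * d))))
    -- The summands serve in turn to make blow-ups with repeated vertices negligible, to compare
    -- `n ^ K` with `K ! * N`, to make the revealed bits cost at most `N`, and to have `K ≤ n`.
    n-min = suc (2 * blowConst D₁ (suc K) * (n₁ * n₁)) + (K * K * (2 + y) + (2 * K ! * (x * (1 + J * (2 + K) * 2 ^ K)) + K))

    s≡ : s ≡ pred (2 * B)
    s≡ = refl

    l≡ : l ≡ 2 ^ K + 2 * B
    l≡ = refl

    d≡ : d ≡ 4 * (3 * (l * B) * 2 ^ K)
    d≡ = refl

    D₁≡ : D₁ ≡ m₀ ^ suc K * (2 ^ K * (2 ^ K * 2 ^ K)) * (2 * x) + 3 * (l * B) * (2 ^ K * (2 ^ K * (2 * K !)))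
    D₁≡ = refl

    J′≡ : J′ ≡ suc (2 * blowConst D₁ (suc K) * ((2 * d) ^ (3 + K) * (3 + K)))
    J′≡ = refl

    J≡ : J ≡ 4 * (J′ * (2 ^ K * (2 * d * (2 * d))))
    J≡ = refl

    n-min≡ : n-min ≡ suc (2 * blowConst D₁ (suc K) * (n₁ * n₁)) + (K * K * (2 + y) + (2 * K ! * (x * (1 + J * (2 + K) * 2 ^ K)) + K))
    n-min≡ = refl

module Main (j p q b N₀ : ℕ) (1≤q : 1 ≤ q) (1≤b : 1 ≤ b) where
  open Parameters j p q b N₀

  module _
    (adm : ∀ n → N₀ ≤ n → (H : PDG K n) → TkFree H → 2 ^ (x * eU H) * 3 ^ (x * eD H) ≤ 2 ^ (y * (n choose K)))
    (n : ℕ) (n≥ : n-min ≤ n) (L : List (BoolFun n)) (isKSAT : ListAll.All (IsKSAT K) L) (distinct : AllPairs Distinct L) where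

    N M : ℕ
    N = n choose K
    M = length L

    F : (ω : Fin M) → MinimalFormula K (List.lookup L ω)
    F ω = minimalFormula (List.lookup L ω) (ListAll.lookup isKSAT (∈-lookup ω))

    𝔽 : Fin M → Cl n → Bool
    𝔽 ω = MinimalFormula.formula (F ω)

    separate : ∀ {ω ω′} → ω ≢ ω′ → ∃ λ C → ∣ supp C ∣ ≡ K × 𝔽 ω C ≢ 𝔽 ω′ C
    separate {ω} {ω′} ne = distinguish (F ω) (F ω′) (AllPairs-lookup (λ (a , q) → a , λ e → q (sym e)) L distinct ne)

    1≤B : 1 ≤ B
    1≤B = *-mono-≤ {1} {6} (s≤s z≤n) 1≤b

    s+1 : suc s ≡ 2 * B
    s+1 = trans (cong suc s≡) (suc-pred (2 * B) {{m*n≢0 2 B {{_}} {{>-nonZero 1≤B}}}})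

    1≤l : 1 ≤ l
    1≤l = ≤-trans (m^n>0 2 K) (≤-trans (m≤m+n _ (2 * B)) (≤-reflexive (sym l≡)))

    1≤G : 1 ≤ l * B
    1≤G = *-mono-≤ 1≤l 1≤B

    1≤d : 1 ≤ d
    1≤d = ≤-trans (*-mono-≤ {1} {4} (s≤s z≤n) (*-mono-≤ {1} {3 * (l * B)} (*-mono-≤ {1} {3} (s≤s z≤n) 1≤G) (m^n>0 2 K))) (≤-reflexive (sym d≡))

    1≤s : 1 ≤ s
    1≤s = s≤s⁻¹ (subst (2 ≤_) (sym s+1) (*-monoʳ-≤ 2 1≤B))

    n≥′ = subst (_≤ n) n-min≡ n≥

    n≥₁ : 2 * blowConst D₁ (suc K) * (n₁ * n₁) < n
    n≥₁ = ≤-trans (m≤m+n _ _) n≥′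

    rest≤ : K * K * (2 + y) + (2 * K ! * (x * (1 + J * (2 + K) * 2 ^ K)) + K) ≤ n
    rest≤ = ≤-trans (m≤n+m _ (suc (2 * blowConst D₁ (suc K) * (n₁ * n₁)))) n≥′

    n≥₂ : K * K * (2 + y) ≤ n
    n≥₂ = ≤-trans (m≤m+n _ _) rest≤

    rest≤′ : 2 * K ! * (x * (1 + J * (2 + K) * 2 ^ K)) + K ≤ n
    rest≤′ = ≤-trans (m≤n+m _ (K * K * (2 + y))) rest≤

    n≥₃ : 2 * K ! * (x * (1 + J * (2 + K) * 2 ^ K)) ≤ n
    n≥₃ = ≤-trans (m≤m+n _ K) rest≤′

    K≤n : K ≤ n
    K≤n = ≤-trans (m≤n+m K (2 * K ! * (x * (1 + J * (2 + K) * 2 ^ K)))) rest≤′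

    1≤n : 1 ≤ n
    1≤n = ≤-trans (s≤s z≤n) K≤n

    n^K≤ : n ^ K ≤ 2 * K ! * N
    n^K≤ = ≤-trans (≤-reflexive (sym (*-identityʳ _))) (≤-trans (n^k≈k!*choose n K 0 1≤n (≤-trans (*-monoʳ-≤ (K * K) (m≤m+n 2 y)) n≥₂))
      (≤-reflexive (lem (K !) N)))
      where
      lem : ∀ f n → f * n * 2 ≡ 2 * f * n
      lem = solve-∀

    Qs≤ : 2 ^ 2 ^ K * s ≤ 2 ^ l
    Qs≤ = ≤-trans (*-monoʳ-≤ (2 ^ 2 ^ K) (≤-trans (≤-trans (n≤1+n s) (≤-reflexive s+1)) (m≤2^m (2 * B)))) (≤-reflexive (trans (sym (^-distribˡ-+-* 2 (2 ^ K) (2 * B))) (cong (2 ^_) (sym l≡))))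

    small : ∀ m → m ≤ J * (2 + K) → x * (1 + m * (n ^ suc j * 2 ^ K)) ≤ N
    small m m≤ = *-cancelˡ-≤ (2 * K !) {{m*n≢0 2 (K !) {{_}} {{K !≢0}}}} (begin
      2 * K ! * (x * (1 + m * (n ^ suc j * 2 ^ K)))
        ≤⟨ *-monoʳ-≤ (2 * K !) (*-monoʳ-≤ x (+-mono-≤ (m^n>0 n {{>-nonZero 1≤n}} (suc j)) (*-monoˡ-≤ (n ^ suc j * 2 ^ K) m≤))) ⟩
      2 * K ! * (x * (n ^ suc j + J * (2 + K) * (n ^ suc j * 2 ^ K)))
        ≡⟨ lem (2 * K !) x (n ^ suc j) (J * (2 + K)) (2 ^ K) ⟩
      2 * K ! * (x * (1 + J * (2 + K) * 2 ^ K)) * n ^ suc j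
        ≤⟨ *-monoˡ-≤ (n ^ suc j) n≥₃ ⟩
      n ^ K
        ≤⟨ n^K≤ ⟩
      2 * K ! * N ∎)
      where
      open ≤-Reasoning
      lem : ∀ f x a c t → f * (x * (a + c * (a * t))) ≡ f * (x * (1 + c * t)) * a
      lem = solve-∀

    bound : M ^ x ≤ 2 ^ (N + N * (2 + y + 2 * q))
    bound = from-stable (Stability.stable (suc j) n M d 𝔽 (2 + K) J 1≤n)
      where
      from-stable : (∃ λ m → m ≤ J * (2 + K) × Σ (Vec (Fin n) m) λ W → ∑ (tuples n (2 + K)) (λ y → Stability.drops (suc j) n M d 𝔽 y W) * suc J
        ≤ n ^ (2 + K) * Stability.cap (suc j) n M d 𝔽) → M ^ x ≤ 2 ^ (N + N * (2 + y + 2 * q))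
      from-stable (m , m≤ , W , st) = ≤-trans
        (Final.total j n M d D₁ J′ J l B q y m₀ s 𝔽 (λ ω → MinimalFormula.minimal (F ω)) separate 1≤d 1≤n 1≤G (choose-pos n K K≤n)
          (*-mono-≤ 1≤q 1≤B) 1≤s n≥₁ (≤-reflexive (sym J′≡)) (≤-trans (≤-reflexive (sym J≡)) (n≤1+n J)) (≤-reflexive (sym d≡))
          (≤-trans (m≤m+n _ _) (≤-reflexive (sym D₁≡))) (≤-trans (m≤n+m _ (m₀ ^ suc K * (2 ^ K * (2 ^ K * 2 ^ K)) * (2 * x))) (≤-reflexive (sym D₁≡))) n^K≤
          (n^k≈k!*choose n K y 1≤n n≥₂) (m≤n+m K N₀) (adm m₀ (m≤m+n N₀ K))
          (subst (λ z → z ^ B ≤ 2 * s ^ B) (+-comm 1 s) ([1+1/t]^B≤2 B s s+1)) Qs≤ W st)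
        (^-monoʳ-≤ 2 (+-monoˡ-≤ (N * (2 + y + 2 * q)) (small m m≤)))

    conclusion : ∀ a → 1 ≤ a → M ^ (q * b) ≤ 2 ^ ((p * b + a * q) * N)
    conclusion a 1≤a = ^-cancelʳ-≤ (M ^ (q * b)) (2 ^ ((p * b + a * q) * N)) 6 (s≤s z≤n) (begin
      (M ^ (q * b)) ^ 6              ≡⟨ trans (^-*-assoc M (q * b) 6) (cong (M ^_) (lem₁ q b)) ⟩
      M ^ x                          ≤⟨ bound ⟩
      2 ^ (N + N * (2 + y + 2 * q))  ≤⟨ ^-monoʳ-≤ 2 exponent ⟩
      2 ^ ((p * b + a * q) * N * 6)  ≡⟨ sym (^-*-assoc 2 ((p * b + a * q) * N) 6) ⟩
      (2 ^ ((p * b + a * q) * N)) ^ 6 ∎)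
      where
      open ≤-Reasoning
      lem₁ : ∀ q b → q * b * 6 ≡ q * (6 * b)
      lem₁ = solve-∀
      lem₂ : ∀ N p b q → N + N * (2 + (p * (6 * b) + 1 * q) + 2 * q) ≡ N * (p * b * 6 + q * 3 + 3)
      lem₂ = solve-∀
      lem₃ : ∀ N p b r → N * (p * b * 6 + r * 3 + r * 3) ≡ (p * b + r) * N * 6
      lem₃ = solve-∀
      q≤aq : q ≤ a * q
      q≤aq = m≤n*m q a {{>-nonZero 1≤a}}
      exponent : N + N * (2 + y + 2 * q) ≤ (p * b + a * q) * N * 6
      exponent = begin
        N + N * (2 + y + 2 * q)                       ≡⟨ lem₂ N p b q ⟩
        N * (p * b * 6 + q * 3 + 3)                   ≤⟨ *-monoʳ-≤ N (+-mono-≤ (+-monoʳ-≤ (p * b * 6) (*-monoˡ-≤ 3 q≤aq)) (*-monoˡ-≤ 3 (≤-trans 1≤q q≤aq))) ⟩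
        N * (p * b * 6 + a * q * 3 + a * q * 3)       ≡⟨ lem₃ N p b (a * q) ⟩
        (p * b + a * q) * N * 6 ∎

open import Data.Nat.Combinatorics using (_C_)

theorem1p16 : (k : ℕ) → 2 ≤ k → (p q : ℕ) → 1 ≤ q → AdmissibleT k p q →
    (a b : ℕ) → 1 ≤ a → 1 ≤ b → Σ ℕ λ N → ∀ n → N ≤ n →
    (L : List (BoolFun n)) → DistinctKSATList k n L →
    length L ^ (q * b) ≤ 2 ^ ((p * b + a * q) * (n C k))
theorem1p16 (suc (suc j)) (s≤s (s≤s _)) p q 1≤q adm a b 1≤a 1≤b with adm 1 (6 * b) ≤-refl (≤-trans 1≤b (m≤n*m b 6))
... | (N₀ , adm₀) = Parameters.n-min j p q b N₀ , λ n n≥ L (isKSAT , distinct) →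
  Main.conclusion j p q b N₀ 1≤q 1≤b adm₀ n n≥ L isKSAT distinct a 1≤a
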